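{- Let $n\ge2$. Then \[\mathrm{span}\{V_{k,n}^+,V_{k,n}^-:k\ge1\}=\mathrm{span}\{V_{k,n}^+,V_{k,n}^-:1\le k<n\}=\mathcal{W}_n^{\pm}\] is an algebra under the internal product, and the following are five commutative subalgebras of $\mathcal{W}_n^\pm$: \begin{align*} \mathrm{span}\{V_{k,n}:k\ge1\}&=\mathrm{span}\{V_{k,n}:1\le k<n\}=\mathcal{W}_n,\\ \mathrm{span}\{V^+_{k,n}:k\ge1\}&=\mathrm{span}\{V^+_{k,n}:1\le k\le n\}=\mathcal{W}^\circ_n,\\ \mathrm{span}\{V^-_{2k,n}:k\ge1\}&=\mathrm{span}\{V^-_{2k,n}:1\le 2k\le n+1\}=\mathcal{P}_n,\\ \mathrm{span}\{V^+_{2k+1,n}:k\ge0\}&=\mathrm{span}\{V^+_{2k+1,n}:1\le 2k+1\le n+1\}=\mathcal{P}^\circ_n,\\ \mathrm{span}\{V^+_{2k+1,n},V^-_{2k+1,n},V_{2k,n}:k\ge0\}&=\mathrm{span}\{V^+_{2k+1,n},V^-_{2k+1,n},V_{2l,n}:1\le 2k+1<n,\ 1\le 2l<n\}=\mathcal{C}_n. \end{align*} Furthermore, $\mathcal{P}^\circ_n$ is central in $\mathcal{W}_n^\pm$.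
   Context: Compositions, descent sets: a composition $I=(i_1,\dots,i_r)$ of $n$ has descent set $\{i_1,\dots,i_1+\dots+i_{r-1}\}$. $\mathbf{Sym}=\bigoplus_n\mathbf{Sym}_n$ is the algebra of noncommutative symmetric functions over $\mathbb{Q}$ with ribbon basis $R_I$; $\mathbf{Sym}_n$ is identified with the descent algebra $\mathcal{D}_n\subseteq\mathbb{Q}[\mathfrak{S}_n]$ via $R_I\mapsto\sum\{\sigma:\mathrm{Des}(\sigma)=\text{descent set of }I\}$, $\mathrm{Des}(\sigma)=\{i:\sigma(i)>\sigma(i+1)\}$. The internal product is the product of $\mathbb{Q}[\mathfrak{S}_n]$ (with $(\alpha\beta)(i)=\alpha(\beta(i))$) in each degree, zero between different degrees. The external product is $R_{(i_1,\dots,i_r)}\star R_{(j_1,\dots,j_s)}=R_{(i_1,\dots,i_r,j_1,\dots,j_s)}+R_{(i_1,\dots,i_{r-1},i_r+j_1,j_2,\dots,j_s)}$, $R_\emptyset=1$; both products extend degreewise to the completion $\widehat{\mathbf{Sym}}$. Define $V_1^+=\sum_{i\ge0}R_{(i)}$, $V_1^-=\sum_{i\ge0}R_{(1^i)}$, $V_{2k}^+=(V_1^+\star V_1^-)^{\star k}$, $V_{2k}^-=(V_1^-\star V_1^+)^{\star k}$, $V_{2k+1}^+=V_1^+\star(V_1^-\star V_1^+)^{\star k}$, $V_{2k+1}^-=V_1^-\star(V_1^+\star V_1^-)^{\star k}$, $V_k=V_k^++V_k^-$; $V_{k,n}^\pm,V_{k,n}$ denote degree-$n$ components. For $\sigma\in\mathfrak{S}_n$: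 an alternating run is a maximal monotone sequence of consecutive entries of $\sigma(1),\dots,\sigma(n)$, $\mathrm{run}(\sigma)$ their number; a left run is defined the same way for $\sigma(0),\sigma(1),\dots,\sigma(n)$ with $\sigma(0)=0$, $\mathrm{run}^\circ(\sigma)$ their number. $W_{k,n}^+$ (resp. $W_{k,n}^-$) is the sum of $\sigma\in\mathfrak{S}_n$ with $\mathrm{run}(\sigma)=k$ and first run ascending (resp. descending), $W_{k,n}=W_{k,n}^++W_{k,n}^-$, $W^\circ_{k,n}$ the sum of $\sigma$ with $\mathrm{run}^\circ(\sigma)=k$. Then $\mathcal{W}_n^\pm=\mathrm{span}\{W_{k,n}^\pm:1\le k\le n-1\}$, $\mathcal{W}_n=\mathrm{span}\{W_{k,n}:1\le k\le n-1\}$, $\mathcal{W}_n^\circ=\mathrm{span}\{W^\circ_{k,n}:1\le k\le n\}$, $\mathcal{C}_n=\mathrm{span}\{W_{2k,n}\}\oplus\mathrm{span}\{W^+_{2k-1,n},W^-_{2k-1,n}\}$ (over the nonzero ones). A peak of $\sigma$ is $i$, $2\le i\le n-1$, with $\sigma(i-1)<\sigma(i)>\sigma(i+1)$; a left peak is $i$, $1\le i\le n-1$, with the same condition and $\sigma(0)=0$; $\mathcal{P}_n$ (resp. $\mathcal{P}_n^\circ$) is spanned by the sums of permutations with a given number of peaks (resp. left peaks). -}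

module Defs where

open import Data.Bool using (Bool; true; false; if_then_else_; _∧_; _∨_; not)
open import Data.Nat as ℕ using (ℕ; zero; suc; _∸_; _<ᵇ_; _≡ᵇ_; _≤ᵇ_)
open import Data.Nat.DivMod using (_%_; _/_)
open import Data.Fin using (Fin; toℕ) renaming (_≟_ to _≟F_)
open import Data.Fin.Base using (Fin)
open import Data.Vec as Vec using (Vec; []; _∷_; lookup; tabulate)
import Data.Vec.Properties as VecP
open import Data.List as List using (List; []; _∷_; _++_; concatMap; upTo; filterᵇ; replicate; zipWith; foldr)
import Data.List.Properties as ListP
import Data.List.Relation.Unary.Unique.DecPropositional as U
open import Data.List.Membership.Propositional using (_∈_)
open import Data.Rational using (ℚ; 0ℚ; 1ℚ; _+_; _*_)
open import Data.Product using (_×_; _,_; ∃-syntax)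
open import Relation.Nullary.Decidable using (⌊_⌋)
open import Relation.Binary.PropositionalEquality using (_≡_)

-- Symmetric group S_n.  A permutation σ of {1,…,n} is stored as the
-- vector of its values, with value j ∈ Fin n standing for j+1.

Word : ℕ → Set
Word n = Vec (Fin n) n

words : (n k : ℕ) → List (Vec (Fin n) k)
words n zero    = [] ∷ []
words n (suc k) = concatMap (λ i → List.map (i ∷_) (words n k)) (List.allFin n)

perms : (n : ℕ) → List (Word n)
perms n = filterᵇ (λ v → ⌊ U.unique? (_≟F_ {n}) (Vec.toList v) ⌋) (words n n)

compose : {n : ℕ} → Word n → Word n → Word n
compose α β = tabulate (λ i → lookup α (lookup β i))

_==W_ : {n : ℕ} → Word n → Word n → Bool
α ==W β = ⌊ VecP.≡-dec _≟F_ α β ⌋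

seqOf : {n : ℕ} → Word n → List ℕ
seqOf σ = Vec.toList (Vec.map (λ x → suc (toℕ x)) σ)

seq0Of : {n : ℕ} → Word n → List ℕ
seq0Of σ = 0 ∷ seqOf σ

-- The group algebra ℚ[S_n]: an element is its coefficient function
-- (only the values on permutations matter).

A : ℕ → Set
A n = Word n → ℚ

sumℚ : List ℚ → ℚ
sumℚ = foldr _+_ 0ℚ

_≈_ : {n : ℕ} → A n → A n → Set
_≈_ {n} a b = (σ : Word n) → σ ∈ perms n → a σ ≡ b σ

_⊕_ : {n : ℕ} → A n → A n → A n
(a ⊕ b) σ = a σ + b σ

-- internal product = product of ℚ[S_n]
_⊛_ : {n : ℕ} → A n → A n → A n
_⊛_ {n} a b τ =
  sumℚ (concatMap (λ α → concatMap (λ β →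
          if compose α β ==W τ then (a α * b β) ∷ [] else [])
        (perms n)) (perms n))

ind : Bool → ℚ
ind true  = 1ℚ
ind false = 0ℚ

descents : ℕ → List ℕ → List ℕ
descents i (x ∷ y ∷ r) = (if y <ᵇ x then i ∷ [] else []) ++ descents (suc i) (y ∷ r)
descents i _ = []

Des : {n : ℕ} → Word n → List ℕ
Des σ = descents 1 (seqOf σ)

turns : List ℕ → ℕ
turns (x ∷ y ∷ z ∷ r) =
  (if ((x <ᵇ y) ∧ (z <ᵇ y)) ∨ ((y <ᵇ x) ∧ (y <ᵇ z)) then 1 else 0) ℕ.+ turns (y ∷ z ∷ r)
turns _ = 0

-- number of alternating runs (maximal monotone segments) of a sequence
-- of length ≥ 2 : consecutive runs meet exactly at the turning points
runs : List ℕ → ℕ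
runs a = suc (turns a)

firstAsc : List ℕ → Bool
firstAsc (x ∷ y ∷ _) = x <ᵇ y
firstAsc _ = false

peaks : List ℕ → ℕ
peaks (x ∷ y ∷ z ∷ r) = (if (x <ᵇ y) ∧ (z <ᵇ y) then 1 else 0) ℕ.+ peaks (y ∷ z ∷ r)
peaks _ = 0

run : {n : ℕ} → Word n → ℕ
run σ = runs (seqOf σ)

run° : {n : ℕ} → Word n → ℕ
run° σ = runs (seq0Of σ)

pk : {n : ℕ} → Word n → ℕ
pk σ = peaks (seqOf σ)

pk° : {n : ℕ} → Word n → ℕ
pk° σ = peaks (seq0Of σ)

W⁺ W⁻ W W° Pk Pk° : (n k : ℕ) → A n
W⁺ n k σ = ind ((run σ ≡ᵇ k) ∧ firstAsc (seqOf σ))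
W⁻ n k σ = ind ((run σ ≡ᵇ k) ∧ not (firstAsc (seqOf σ)))
W  n k σ = ind (run σ ≡ᵇ k)
W° n k σ = ind (run° σ ≡ᵇ k)
Pk n k σ = ind (pk σ ≡ᵇ k)
Pk° n k σ = ind (pk° σ ≡ᵇ k)

-- Noncommutative symmetric functions in the ribbon basis.
-- A homogeneous element is a formal sum of (coefficient, composition);
-- an element of the completion is given by its homogeneous components.

FS : Set
FS = List (ℚ × List ℕ)

Series : Set
Series = ℕ → FS

glue : List ℕ → List ℕ → List ℕ
glue [] J = J
glue (i ∷ []) [] = i ∷ []
glue (i ∷ []) (j ∷ J) = (i ℕ.+ j) ∷ J
glue (i ∷ i′ ∷ I) J = i ∷ glue (i′ ∷ I) J

ribProd : List ℕ → List ℕ → FS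
ribProd [] J = (1ℚ , J) ∷ []
ribProd (i ∷ I) [] = (1ℚ , i ∷ I) ∷ []
ribProd (i ∷ I) (j ∷ J) = (1ℚ , (i ∷ I) ++ (j ∷ J)) ∷ (1ℚ , glue (i ∷ I) (j ∷ J)) ∷ []

fsProd : FS → FS → FS
fsProd f g = concatMap (λ { (c , I) → concatMap (λ { (d , J) →
  List.map (λ { (e , K) → (c * d * e , K) }) (ribProd I J) }) g }) f

_⋆_ : Series → Series → Series
(F ⋆ G) m = concatMap (λ p → fsProd (F p) (G (m ∸ p))) (upTo (suc m))

oneS : Series
oneS zero = (1ℚ , []) ∷ []
oneS (suc m) = []

_^⋆_ : Series → ℕ → Series
F ^⋆ zero = oneS
F ^⋆ suc k = F ⋆ (F ^⋆ k)

-- V_1^+ = Σ_{i≥0} R_(i)   (R_(0) = R_∅ = 1)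
V₁⁺ : Series
V₁⁺ zero = (1ℚ , []) ∷ []
V₁⁺ (suc i) = (1ℚ , suc i ∷ []) ∷ []

V₁⁻ : Series
V₁⁻ i = (1ℚ , replicate i 1) ∷ []

V⁺S V⁻S : ℕ → Series
V⁺S k = pick (k % 2)
  where pick : ℕ → Series
        pick zero    = (V₁⁺ ⋆ V₁⁻) ^⋆ (k / 2)
        pick (suc _) = V₁⁺ ⋆ ((V₁⁻ ⋆ V₁⁺) ^⋆ (k / 2))
V⁻S k = pick (k % 2)
  where pick : ℕ → Series
        pick zero    = (V₁⁻ ⋆ V₁⁺) ^⋆ (k / 2)
        pick (suc _) = V₁⁻ ⋆ ((V₁⁺ ⋆ V₁⁻) ^⋆ (k / 2))

descSetAux : ℕ → List ℕ → List ℕ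
descSetAux s [] = []
descSetAux s (j ∷ J) = s ∷ descSetAux (s ℕ.+ j) J

descSet : List ℕ → List ℕ
descSet [] = []
descSet (i ∷ I) = descSetAux i I

-- Sym_n ≅ descent algebra:  R_I ↦ Σ {σ : Des σ = descent set of I}
toAlg : (n : ℕ) → FS → A n
toAlg n f σ = sumℚ (List.map (λ { (c , I) →
  c * ind ⌊ ListP.≡-dec ℕ._≟_ (Des σ) (descSet I) ⌋ }) f)

V⁺ V⁻ V : (n k : ℕ) → A n
V⁺ n k = toAlg n (V⁺S k n)
V⁻ n k = toAlg n (V⁻S k n)
V  n k = V⁺ n k ⊕ V⁻ n k

Sub : ℕ → Set₁
Sub n = A n → Set

lincomb : {n : ℕ} → List ℚ → List (A n) → A n
lincomb cs gs σ = sumℚ (zipWith (λ c g → c * g σ) cs gs)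

span : {n : ℕ} → List (A n) → Sub n
span gs x = ∃[ cs ] (x ≈ lincomb cs gs)

spanFam : {n : ℕ} → (ℕ → List (A n)) → Sub n
spanFam G x = ∃[ N ] span (concatMap G (upTo N)) x

_⊆S_ : {n : ℕ} → Sub n → Sub n → Set
S ⊆S T = ∀ x → S x → T x

_≐_ : {n : ℕ} → Sub n → Sub n → Set
S ≐ T = (S ⊆S T) × (T ⊆S S)

ClosedUnder⊛ : {n : ℕ} → Sub n → Set
ClosedUnder⊛ S = ∀ x y → S x → S y → S (x ⊛ y)

Commutative : {n : ℕ} → Sub n → Set
Commutative S = ∀ x y → S x → S y → (x ⊛ y) ≈ (y ⊛ x)

CommSubalgebraOf : {n : ℕ} → Sub n → Sub n → Set
CommSubalgebraOf S T = (S ⊆S T) × ClosedUnder⊛ S × Commutative S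

Central : {n : ℕ} → Sub n → Sub n → Set
Central S T = ∀ x y → S x → T y → (x ⊛ y) ≈ (y ⊛ x)

fromTo : ℕ → ℕ → List ℕ
fromTo a b = List.map (a ℕ.+_) (upTo (suc b ∸ a))

𝒲± 𝒲 𝒲° 𝒫 𝒫° 𝒞 : (n : ℕ) → Sub n
𝒲± n = span (concatMap (λ k → W⁺ n k ∷ W⁻ n k ∷ []) (fromTo 1 (n ∸ 1)))
𝒲  n = span (List.map (W n) (fromTo 1 (n ∸ 1)))
𝒲° n = span (List.map (W° n) (fromTo 1 n))
-- a permutation of S_n has at most n peaks / left peaks
𝒫  n = span (List.map (Pk n) (upTo (suc n)))
𝒫° n = span (List.map (Pk° n) (upTo (suc n)))
𝒞  n = span (  List.map (W n) (filterᵇ (λ k → k % 2 ≡ᵇ 0) (fromTo 1 (n ∸ 1)))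
            ++ concatMap (λ k → W⁺ n k ∷ W⁻ n k ∷ [])
                 (filterᵇ (λ k → k % 2 ≡ᵇ 1) (fromTo 1 (n ∸ 1))))

V±all V±fin : (n : ℕ) → Sub n
V±all n = spanFam (λ k → V⁺ n (suc k) ∷ V⁻ n (suc k) ∷ [])
V±fin n = span (concatMap (λ k → V⁺ n k ∷ V⁻ n k ∷ []) (fromTo 1 (n ∸ 1)))

Vall Vfin : (n : ℕ) → Sub n
Vall n = spanFam (λ k → V n (suc k) ∷ [])
Vfin n = span (List.map (V n) (fromTo 1 (n ∸ 1)))

V⁺all V⁺fin : (n : ℕ) → Sub n
V⁺all n = spanFam (λ k → V⁺ n (suc k) ∷ [])
V⁺fin n = span (List.map (V⁺ n) (fromTo 1 n))

V⁻evall V⁻evfin : (n : ℕ) → Sub n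
V⁻evall n = spanFam (λ k → V⁻ n (2 ℕ.* suc k) ∷ [])
V⁻evfin n = span (List.map (λ k → V⁻ n (2 ℕ.* k))
              (filterᵇ (λ k → (1 ≤ᵇ 2 ℕ.* k) ∧ (2 ℕ.* k ≤ᵇ n ℕ.+ 1)) (upTo (n ℕ.+ 2))))

V⁺odall V⁺odfin : (n : ℕ) → Sub n
V⁺odall n = spanFam (λ k → V⁺ n (2 ℕ.* k ℕ.+ 1) ∷ [])
V⁺odfin n = span (List.map (λ k → V⁺ n (2 ℕ.* k ℕ.+ 1))
              (filterᵇ (λ k → (1 ≤ᵇ 2 ℕ.* k ℕ.+ 1) ∧ (2 ℕ.* k ℕ.+ 1 ≤ᵇ n ℕ.+ 1)) (upTo (n ℕ.+ 2))))

VCall VCfin : (n : ℕ) → Sub n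
VCall n = spanFam (λ k → V⁺ n (2 ℕ.* k ℕ.+ 1) ∷ V⁻ n (2 ℕ.* k ℕ.+ 1) ∷ V n (2 ℕ.* k) ∷ [])
VCfin n = span (  concatMap (λ k → V⁺ n (2 ℕ.* k ℕ.+ 1) ∷ V⁻ n (2 ℕ.* k ℕ.+ 1) ∷ [])
                    (filterᵇ (λ k → (1 ≤ᵇ 2 ℕ.* k ℕ.+ 1) ∧ (2 ℕ.* k ℕ.+ 1 <ᵇ n)) (upTo n))
               ++ List.map (λ l → V n (2 ℕ.* l))
                    (filterᵇ (λ l → (1 ≤ᵇ 2 ℕ.* l) ∧ (2 ℕ.* l <ᵇ n)) (upTo n)))

{-# OPTIONS --safe #-}

-- Evaluated at σ, V^δ_k counts the weakly increasing words h over k letters of alternating signs (the first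
-- of sign δ) such that i ↦ (h i , σ i) increases strictly for the order Lex δ.
--
-- Products: if αβ = τ and f, g are such words for α, β, then i ↦ (g i , f (β i)) is such a word for τ over the
-- product alphabet, ordered by g first, with the blocks of negative letters reversed and their signs flipped.
-- This is a bijection, since β is recovered as the ranking of the positions by (f ∘ β , τ), and the product
-- alphabet is again alternating. Hence V^δ_k V^ε_l = V^η_lk with η = δ if ε = +, and η = δ flipped k times
-- if ε = −, which gives all closure, commutativity and centrality claims.
--
-- Spans: with T the number of turns of σ preceded by a step of direction δ, the generating function is
--   Σ_k V^δ_k(σ) t^k = t (2t)^T (1+t²)^(n-1-T) / ((1-t)² (1-t²)^(n-1)).
-- So V^δ_k(σ) depends only on T and vanishes exactly when k ≤ T, and it depends only on ⌈T/2⌉ for odd k and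
-- on ⌊T/2⌋ for even k. Each space of the theorem is therefore the space of all functions of one statistic,
-- and the V's are triangular with respect to it.

module Submission where

open import Defs
open import Data.Bool using (Bool; true; false; if_then_else_; _∧_; _∨_; not; T; T?)
open import Data.Bool.Properties using (not-involutive; T-≡; T-∧)
open import Data.Fin as Fin using (Fin; zero; suc; toℕ; fromℕ<; punchOut; combine; opposite)
import Data.Fin.Properties as Fin
open import Data.List as List using (List; []; _∷_; _++_; concatMap; upTo; filter; filterᵇ; length; take; drop; applyUpTo; replicate; allFin; cartesianProduct; cartesianProductWith)
open import Data.List.Membership.Propositional using (_∈_; lose)
open import Data.List.Membership.Propositional.Properties
open import Data.List.Membership.Propositional.Properties.WithK using (unique∧set⇒bag)
open import Data.List.Properties as List using (map-++; take++drop≡id; length-take; length-drop; map-applyUpTo; ++-identityʳ; map-tabulate; filter-notAll; length-tabulate; length-map)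
open import Data.List.Relation.Binary.BagAndSetEquality using (∼bag⇒↭)
open import Data.List.Relation.Binary.Permutation.Propositional.Properties using (↭-length)
open import Data.List.Relation.Unary.All as All using (All; []; _∷_)
import Data.List.Relation.Unary.All.Properties as All
open import Data.List.Relation.Unary.AllPairs using ([]; _∷_)
open import Data.List.Relation.Unary.Any as Any using (here; there)
open import Data.List.Relation.Unary.Unique.Propositional using (Unique)
import Data.List.Relation.Unary.Unique.DecPropositional as DecUnique
import Data.List.Relation.Unary.Unique.Propositional.Properties as Unique
open import Data.Nat as ℕ using (ℕ; zero; suc; s≤s; z≤n; _≤_; _∸_; _<ᵇ_; _≡ᵇ_; _≤ᵇ_; ⌊_/2⌋; ⌈_/2⌉)
open import Data.Nat.DivMod using (_%_; _/_; m≡m%n+[m/n]*n; m%n<n; m*n%n≡0)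
import Data.Nat.Properties as ℕ
open import Data.Nat.Tactic.RingSolver using (solve-∀)
open import Data.Product using (_×_; _,_; ∃; ∃-syntax; proj₁; proj₂)
open import Data.Rational as ℚ using (ℚ; 0ℚ; 1ℚ; _+_; _*_; -_; 1/_)
import Data.Rational.Properties as ℚ
open import Data.Rational.Solver using (module +-*-Solver)
open import Data.Sum as Sum using (_⊎_; inj₁; inj₂)
open import Data.Vec as Vec using (Vec; []; _∷_; lookup; tabulate; toList)
import Data.Vec.Membership.Propositional.Properties as VecMem
import Data.Vec.Properties as Vec
import Data.Vec.Relation.Unary.Any as VecAny
import Data.Vec.Relation.Unary.Any.Properties as VecAny
open import Function using (_∘_; mk⇔; Equivalence)
open import Relation.Binary.Definitions using (tri<; tri≈; tri>)
open import Relation.Binary.PropositionalEquality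
open import Relation.Nullary using (¬_; Dec; yes; no; contradiction; proof)
open import Relation.Nullary.Decidable using (⌊_⌋; toWitness; fromWitness; isYes≗does)
open import Relation.Nullary.Reflects using (Reflects; ofʸ; ofⁿ; det)
open +-*-Solver using (solve; _:=_; _:+_; _:*_)
open ≡-Reasoning


-- The ribbon definition and the words `h` meet in one number, `H`. When ribbons are read as descent
-- classes, the external product becomes a sum over the cuts of the sequence σ: a cut falls either
-- on a descent (concatenation) or on an ascent (gluing). V₁⁺ and V₁⁻ become the indicators of
-- increasing and decreasing sequences. So V^δ_k counts the ways to cut σ into k monotone pieces,
-- possibly empty, of alternating direction, and `h` names the piece of each position. Both counts
-- obey the recursion of `H`. The generating function stays implicit: its factors act on sequences
-- of naturals as the operators `E` and `U`. For the spans no basis or dimension is computed. Each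
-- span is compared with `Inv S`, the functions constant on the classes of a statistic `S`, and
-- elimination runs over the attained values of `S` only. Since `Inv S` contains the V's of the
-- relevant kind for every index, a product whose index lk exceeds n lands there without being
-- rewritten in terms of the finite list.

-- Finite sums and counts in ℚ

∑ : {X : Set} → List X → (X → ℚ) → ℚ
∑ xs f = sumℚ (List.map f xs)

∑-cong : {X : Set} (xs : List X) {f g : X → ℚ} → (∀ x → x ∈ xs → f x ≡ g x) → ∑ xs f ≡ ∑ xs g
∑-cong []       e = refl
∑-cong (x ∷ xs) e = cong₂ _+_ (e x (here refl)) (∑-cong xs (λ y m → e y (there m)))

sumℚ-++ : ∀ xs ys → sumℚ (xs ++ ys) ≡ sumℚ xs + sumℚ ys
sumℚ-++ []       ys = sym (ℚ.+-identityˡ _)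
sumℚ-++ (x ∷ xs) ys = trans (cong (x +_) (sumℚ-++ xs ys)) (sym (ℚ.+-assoc x _ _))

∑-++ : {X : Set} (xs ys : List X) (f : X → ℚ) → ∑ (xs ++ ys) f ≡ ∑ xs f + ∑ ys f
∑-++ xs ys f = trans (cong sumℚ (map-++ f xs ys)) (sumℚ-++ (List.map f xs) (List.map f ys))

∑-+ : {X : Set} (xs : List X) (f g : X → ℚ) → ∑ xs (λ x → f x + g x) ≡ ∑ xs f + ∑ xs g
∑-+ []       f g = refl
∑-+ (x ∷ xs) f g = begin
  f x + g x + ∑ xs (λ y → f y + g y)   ≡⟨ cong (f x + g x +_) (∑-+ xs f g) ⟩
  f x + g x + (∑ xs f + ∑ xs g)        ≡⟨ solve 4 (λ a b c d → a :+ b :+ (c :+ d) := a :+ c :+ (b :+ d)) refl (f x) (g x) (∑ xs f) (∑ xs g) ⟩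
  f x + ∑ xs f + (g x + ∑ xs g)        ∎

∑-*ˡ : {X : Set} (xs : List X) (c : ℚ) (f : X → ℚ) → ∑ xs (λ x → c * f x) ≡ c * ∑ xs f
∑-*ˡ []       c f = sym (ℚ.*-zeroʳ c)
∑-*ˡ (x ∷ xs) c f = trans (cong (c * f x +_) (∑-*ˡ xs c f)) (sym (ℚ.*-distribˡ-+ c _ _))

∑-*ʳ : {X : Set} (xs : List X) (c : ℚ) (f : X → ℚ) → ∑ xs (λ x → f x * c) ≡ ∑ xs f * c
∑-*ʳ xs c f = begin
  ∑ xs (λ x → f x * c)  ≡⟨ ∑-cong xs (λ x _ → ℚ.*-comm (f x) c) ⟩
  ∑ xs (λ x → c * f x)  ≡⟨ ∑-*ˡ xs c f ⟩
  c * ∑ xs f            ≡⟨ ℚ.*-comm c _ ⟩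
  ∑ xs f * c            ∎

∑-concatMap : {X Y : Set} (xs : List X) (k : X → List Y) (f : Y → ℚ) →
              ∑ (concatMap k xs) f ≡ ∑ xs (λ x → ∑ (k x) f)
∑-concatMap []       k f = refl
∑-concatMap (x ∷ xs) k f = trans (∑-++ (k x) (concatMap k xs) f) (cong (∑ (k x) f +_) (∑-concatMap xs k f))

∑-map : {X Y : Set} (xs : List X) (e : X → Y) (f : Y → ℚ) → ∑ (List.map e xs) f ≡ ∑ xs (f ∘ e)
∑-map []       e f = refl
∑-map (x ∷ xs) e f = cong (f (e x) +_) (∑-map xs e f)

sumℚ-concatMap : {X : Set} (xs : List X) (k : X → List ℚ) → sumℚ (concatMap k xs) ≡ ∑ xs (sumℚ ∘ k)
sumℚ-concatMap []       k = refl
sumℚ-concatMap (x ∷ xs) k = trans (sumℚ-++ (k x) _) (cong (sumℚ (k x) +_) (sumℚ-concatMap xs k))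

∑-× : {X Y : Set} (xs : List X) (ys : List Y) (f : X × Y → ℚ) →
      ∑ (cartesianProduct xs ys) f ≡ ∑ xs (λ x → ∑ ys (λ y → f (x , y)))
∑-× []       ys f = refl
∑-× (x ∷ xs) ys f = trans (∑-++ (List.map (x ,_) ys) (cartesianProduct xs ys) f)
  (cong₂ _+_ (∑-map ys (x ,_) f) (∑-× xs ys f))

∑*∑ : {X Y : Set} (xs : List X) (ys : List Y) (f : X → ℚ) (g : Y → ℚ) →
      ∑ xs f * ∑ ys g ≡ ∑ xs (λ x → ∑ ys (λ y → f x * g y))
∑*∑ xs ys f g = trans (sym (∑-*ʳ xs (∑ ys g) f)) (∑-cong xs (λ x _ → sym (∑-*ˡ ys (f x) g)))

nat : ℕ → ℚ
nat zero    = 0ℚ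
nat (suc m) = 1ℚ + nat m

nat-+ : ∀ m p → nat (m ℕ.+ p) ≡ nat m + nat p
nat-+ zero    p = sym (ℚ.+-identityˡ _)
nat-+ (suc m) p = trans (cong (1ℚ +_) (nat-+ m p)) (sym (ℚ.+-assoc 1ℚ (nat m) (nat p)))

0≤nat : ∀ m → 0ℚ ℚ.≤ nat m
0≤nat zero    = ℚ.≤-refl
0≤nat (suc m) = ℚ.+-mono-≤ {0ℚ} {1ℚ} (ℚ.<⇒≤ 0<1) (0≤nat m)
  where 0<1 = ℚ.positive⁻¹ 1ℚ

-- Characteristic zero enters here: a positive count of words stays nonzero in ℚ and can serve as a
-- pivot.
nat≢0 : ∀ {m} → 0 ℕ.< m → nat m ≢ 0ℚ
nat≢0 {suc m} _ e = ℚ.<-irrefl (sym e) (ℚ.+-mono-<-≤ {0ℚ} {1ℚ} {0ℚ} (ℚ.positive⁻¹ 1ℚ) (0≤nat m))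

nat-length-filterᵇ : {X : Set} (p : X → Bool) (xs : List X) → nat (length (filterᵇ p xs)) ≡ ∑ xs (ind ∘ p)
nat-length-filterᵇ p []       = refl
nat-length-filterᵇ p (x ∷ xs) with p x
... | true  = cong (1ℚ +_) (nat-length-filterᵇ p xs)
... | false = trans (nat-length-filterᵇ p xs) (sym (ℚ.+-identityˡ _))

-- Subspaces

0A : {n : ℕ} → A n
0A σ = 0ℚ

_·_ : {n : ℕ} → ℚ → A n → A n
(c · a) σ = c * a σ

-- `respₛ` is a field because elements are functions on all words, while `≈` compares them on
-- permutations only. The notion is kept apart from `span` so that `span-least` also applies to
-- commutants and to preimages under multiplication.
record IsSubspace {n : ℕ} (P : Sub n) : Set where
  field
    respₛ  : ∀ {x y} → x ≈ y → P y → P x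
    zeroₛ : P 0A
    addₛ   : ∀ {x y} → P x → P y → P (x ⊕ y)
    scaleₛ : ∀ c {x} → P x → P (c · x)

open IsSubspace

-- `zipWith` truncates, so the coefficient list may be shorter or longer than the list of
-- generators. A missing coefficient is read as 0 here, which makes induction on the generators
-- possible.
span-uncons : {n : ℕ} {g : A n} {gs : List (A n)} {x : A n} → span (g ∷ gs) x →
              ∃[ c ] ∃[ y ] (span gs y × x ≈ ((c · g) ⊕ y))
span-uncons {g = g} ([] , e) = 0ℚ , 0A , ([] , λ _ _ → refl) ,
  λ σ m → trans (e σ m) (sym (trans (ℚ.+-identityʳ _) (ℚ.*-zeroˡ (g σ))))
span-uncons {gs = gs} (c ∷ cs , e) = c , lincomb cs gs , (cs , λ _ _ → refl) , e

span-cons : {n : ℕ} {g : A n} {gs : List (A n)} (c : ℚ) {y : A n} → span gs y → span (g ∷ gs) ((c · g) ⊕ y)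
span-cons {g = g} c (cs , e) = c ∷ cs , λ σ m → cong (c * g σ +_) (e σ m)

span-resp : {n : ℕ} {gs : List (A n)} {x y : A n} → x ≈ y → span gs y → span gs x
span-resp e (cs , f) = cs , λ σ m → trans (e σ m) (f σ m)

span-0 : {n : ℕ} (gs : List (A n)) → span gs 0A
span-0 gs = [] , λ _ _ → refl

lincomb-[] : {n : ℕ} (cs : List ℚ) (σ : Word n) → lincomb cs [] σ ≡ 0ℚ
lincomb-[] []       σ = refl
lincomb-[] (_ ∷ _) σ = refl

span-add : {n : ℕ} (gs : List (A n)) {x y : A n} → span gs x → span gs y → span gs (x ⊕ y)
span-add [] (cs , e) (ds , f) = [] , λ σ m →
  cong₂ _+_ (trans (e σ m) (lincomb-[] cs σ)) (trans (f σ m) (lincomb-[] ds σ))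
span-add (g ∷ gs) sx sy
  with c , x' , px , ex ← span-uncons sx | d , y' , py , ey ← span-uncons sy =
  span-resp (λ σ m → trans (cong₂ _+_ (ex σ m) (ey σ m))
      (solve 5 (λ c g x d y → (c :* g :+ x) :+ (d :* g :+ y) := (c :+ d) :* g :+ (x :+ y)) refl
        c (g σ) (x' σ) d (y' σ)))
    (span-cons (c + d) (span-add gs px py))

span-scale : {n : ℕ} (gs : List (A n)) (k : ℚ) {x : A n} → span gs x → span gs (k · x)
span-scale [] k (cs , e) = [] , λ σ m → trans (cong (k *_) (trans (e σ m) (lincomb-[] cs σ))) (ℚ.*-zeroʳ k)
span-scale (g ∷ gs) k sx with c , x' , px , ex ← span-uncons sx =
  span-resp (λ σ m → trans (cong (k *_) (ex σ m))
      (solve 4 (λ k c g x → k :* (c :* g :+ x) := k :* c :* g :+ k :* x) refl k c (g σ) (x' σ)))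
    (span-cons (k * c) (span-scale gs k px))

span-isSubspace : {n : ℕ} (gs : List (A n)) → IsSubspace (span gs)
span-isSubspace gs = record { respₛ = span-resp ; zeroₛ = span-0 gs ; addₛ = span-add gs ; scaleₛ = span-scale gs }

span-gen : {n : ℕ} {gs : List (A n)} {g : A n} → g ∈ gs → span gs g
span-gen {gs = g ∷ gs} (here refl) = span-resp
  (λ σ m → sym (trans (ℚ.+-identityʳ _) (ℚ.*-identityˡ (g σ)))) (span-cons 1ℚ (span-0 gs))
span-gen {gs = h ∷ gs} {g} (there i) = span-resp
  (λ σ m → sym (trans (cong (_+ g σ) (ℚ.*-zeroˡ (h σ))) (ℚ.+-identityˡ (g σ)))) (span-cons 0ℚ (span-gen i))

span-least : {n : ℕ} {P : Sub n} → IsSubspace P → (gs : List (A n)) → (∀ g → g ∈ gs → P g) → span gs ⊆S P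
span-least S [] h x (cs , e) = respₛ S (λ σ m → trans (e σ m) (lincomb-[] cs σ)) (zeroₛ S)
span-least S (g ∷ gs) h x sx with c , y , py , e ← span-uncons sx =
  respₛ S e (addₛ S (scaleₛ S c (h g (here refl))) (span-least S gs (λ g i → h g (there i)) y py))

Inv : {n : ℕ} → (Word n → ℕ) → Sub n
Inv {n} S x = ∀ σ σ' → σ ∈ perms n → σ' ∈ perms n → S σ ≡ S σ' → x σ ≡ x σ'

Inv-isSubspace : {n : ℕ} (S : Word n → ℕ) → IsSubspace (Inv S)
Inv-isSubspace S = record
  { respₛ  = λ e p σ σ' m m' q → trans (e σ m) (trans (p σ σ' m m' q) (sym (e σ' m')))
  ; zeroₛ = λ _ _ _ _ _ → refl
  ; addₛ   = λ p q σ σ' m m' e → cong₂ _+_ (p σ σ' m m' e) (q σ σ' m m' e)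
  ; scaleₛ = λ c p σ σ' m m' e → cong (c *_) (p σ σ' m m' e) }

Inv-mono : {n : ℕ} (S S' : Word n → ℕ) →
  (∀ σ σ' → σ ∈ perms n → σ' ∈ perms n → S' σ ≡ S' σ' → S σ ≡ S σ') → Inv S ⊆S Inv S'
Inv-mono S S' h x p σ σ' m m' e = p σ σ' m m' (h σ σ' m m' e)

-- The generator chosen for `σ₀` is the pivot of its class: nonzero at `σ₀` and zero at every larger
-- value of `S`, with no condition at smaller values. Asking for one pivot per permutation, rather
-- than per number, confines the elimination to attained values.
Triangular : {n : ℕ} → (Word n → ℕ) → List (A n) → Set
Triangular {n} S gs = ∀ σ₀ → σ₀ ∈ perms n → ∃[ v ] (v ∈ gs × v σ₀ ≢ 0ℚ ×
  (∀ σ → σ ∈ perms n → S σ₀ ℕ.< S σ → v σ ≡ 0ℚ))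

private
  bounded : {X : Set} (f : X → ℕ) (xs : List X) → ∃[ N ] (∀ x → x ∈ xs → f x ℕ.< N)
  bounded f [] = 0 , λ _ ()
  bounded f (x ∷ xs) with N , h ← bounded f xs = suc (f x) ℕ.⊔ N , λ where
    y (here refl) → ℕ.m≤m⊔n (suc (f x)) N
    y (there i)   → ℕ.≤-trans (h y i) (ℕ.m≤n⊔m (suc (f x)) N)

  find : {X : Set} (f : X → ℕ) (N : ℕ) (xs : List X) → (∃[ x ] (x ∈ xs × f x ≡ N)) ⊎ (∀ x → x ∈ xs → f x ≢ N)
  find f N [] = inj₂ λ _ ()
  find f N (x ∷ xs) with f x ℕ.≟ N | find f N xs
  ... | yes p | _                 = inj₁ (x , here refl , p)
  ... | no _  | inj₁ (y , i , p)  = inj₁ (y , there i , p)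
  ... | no q  | inj₂ h            = inj₂ λ where
    y (here refl) → q
    y (there i)   → h y i

  cancel : ∀ x v w → v * w ≡ 1ℚ → x + (- (x * w)) * v ≡ 0ℚ
  cancel x v w e = begin
    x + (- (x * w)) * v   ≡⟨ cong (x +_) (sym (ℚ.neg-distribˡ-* (x * w) v)) ⟩
    x + - (x * w * v)     ≡⟨ cong (λ z → x + - z) (trans (ℚ.*-assoc x w v) (trans (cong (x *_) (trans (ℚ.*-comm w v) e)) (ℚ.*-identityʳ x))) ⟩
    x + - x               ≡⟨ ℚ.+-inverseʳ x ⟩
    0ℚ                    ∎

  inverse : ∀ v → v ≢ 0ℚ → ∃[ w ] v * w ≡ 1ℚ
  inverse v v≢0 = (1/ v) {{nz}} , ℚ.*-inverseʳ v {{nz}}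
    where nz = ℚ.≢-nonZero v≢0

-- Elimination from the largest value of the statistic downwards.
Inv⊆span : {n : ℕ} (S : Word n → ℕ) (gs : List (A n)) → (∀ g → g ∈ gs → Inv S g) → Triangular S gs → Inv S ⊆S span gs
Inv⊆span {n} S gs inv tri x ix = go (proj₁ B) x ix (λ σ m N≤ → contradiction (proj₂ B σ m) (ℕ.≤⇒≯ N≤))
  where
  B = bounded S (perms n)
  -- Invariant: `x` vanishes wherever `S` is at least `N`. The start is a strict bound on all values
  -- of `S`.
  go : ∀ N x → Inv S x → (∀ σ → σ ∈ perms n → N ℕ.≤ S σ → x σ ≡ 0ℚ) → span gs x
  go zero x ix h = span-resp (λ σ m → h σ m z≤n) (span-0 gs)
  go (suc N) x ix h with find S N (perms n)
  ... | inj₂ none = go N x ix (λ σ m p → h σ m (ℕ.≤∧≢⇒< p (≢-sym (none σ m))))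
  ... | inj₁ (σ₀ , m₀ , e₀) with v , v∈ , v≢0 , v0 ← tri σ₀ m₀ with w , vw ← inverse (v σ₀) v≢0 =
    span-resp eq (span-add gs sy (span-scale gs c (span-gen v∈)))
    where
    c = x σ₀ * w
    y : A n
    y = x ⊕ ((- c) · v)
    y-0 : ∀ σ → σ ∈ perms n → N ℕ.≤ S σ → y σ ≡ 0ℚ
    y-0 σ m p with S σ ℕ.≟ N
    -- Both `x` and the pivot are constant on the class of `σ₀`, so the multiple chosen at `σ₀`
    -- clears the whole class at once.
    ... | yes q = trans (cong₂ (λ a b → a + (- c) * b) (ix σ σ₀ m m₀ (trans q (sym e₀))) (inv v v∈ σ σ₀ m m₀ (trans q (sym e₀))))
                        (cancel (x σ₀) (v σ₀) w vw)
    ... | no q  = trans (cong₂ (λ a b → a + (- c) * b) (h σ m lt) (v0 σ m (subst (ℕ._< S σ) (sym e₀) lt))) (trans (ℚ.+-identityˡ _) (ℚ.*-zeroʳ (- c)))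
      where lt = ℕ.≤∧≢⇒< p (≢-sym q)
    sy : span gs y
    sy = go N y (addₛ (Inv-isSubspace S) ix (scaleₛ (Inv-isSubspace S) (- c) (inv v v∈))) y-0
    eq : x ≈ (y ⊕ (c · v))
    eq σ m = sym (begin
      x σ + (- c) * v σ + c * v σ     ≡⟨ ℚ.+-assoc (x σ) _ _ ⟩
      x σ + ((- c) * v σ + c * v σ)   ≡⟨ cong (x σ +_) (sym (ℚ.*-distribʳ-+ (v σ) (- c) c)) ⟩
      x σ + (- c + c) * v σ           ≡⟨ cong (λ z → x σ + z * v σ) (ℚ.+-inverseˡ c) ⟩
      x σ + 0ℚ * v σ                  ≡⟨ cong (x σ +_) (ℚ.*-zeroˡ (v σ)) ⟩
      x σ + 0ℚ                        ≡⟨ ℚ.+-identityʳ (x σ) ⟩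
      x σ                             ∎)

span≐Inv : {n : ℕ} (S : Word n → ℕ) (gs : List (A n)) → (∀ g → g ∈ gs → Inv S g) → Triangular S gs → span gs ≐ Inv S
span≐Inv S gs inv tri = span-least (Inv-isSubspace S) gs inv , Inv⊆span S gs inv tri

≐-sym : {n : ℕ} {S T : Sub n} → S ≐ T → T ≐ S
≐-sym (p , q) = q , p

≐-trans : {n : ℕ} {S T U : Sub n} → S ≐ T → T ≐ U → S ≐ U
≐-trans (p , q) (r , s) = (λ x i → r x (p x i)) , (λ x i → q x (s x i))

-- Members of the family beyond the finite list are functions of `S`, hence already in the finite
-- span; no linear relation between them is written down. `N` only has to be large enough for the
-- family to contain the finite list.
spanFam≐span : {n : ℕ} (S : Word n → ℕ) (G : ℕ → List (A n)) (gs : List (A n)) →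
  (∀ k g → g ∈ G k → Inv S g) → span gs ≐ Inv S → (N : ℕ) → (∀ g → g ∈ gs → g ∈ concatMap G (upTo N)) →
  spanFam G ≐ span gs
spanFam≐span S G gs inv (_ , q) N sub =
  (λ { x (M , s) → q x (span-least (Inv-isSubspace S) _ (λ g i → let k , j = Any.satisfied (∈-concatMap⁻ G {xs = upTo M} i) in inv k g j) x s) }) ,
  (λ x s → N , span-least (span-isSubspace _) gs (λ g i → span-gen (sub g i)) x s)

-- Bilinearity of the internal product

⊛-∑ : {n : ℕ} (a b : A n) (τ : Word n) →
      (a ⊛ b) τ ≡ ∑ (perms n) (λ α → ∑ (perms n) (λ β → ind (compose α β ==W τ) * (a α * b β)))
⊛-∑ {n} a b τ = trans (sumℚ-concatMap (perms n) _)
  (∑-cong (perms n) (λ α _ → trans (sumℚ-concatMap (perms n) _)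
    (∑-cong (perms n) (λ β _ → lemma (compose α β ==W τ) (a α * b β)))))
  where
  lemma : ∀ c q → sumℚ (if c then q ∷ [] else []) ≡ ind c * q
  lemma true  q = trans (ℚ.+-identityʳ q) (sym (ℚ.*-identityˡ q))
  lemma false q = sym (ℚ.*-zeroˡ q)

⊛-cong : {n : ℕ} {a a' b b' : A n} → a ≈ a' → b ≈ b' → (a ⊛ b) ≈ (a' ⊛ b')
⊛-cong {n} {a} {a'} {b} {b'} p q τ _ = trans (⊛-∑ a b τ) (trans
  (∑-cong (perms n) (λ α m → ∑-cong (perms n) (λ β m' → cong (ind (compose α β ==W τ) *_) (cong₂ _*_ (p α m) (q β m')))))
  (sym (⊛-∑ a' b' τ)))

⊛-distribˡ : {n : ℕ} (a b c : A n) → (a ⊛ (b ⊕ c)) ≈ ((a ⊛ b) ⊕ (a ⊛ c))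
⊛-distribˡ {n} a b c τ _ = begin
  (a ⊛ (b ⊕ c)) τ
    ≡⟨ ⊛-∑ a (b ⊕ c) τ ⟩
  ∑ (perms n) (λ α → ∑ (perms n) (λ β → i α β * (a α * (b β + c β))))
    ≡⟨ ∑-cong (perms n) (λ α _ → trans (∑-cong (perms n) (λ β _ →
         solve 4 (λ i a b c → i :* (a :* (b :+ c)) := i :* (a :* b) :+ i :* (a :* c)) refl (i α β) (a α) (b β) (c β)))
         (∑-+ (perms n) (λ β → i α β * (a α * b β)) (λ β → i α β * (a α * c β)))) ⟩
  ∑ (perms n) (λ α → ∑ (perms n) (λ β → i α β * (a α * b β)) + ∑ (perms n) (λ β → i α β * (a α * c β)))
    ≡⟨ ∑-+ (perms n) _ _ ⟩
  ∑ (perms n) (λ α → ∑ (perms n) (λ β → i α β * (a α * b β))) + ∑ (perms n) (λ α → ∑ (perms n) (λ β → i α β * (a α * c β)))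
    ≡⟨ cong₂ _+_ (⊛-∑ a b τ) (⊛-∑ a c τ) ⟨
  (a ⊛ b) τ + (a ⊛ c) τ ∎
  where i = λ α β → ind (compose α β ==W τ)

⊛-distribʳ : {n : ℕ} (a b c : A n) → ((a ⊕ b) ⊛ c) ≈ ((a ⊛ c) ⊕ (b ⊛ c))
⊛-distribʳ {n} a b c τ _ = begin
  ((a ⊕ b) ⊛ c) τ
    ≡⟨ ⊛-∑ (a ⊕ b) c τ ⟩
  ∑ (perms n) (λ α → ∑ (perms n) (λ β → i α β * ((a α + b α) * c β)))
    ≡⟨ ∑-cong (perms n) (λ α _ → trans (∑-cong (perms n) (λ β _ →
         solve 4 (λ i a b c → i :* ((a :+ b) :* c) := i :* (a :* c) :+ i :* (b :* c)) refl (i α β) (a α) (b α) (c β)))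
         (∑-+ (perms n) (λ β → i α β * (a α * c β)) (λ β → i α β * (b α * c β)))) ⟩
  ∑ (perms n) (λ α → ∑ (perms n) (λ β → i α β * (a α * c β)) + ∑ (perms n) (λ β → i α β * (b α * c β)))
    ≡⟨ ∑-+ (perms n) _ _ ⟩
  ∑ (perms n) (λ α → ∑ (perms n) (λ β → i α β * (a α * c β))) + ∑ (perms n) (λ α → ∑ (perms n) (λ β → i α β * (b α * c β)))
    ≡⟨ cong₂ _+_ (⊛-∑ a c τ) (⊛-∑ b c τ) ⟨
  (a ⊛ c) τ + (b ⊛ c) τ ∎
  where i = λ α β → ind (compose α β ==W τ)

⊛-scaleˡ : {n : ℕ} (k : ℚ) (a b : A n) → ((k · a) ⊛ b) ≈ (k · (a ⊛ b))
⊛-scaleˡ {n} k a b τ _ = begin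
  ((k · a) ⊛ b) τ
    ≡⟨ ⊛-∑ (k · a) b τ ⟩
  ∑ (perms n) (λ α → ∑ (perms n) (λ β → i α β * (k * a α * b β)))
    ≡⟨ ∑-cong (perms n) (λ α _ → trans (∑-cong (perms n) (λ β _ →
         solve 4 (λ i k a b → i :* (k :* a :* b) := k :* (i :* (a :* b))) refl (i α β) k (a α) (b β)))
         (∑-*ˡ (perms n) k (λ β → i α β * (a α * b β)))) ⟩
  ∑ (perms n) (λ α → k * ∑ (perms n) (λ β → i α β * (a α * b β)))
    ≡⟨ ∑-*ˡ (perms n) k _ ⟩
  k * ∑ (perms n) (λ α → ∑ (perms n) (λ β → i α β * (a α * b β)))
    ≡⟨ cong (k *_) (⊛-∑ a b τ) ⟨
  k * (a ⊛ b) τ ∎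
  where i = λ α β → ind (compose α β ==W τ)

⊛-scaleʳ : {n : ℕ} (k : ℚ) (a b : A n) → (a ⊛ (k · b)) ≈ (k · (a ⊛ b))
⊛-scaleʳ {n} k a b τ m = begin
  (a ⊛ (k · b)) τ
    ≡⟨ ⊛-∑ a (k · b) τ ⟩
  ∑ (perms n) (λ α → ∑ (perms n) (λ β → i α β * (a α * (k * b β))))
    ≡⟨ ∑-cong (perms n) (λ α _ → ∑-cong (perms n) (λ β _ →
         solve 4 (λ i k a b → i :* (a :* (k :* b)) := i :* (k :* a :* b)) refl (i α β) k (a α) (b β))) ⟩
  ∑ (perms n) (λ α → ∑ (perms n) (λ β → i α β * (k * a α * b β)))
    ≡⟨ ⊛-∑ (k · a) b τ ⟨
  ((k · a) ⊛ b) τ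
    ≡⟨ ⊛-scaleˡ k a b τ m ⟩
  k * (a ⊛ b) τ ∎
  where i = λ α β → ind (compose α β ==W τ)

⊛-zeroˡ : {n : ℕ} (b : A n) → (0A ⊛ b) ≈ 0A
⊛-zeroˡ b τ m = trans (⊛-cong {a' = 0ℚ · 0A} {b = b} (λ _ _ → sym (ℚ.*-zeroˡ 0ℚ)) (λ _ _ → refl) τ m)
  (trans (⊛-scaleˡ 0ℚ 0A b τ m) (ℚ.*-zeroˡ ((0A ⊛ b) τ)))

⊛-zeroʳ : {n : ℕ} (a : A n) → (a ⊛ 0A) ≈ 0A
⊛-zeroʳ a τ m = trans (⊛-cong {a = a} {b' = 0ℚ · 0A} (λ _ _ → refl) (λ _ _ → sym (ℚ.*-zeroˡ 0ℚ)) τ m)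
  (trans (⊛-scaleʳ 0ℚ a 0A τ m) (ℚ.*-zeroˡ ((a ⊛ 0A) τ)))

-- By bilinearity the elements whose product with a fixed one lies in `P` form a subspace, on either
-- side. `P` is separate from the span, so that products of generators can be tested in `Inv S`.
span-closed : {n : ℕ} (gs : List (A n)) {P : Sub n} → IsSubspace P →
  (∀ g h → g ∈ gs → h ∈ gs → P (g ⊛ h)) → ∀ x y → span gs x → span gs y → P (x ⊛ y)
span-closed gs {P} SP h x y sx sy = span-least right gs
  (λ b i → span-least (left b) gs (λ a j → h a b j i) x sx) y sy
  where
  left : ∀ b → IsSubspace (λ a → P (a ⊛ b))
  left b = record
    { respₛ  = λ {u} {v} e → respₛ SP (⊛-cong {a = u} {v} {b} e (λ _ _ → refl))
    ; zeroₛ = respₛ SP (⊛-zeroˡ b) (zeroₛ SP)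
    ; addₛ   = λ {u} {v} p q → respₛ SP (⊛-distribʳ u v b) (addₛ SP p q)
    ; scaleₛ = λ c {u} p → respₛ SP (⊛-scaleˡ c u b) (scaleₛ SP c p) }
  right : IsSubspace (λ b → P (x ⊛ b))
  right = record
    { respₛ  = λ {u} {v} e → respₛ SP (⊛-cong {a = x} {b = u} {v} (λ _ _ → refl) e)
    ; zeroₛ = respₛ SP (⊛-zeroʳ x) (zeroₛ SP)
    ; addₛ   = λ {u} {v} p q → respₛ SP (⊛-distribˡ x u v) (addₛ SP p q)
    ; scaleₛ = λ c {u} p → respₛ SP (⊛-scaleʳ c x u) (scaleₛ SP c p) }

-- The commutant of an element is a subspace; `span-least` is applied to it once for each factor.
span-commute : {n : ℕ} (gs hs : List (A n)) → (∀ g h → g ∈ gs → h ∈ hs → (g ⊛ h) ≈ (h ⊛ g)) →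
  ∀ x y → span gs x → span hs y → (x ⊛ y) ≈ (y ⊛ x)
span-commute gs hs h x y sx sy = span-least (commutant x) hs
  (λ b i σ m → sym (span-least (commutant b) gs (λ a j σ m → sym (h a b j i σ m)) x sx σ m)) y sy
  where
  commutant : ∀ a → IsSubspace (λ b → (a ⊛ b) ≈ (b ⊛ a))
  commutant a = record
    { respₛ  = λ {u} {v} e p σ m → trans (⊛-cong {a = a} {b = u} {v} (λ _ _ → refl) e σ m)
                (trans (p σ m) (sym (⊛-cong {a = u} {v} {a} e (λ _ _ → refl) σ m)))
    ; zeroₛ = λ σ m → trans (⊛-zeroʳ a σ m) (sym (⊛-zeroˡ a σ m))
    ; addₛ   = λ {u} {v} p q σ m → trans (⊛-distribˡ a u v σ m)
                (trans (cong₂ _+_ (p σ m) (q σ m)) (sym (⊛-distribʳ u v a σ m)))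
    ; scaleₛ = λ c {u} p σ m → trans (⊛-scaleʳ c a u σ m)
                (trans (cong (c *_) (p σ m)) (sym (⊛-scaleˡ c u a σ m))) }

-- Signs and ascent patterns

-- The sign of letter `m` in the alternating alphabet whose letter 0 has sign `δ`; `true` is
-- positive. `sg true` doubles as the parity of a number.
sg : Bool → ℕ → Bool
sg δ zero    = δ
sg δ (suc m) = not (sg δ m)

sg-not : ∀ δ m → sg (not δ) m ≡ not (sg δ m)
sg-not δ zero    = refl
sg-not δ (suc m) = cong not (sg-not δ m)

sg-+ : ∀ δ m p → sg δ (m ℕ.+ p) ≡ sg (sg δ m) p
sg-+ δ zero    p = refl
sg-+ δ (suc m) p = trans (cong not (sg-+ δ m p)) (sym (sg-not (sg δ m) p))

sg-double : ∀ δ m → sg (sg δ m) m ≡ δ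
sg-double δ zero    = refl
sg-double δ (suc m) = begin
  not (sg (not (sg δ m)) m)   ≡⟨ cong not (sg-not (sg δ m) m) ⟩
  not (not (sg (sg δ m) m))   ≡⟨ not-involutive _ ⟩
  sg (sg δ m) m               ≡⟨ sg-double δ m ⟩
  δ                           ∎

sg-2* : ∀ δ m → sg δ (2 ℕ.* m) ≡ δ
sg-2* δ m rewrite ℕ.+-identityʳ m = trans (sg-+ δ m m) (sg-double δ m)

sg-odd : ∀ δ m → sg δ (2 ℕ.* m ℕ.+ 1) ≡ not δ
sg-odd δ m rewrite ℕ.+-comm (2 ℕ.* m) 1 = cong not (sg-2* δ m)

-- Whether a letter of sign `δ` may be kept across the step `b`, where `true` stands for an ascent.
agree : Bool → Bool → Bool
agree true  b = b
agree false b = not b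

-- The number of weakly increasing words over k letters of alternating signs, the first one having sign δ,
-- that repeat a positive letter only across an ascent and a negative one only across a descent.
-- The case split is on whether the first letter of the alphabet is used.
H : Bool → ℕ → List Bool → ℕ
H δ zero    bs       = 0
H δ (suc k) []       = suc k
H δ (suc k) (b ∷ bs) =
  H (not δ) k (b ∷ bs) ℕ.+ (if agree δ b then H δ (suc k) bs else H (not δ) k bs)

-- The statistic T: the turns in the step pattern `bs` when a step of direction `δ` precedes it.
changes : Bool → List Bool → ℕ
changes δ []       = 0
changes δ (b ∷ bs) = (if agree δ b then 0 else 1) ℕ.+ changes b bs

repeats : Bool → List Bool → ℕ
repeats δ []       = 0
repeats δ (b ∷ bs) = (if agree δ b then 1 else 0) ℕ.+ repeats b bs

repeats+changes : ∀ δ bs → repeats δ bs ℕ.+ changes δ bs ≡ length bs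
repeats+changes δ [] = refl
repeats+changes δ (b ∷ bs) with agree δ b
... | true  = cong suc (repeats+changes b bs)
... | false = trans (ℕ.+-suc _ _) (cong suc (repeats+changes b bs))

changes≤length : ∀ δ bs → changes δ bs ℕ.≤ length bs
changes≤length δ bs = subst (changes δ bs ℕ.≤_) (repeats+changes δ bs) (ℕ.m≤n+m _ (repeats δ bs))

peaksᵇ : Bool → List Bool → ℕ
peaksᵇ δ []       = 0
peaksᵇ δ (b ∷ bs) = (if δ ∧ not b then 1 else 0) ℕ.+ peaksᵇ b bs

-- Turns are alternately peaks and valleys. After an ascent the first turn is a peak, so the peaks
-- are half of the turns rounded up; after a descent the first turn is a valley, so they are half
-- rounded down.
peaks-true  : ∀ bs → peaksᵇ true  bs ≡ ⌈ changes true bs /2⌉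
peaks-false : ∀ bs → peaksᵇ false bs ≡ ⌊ changes false bs /2⌋
peaks-true []           = refl
peaks-true (true ∷ bs)  = peaks-true bs
peaks-true (false ∷ bs) = cong suc (peaks-false bs)
peaks-false []           = refl
peaks-false (true ∷ bs)  = peaks-true bs
peaks-false (false ∷ bs) = peaks-false bs

-- Every change of direction forces a move to a later letter, so a word uses more than
-- `changes δ bs` letters of the alphabet.
H-zero : ∀ δ k bs → k ℕ.≤ changes δ bs → H δ k bs ≡ 0
H-zero δ     zero    bs           p = refl
H-zero true  (suc k) (true ∷ bs)  p =
  cong₂ ℕ._+_ (H-zero false k (true ∷ bs) (ℕ.≤-trans (ℕ.n≤1+n k) (ℕ.≤-trans p (ℕ.n≤1+n _)))) (H-zero true (suc k) bs p)
H-zero true  (suc k) (false ∷ bs) (s≤s p) =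
  cong₂ ℕ._+_ (H-zero false k (false ∷ bs) p) (H-zero false k bs p)
H-zero false (suc k) (true ∷ bs)  (s≤s p) =
  cong₂ ℕ._+_ (H-zero true k (true ∷ bs) p) (H-zero true k bs p)
H-zero false (suc k) (false ∷ bs) p =
  cong₂ ℕ._+_ (H-zero true k (false ∷ bs) (ℕ.≤-trans (ℕ.n≤1+n k) (ℕ.≤-trans p (ℕ.n≤1+n _)))) (H-zero false (suc k) bs p)

-- The word that starts with the first letter and moves to the next one exactly at the changes of
-- direction needs `suc (changes δ bs)` letters. The proof follows this word through the second
-- summand of `H`.
H-pos : ∀ δ k bs → changes δ bs ℕ.< k → 0 ℕ.< H δ k bs
H-pos δ     (suc k) []           p       = s≤s z≤n
H-pos true  (suc k) (true ∷ bs)  p       = ℕ.≤-trans (H-pos true (suc k) bs p) (ℕ.m≤n+m _ _)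
H-pos true  (suc k) (false ∷ bs) (s≤s p) = ℕ.≤-trans (H-pos false k bs p) (ℕ.m≤n+m _ _)
H-pos false (suc k) (true ∷ bs)  (s≤s p) = ℕ.≤-trans (H-pos true k bs p) (ℕ.m≤n+m _ _)
H-pos false (suc k) (false ∷ bs) p       = ℕ.≤-trans (H-pos false (suc k) bs p) (ℕ.m≤n+m _ _)

-- On generating functions Σ C k tᵏ with C 0 = 0 these are multiplication by (1+t²)/(1-t²) and 2t/(1-t²).
E U : (ℕ → ℕ) → ℕ → ℕ
E C zero    = 0
E C (suc k) = U C k ℕ.+ C (suc k)
U C zero    = 0
U C (suc k) = E C k ℕ.+ C k

E-cong : ∀ {C D} → (∀ k → C k ≡ D k) → ∀ k → E C k ≡ E D k
U-cong : ∀ {C D} → (∀ k → C k ≡ D k) → ∀ k → U C k ≡ U D k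
E-cong e zero    = refl
E-cong e (suc k) = cong₂ ℕ._+_ (U-cong e k) (e (suc k))
U-cong e zero    = refl
U-cong e (suc k) = cong₂ ℕ._+_ (E-cong e k) (e k)

-- The companion `EE≡UU+1` is the identity ((1+t²)² - (2t)²) / (1-t²)² = 1. Unfolding one step of
-- either statement produces the other at the preceding index, hence the mutual recursion.
EU≡UE : ∀ C → C 0 ≡ 0 → ∀ k → E (U C) k ≡ U (E C) k
EE≡UU+1 : ∀ C → C 0 ≡ 0 → ∀ k → E (E C) k ≡ U (U C) k ℕ.+ C k
EU≡UE C z zero = refl
EU≡UE C z (suc k) rewrite EE≡UU+1 C z k = lemma (U (U C) k) (E C k) (C k)
  where lemma : ∀ a b c → a ℕ.+ (b ℕ.+ c) ≡ a ℕ.+ c ℕ.+ b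
        lemma = solve-∀
EE≡UU+1 C z zero    = sym z
EE≡UU+1 C z (suc k) rewrite EU≡UE C z k = sym (ℕ.+-assoc (U (E C) k) _ _)

-- G a b = E^a U^b (k ↦ k); as E and U commute, H depends only on the numbers of repeats and changes.
G : ℕ → ℕ → ℕ → ℕ
G zero    zero    = λ k → k
G zero    (suc b) = U (G zero b)
G (suc a) b       = E (G a b)

G-0 : ∀ a b → G a b 0 ≡ 0
G-0 zero    zero    = refl
G-0 zero    (suc b) = refl
G-0 (suc a) b       = refl

U-G : ∀ a b k → U (G a b) k ≡ G a (suc b) k
U-G zero    b k = refl
U-G (suc a) b k = trans (sym (EU≡UE (G a b) (G-0 a b) k)) (E-cong (U-G a b) k)

-- For a first step `b`, the recursions of `H b` and `H (not b)` in the size of the alphabet call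
-- each other exactly as those of `E` and `U` do.
H-E : ∀ b bs k → H b k (b ∷ bs) ≡ E (λ j → H b j bs) k
H-U : ∀ b bs k → H (not b) k (b ∷ bs) ≡ U (λ j → H b j bs) k
H-E b     bs zero    = refl
H-E true  bs (suc k) = cong (ℕ._+ H true (suc k) bs) (H-U true bs k)
H-E false bs (suc k) = cong (ℕ._+ H false (suc k) bs) (H-U false bs k)
H-U b     bs zero    = refl
H-U true  bs (suc k) = cong (ℕ._+ H true k bs) (H-E true bs k)
H-U false bs (suc k) = cong (ℕ._+ H false k bs) (H-E false bs k)

H-G : ∀ δ bs k → H δ k bs ≡ G (repeats δ bs) (changes δ bs) k
H-G δ     [] zero    = refl
H-G δ     [] (suc k) = refl
H-G true  (true ∷ bs)  k = trans (H-E true bs k) (E-cong (H-G true bs) k)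
H-G true  (false ∷ bs) k = trans (H-U false bs k) (trans (U-cong (H-G false bs) k) (U-G (repeats false bs) _ k))
H-G false (true ∷ bs)  k = trans (H-U true bs k) (trans (U-cong (H-G true bs) k) (U-G (repeats true bs) _ k))
H-G false (false ∷ bs) k = trans (H-E false bs k) (E-cong (H-G false bs) k)

-- Once the length is fixed, the number of changes fixes the number of repeats. Two signs `δ` and
-- `δ'` are allowed so that V⁺ at one permutation can be identified with V⁻ at another.
H-changes : ∀ δ δ' k bs bs' → length bs ≡ length bs' → changes δ bs ≡ changes δ' bs' → H δ k bs ≡ H δ' k bs'
H-changes δ δ' k bs bs' l c = begin
  H δ k bs                               ≡⟨ H-G δ bs k ⟩
  G (repeats δ bs) (changes δ bs) k      ≡⟨ cong₂ (λ a b → G a b k) r c ⟩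
  G (repeats δ' bs') (changes δ' bs') k  ≡⟨ H-G δ' bs' k ⟨
  H δ' k bs'                             ∎
  where
  r : repeats δ bs ≡ repeats δ' bs'
  r = ℕ.+-cancelʳ-≡ (changes δ bs) _ _ (begin
    repeats δ bs ℕ.+ changes δ bs      ≡⟨ repeats+changes δ bs ⟩
    length bs                        ≡⟨ l ⟩
    length bs'                       ≡⟨ repeats+changes δ' bs' ⟨
    repeats δ' bs' ℕ.+ changes δ' bs'  ≡⟨ cong (repeats δ' bs' ℕ.+_) c ⟨
    repeats δ' bs' ℕ.+ changes δ bs    ∎)

private
  flip≡ : ∀ {a p} → not a ≡ p → a ≡ not p
  flip≡ {a} e = trans (sym (not-involutive a)) (cong not e)

-- `E` multiplies by an even series and `U` by an odd one. So agreement of two sequences on the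
-- indices of one parity is preserved by `E` and carried to the other parity by `U`.
E-par : ∀ {C D} p → (∀ k → sg true k ≡ p → C k ≡ D k) → ∀ k → sg true k ≡ p → E C k ≡ E D k
U-par : ∀ {C D} p → (∀ k → sg true k ≡ p → C k ≡ D k) → ∀ k → sg true k ≡ not p → U C k ≡ U D k
E-par p h zero    e = refl
E-par p h (suc k) e = cong₂ ℕ._+_ (U-par p h k (flip≡ e)) (h (suc k) e)
U-par p h zero    e = refl
U-par p h (suc k) e = cong₂ ℕ._+_ (E-par p h k e') (h k e')
  where e' = trans (flip≡ e) (not-involutive p)

-- The generating function of k ↦ k is t(1+t)²/(1-t²)², so that t(1+t²) and 2t² times (1+t)²
-- have the same even part; each U exchanges the parities.
G-par : ∀ a b k → sg true k ≡ sg true b → G (suc a) b k ≡ G a (suc b) k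
G-par zero zero zero e = refl
G-par zero zero (suc (suc k)) e = begin
  E id k ℕ.+ k ℕ.+ suc (suc k)        ≡⟨ cong (λ z → z ℕ.+ k ℕ.+ suc (suc k)) (G-par zero zero k (trans (sym (not-involutive _)) e)) ⟩
  U id k ℕ.+ k ℕ.+ suc (suc k)        ≡⟨ lemma (U id k) k ⟩
  U id k ℕ.+ suc k ℕ.+ suc k          ∎
  where id : ℕ → ℕ
        id j = j
        lemma : ∀ u k → u ℕ.+ k ℕ.+ suc (suc k) ≡ u ℕ.+ suc k ℕ.+ suc k
        lemma = solve-∀
G-par zero (suc b) k e = trans (EU≡UE (G zero b) (G-0 zero b) k)
  (U-par (sg true b) (G-par zero b) k e)
G-par (suc a) b k e = E-par (sg true b) (G-par a b) k e

double : ℕ → ℕ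
double zero    = 0
double (suc q) = suc (suc (double q))

double-⌊/2⌋ : ∀ c → c ≡ double ⌊ c /2⌋ ⊎ c ≡ suc (double ⌊ c /2⌋)
double-⌊/2⌋ zero          = inj₁ refl
double-⌊/2⌋ (suc zero)    = inj₂ refl
double-⌊/2⌋ (suc (suc c)) = Sum.map (cong (2 ℕ.+_)) (cong (2 ℕ.+_)) (double-⌊/2⌋ c)

sg-+double : ∀ δ o q → sg δ (o ℕ.+ double q) ≡ sg δ o
sg-+double δ o zero    = cong (sg δ) (ℕ.+-identityʳ o)
sg-+double δ o (suc q) rewrite ℕ.+-suc o (suc (double q)) | ℕ.+-suc o (double q) =
  trans (not-involutive _) (sg-+double δ o q)

-- If `c` is odd, `G-par` trades one `U` for an `E`, which leaves an even number of them besides the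
-- offset. The offset `o` carries the parity of `k`: 0 for even `k`, and one change set aside for
-- odd `k`.
G-canonical : ∀ o c a k → sg true k ≡ sg true o →
              ∃ λ a' → a' ℕ.+ double ⌊ c /2⌋ ≡ a ℕ.+ c × G a (o ℕ.+ c) k ≡ G a' (o ℕ.+ double ⌊ c /2⌋) k
G-canonical o c a k e with double-⌊/2⌋ c
... | inj₁ p = a , cong (a ℕ.+_) (sym p) , cong (λ z → G a (o ℕ.+ z) k) p
... | inj₂ p = suc a , trans (sym (ℕ.+-suc a _)) (cong (a ℕ.+_) (sym p)) , (begin
  G a (o ℕ.+ c) k              ≡⟨ cong (λ z → G a (o ℕ.+ z) k) p ⟩
  G a (o ℕ.+ suc d) k          ≡⟨ cong (λ z → G a z k) (ℕ.+-suc o d) ⟩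
  G a (suc (o ℕ.+ d)) k        ≡⟨ G-par a (o ℕ.+ d) k (trans e (sym (sg-+double true o ⌊ c /2⌋))) ⟨
  G (suc a) (o ℕ.+ d) k        ∎)
  where d = double ⌊ c /2⌋

G-merge : ∀ o k a a' c c' → sg true k ≡ sg true o → a ℕ.+ c ≡ a' ℕ.+ c' → ⌊ c /2⌋ ≡ ⌊ c' /2⌋ →
          G a (o ℕ.+ c) k ≡ G a' (o ℕ.+ c') k
G-merge o k a a' c c' e s h
  with x , p , q ← G-canonical o c a k e | x' , p' , q' ← G-canonical o c' a' k e = begin
  G a (o ℕ.+ c) k                     ≡⟨ q ⟩
  G x (o ℕ.+ double ⌊ c /2⌋) k        ≡⟨ cong₂ (λ y z → G y (o ℕ.+ double z) k) x≡x' h ⟩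
  G x' (o ℕ.+ double ⌊ c' /2⌋) k      ≡⟨ q' ⟨
  G a' (o ℕ.+ c') k                   ∎
  where
  x≡x' : x ≡ x'
  x≡x' = ℕ.+-cancelʳ-≡ (double ⌊ c /2⌋) x x'
    (trans p (trans s (trans (sym p') (cong (λ z → x' ℕ.+ double z) (sym h)))))

H-even : ∀ δ δ' j bs bs' → length bs ≡ length bs' → ⌊ changes δ bs /2⌋ ≡ ⌊ changes δ' bs' /2⌋ →
         H δ (2 ℕ.* j) bs ≡ H δ' (2 ℕ.* j) bs'
H-even δ δ' j bs bs' l h = trans (H-G δ bs (2 ℕ.* j)) (trans
  (G-merge 0 (2 ℕ.* j) (repeats δ bs) (repeats δ' bs') (changes δ bs) (changes δ' bs') (sg-2* true j)
    (trans (repeats+changes δ bs) (trans l (sym (repeats+changes δ' bs')))) h)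
  (sym (H-G δ' bs' (2 ℕ.* j))))

H-odd : ∀ δ δ' j bs bs' → length bs ≡ length bs' → ⌈ changes δ bs /2⌉ ≡ ⌈ changes δ' bs' /2⌉ →
        H δ (2 ℕ.* j ℕ.+ 1) bs ≡ H δ' (2 ℕ.* j ℕ.+ 1) bs'
H-odd δ δ' j bs bs' l h = trans (H-G δ bs (2 ℕ.* j ℕ.+ 1)) (trans
  (lemma (repeats δ bs) (repeats δ' bs') (changes δ bs) (changes δ' bs')
    (trans (repeats+changes δ bs) (trans l (sym (repeats+changes δ' bs')))) h)
  (sym (H-G δ' bs' (2 ℕ.* j ℕ.+ 1))))
  where
  lemma : ∀ a a' c c' → a ℕ.+ c ≡ a' ℕ.+ c' → ⌈ c /2⌉ ≡ ⌈ c' /2⌉ → G a c (2 ℕ.* j ℕ.+ 1) ≡ G a' c' (2 ℕ.* j ℕ.+ 1)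
  -- ⌈c/2⌉ = 0 only for c = 0. Otherwise one change is set aside as the offset 1, and ⌈(1+c)/2⌉ = 1
  -- + ⌊c/2⌋ reduces the claim to `G-merge`.
  lemma a a' zero    zero     s h = cong (λ z → G z 0 (2 ℕ.* j ℕ.+ 1)) (ℕ.+-cancelʳ-≡ 0 a a' s)
  lemma a a' (suc c) (suc c') s h = G-merge 1 (2 ℕ.* j ℕ.+ 1) a a' c c' (sg-odd true j)
    (ℕ.suc-injective (trans (sym (ℕ.+-suc a c)) (trans s (ℕ.+-suc a' c')))) (ℕ.suc-injective h)

-- Compositions and evaluation of ribbons

-- The formal sums admit arbitrary lists. This predicate singles out the compositions of a given
-- number, on which `match` decides membership in the descent class.
data _⊨_ : List ℕ → ℕ → Set where
  nil  : [] ⊨ 0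
  cons : ∀ i {I p} → I ⊨ p → (suc i ∷ I) ⊨ (suc i ℕ.+ p)

⊨-cast : ∀ {I p q} → q ≡ p → I ⊨ p → I ⊨ q
⊨-cast refl c = c

++-⊨ : ∀ {I J p q} → I ⊨ p → J ⊨ q → (I ++ J) ⊨ (p ℕ.+ q)
++-⊨ nil        c = c
++-⊨ {q = q} (cons i {p = p} b) c = ⊨-cast (ℕ.+-assoc (suc i) p q) (cons i (++-⊨ b c))

glue-⊨ : ∀ {I J p q} → I ⊨ p → J ⊨ q → glue I J ⊨ (p ℕ.+ q)
glue-⊨ nil                   c    = c
glue-⊨ (cons i nil)          nil  = ⊨-cast (ℕ.+-identityʳ _) (cons i nil)
glue-⊨ (cons i nil) (cons j {p = p} c) = ⊨-cast (sym eq) (cons (i ℕ.+ suc j) c)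
  where eq : suc (i ℕ.+ suc j) ℕ.+ p ≡ suc i ℕ.+ 0 ℕ.+ (suc j ℕ.+ p)
        eq rewrite ℕ.+-identityʳ i = cong suc (ℕ.+-assoc i (suc j) p)
glue-⊨ {q = q} (cons i (cons i' {p = p} b)) c =
  ⊨-cast (ℕ.+-assoc (suc i) (suc i' ℕ.+ p) q) (cons i (glue-⊨ (cons i' b) c))

-- The descent condition read entry by entry: no descent inside a part and a descent where a part
-- gives way to the next. No positions are carried along, which is what allows the condition to be
-- split at a cut of the word.
match : List ℕ → List ℕ → Bool
match []                []          = true
match []                (_ ∷ _)     = false
match (suc zero ∷ I)    (x ∷ [])    = match I []
match (suc zero ∷ I)    (x ∷ y ∷ w) = (y <ᵇ x) ∧ match I (y ∷ w)
match (suc (suc i) ∷ I) (x ∷ y ∷ w) = not (y <ᵇ x) ∧ match (suc i ∷ I) (y ∷ w)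
match _                 _           = false

private
  descents-head : ∀ s x w {t ts} → descents s (x ∷ w) ≡ t ∷ ts → s ℕ.≤ t
  descents-head s x (y ∷ w) e with y <ᵇ x
  ... | true  = ℕ.≤-reflexive (List.∷-injectiveˡ e)
  ... | false = ℕ.≤-trans (ℕ.n≤1+n s) (descents-head (suc s) y w e)

  descSetAux-head : ∀ s I {t ts} → descSetAux s I ≡ t ∷ ts → t ≡ s
  descSetAux-head s (i ∷ I) e = sym (List.∷-injectiveˡ e)

  reflects-map : {P Q : Set} {b : Bool} → (P → Q) → (Q → P) → Reflects P b → Reflects Q b
  reflects-map f g (ofʸ p) = ofʸ (f p)
  reflects-map f g (ofⁿ p) = ofⁿ (p ∘ g)

  -- `s` is the position of `x`, so the part beginning there ends at position `s + i`, where the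
  -- next descent has to be. Both position lists are increasing, so their heads already decide a
  -- mismatch.
  match-reflects : ∀ s i I p x w → I ⊨ p → suc i ℕ.+ p ≡ length (x ∷ w) →
    Reflects (descents s (x ∷ w) ≡ descSetAux (s ℕ.+ i) I) (match (suc i ∷ I) (x ∷ w))
  match-reflects s zero .[] .0 x [] nil e = ofʸ refl
  match-reflects s zero (suc j ∷ I) (suc _) x [] c ()
  match-reflects s (suc i) I p x [] c e = contradiction (ℕ.suc-injective e) λ ()
  match-reflects s zero .[] .0 x (y ∷ w) nil ()
  match-reflects s zero (suc j ∷ J) _ x (y ∷ w) (cons j {p = q} c) e with y <ᵇ x
  ... | true  = reflects-map to from (match-reflects (suc s) j J q y w c (ℕ.suc-injective e))
    where
    eq : descSetAux (suc s ℕ.+ j) J ≡ descSetAux (s ℕ.+ 0 ℕ.+ suc j) J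
    eq = cong (λ z → descSetAux z J) (trans (sym (ℕ.+-suc s j)) (cong (ℕ._+ suc j) (sym (ℕ.+-identityʳ s))))
    to : descents (suc s) (y ∷ w) ≡ descSetAux (suc s ℕ.+ j) J →
         s ∷ descents (suc s) (y ∷ w) ≡ (s ℕ.+ 0) ∷ descSetAux (s ℕ.+ 0 ℕ.+ suc j) J
    to h = cong₂ _∷_ (sym (ℕ.+-identityʳ s)) (trans h eq)
    from : s ∷ descents (suc s) (y ∷ w) ≡ (s ℕ.+ 0) ∷ descSetAux (s ℕ.+ 0 ℕ.+ suc j) J →
           descents (suc s) (y ∷ w) ≡ descSetAux (suc s ℕ.+ j) J
    from h = trans (List.∷-injectiveʳ h) (sym eq)
  ... | false = ofⁿ λ h → ℕ.<-irrefl (sym (ℕ.+-identityʳ s)) (descents-head (suc s) y w h)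
  match-reflects s (suc i) I p x (y ∷ w) c e with y <ᵇ x
  ... | true  = ofⁿ λ h → ℕ.m≢1+m+n s (trans (descSetAux-head (s ℕ.+ suc i) I (sym h)) (ℕ.+-suc s i))
  ... | false = reflects-map (λ h → trans h eq) (λ h → trans h (sym eq))
                  (match-reflects (suc s) i I p y w c (ℕ.suc-injective e))
    where eq = cong (λ z → descSetAux z I) (sym (ℕ.+-suc s i))

match-Des : ∀ I w → I ⊨ length w → ⌊ List.≡-dec ℕ._≟_ (descents 1 w) (descSet I) ⌋ ≡ match I w
match-Des I w c = trans (isYes≗does d) (det (proof d) (lemma I w c refl))
  where
  d = List.≡-dec ℕ._≟_ (descents 1 w) (descSet I)
  lemma : ∀ I w {m} → I ⊨ m → m ≡ length w → Reflects (descents 1 w ≡ descSet I) (match I w)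
  lemma .[] []      nil        e = ofʸ refl
  lemma _   []      (cons i c) ()
  lemma .[] (x ∷ w) nil        ()
  lemma _   (x ∷ w) (cons i {I} {p} c) e = match-reflects 1 i I p x w c e

private
  -- At the cut, concatenation demands a descent and gluing a non-descent. So one of the two terms
  -- vanishes, and the other reduces to the separate conditions on the two sides.
  match-product : ∀ i I j J u v x y {p q} → I ⊨ p → suc i ℕ.+ p ≡ suc (length u) → J ⊨ q → suc j ℕ.+ q ≡ suc (length v) →
    ind (match ((suc i ∷ I) ++ (suc j ∷ J)) (x ∷ u ++ y ∷ v)) + ind (match (glue (suc i ∷ I) (suc j ∷ J)) (x ∷ u ++ y ∷ v))
      ≡ ind (match (suc i ∷ I) (x ∷ u)) * ind (match (suc j ∷ J) (y ∷ v))
  match-product zero .[] j J [] v x y nil e cJ f with y <ᵇ x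
  ... | true  = trans (ℚ.+-identityʳ m) (sym (ℚ.*-identityˡ m))
    where m = ind (match (suc j ∷ J) (y ∷ v))
  ... | false = trans (ℚ.+-identityˡ m) (sym (ℚ.*-identityˡ m))
    where m = ind (match (suc j ∷ J) (y ∷ v))
  match-product zero .(suc _ ∷ _) j J [] v x y (cons i c) () cJ f
  match-product (suc i) I j J [] v x y cI e cJ f = contradiction (ℕ.suc-injective e) λ ()
  match-product zero .[] j J (x' ∷ u) v x y nil () cJ f
  match-product zero (suc i' ∷ I) j J (x' ∷ u) v x y (cons i' cI) e cJ f with x' <ᵇ x
  ... | true  = match-product i' I j J u v x' y cI (ℕ.suc-injective e) cJ f
  ... | false = sym (ℚ.*-zeroˡ (ind (match (suc j ∷ J) (y ∷ v))))
  match-product (suc i) [] j J (x' ∷ u) v x y cI e cJ f with x' <ᵇ x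
  ... | true  = sym (ℚ.*-zeroˡ (ind (match (suc j ∷ J) (y ∷ v))))
  ... | false = match-product i [] j J u v x' y cI (ℕ.suc-injective e) cJ f
  match-product (suc i) (i' ∷ I) j J (x' ∷ u) v x y cI e cJ f with x' <ᵇ x
  ... | true  = sym (ℚ.*-zeroˡ (ind (match (suc j ∷ J) (y ∷ v))))
  ... | false = match-product i (i' ∷ I) j J u v x' y cI (ℕ.suc-injective e) cJ f

pairing : FS → List ℕ → ℚ
pairing f w = ∑ f (λ t → proj₁ t * ind (match (proj₂ t) w))

ribProd-pairing : ∀ I J u v → I ⊨ length u → J ⊨ length v →
  pairing (ribProd I J) (u ++ v) ≡ ind (match I u) * ind (match J v)
ribProd-pairing I J u v cI cJ = lemma I J u v cI refl cJ refl
  where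
  unit : ∀ q → 1ℚ * q + 0ℚ ≡ q
  unit q = trans (ℚ.+-identityʳ _) (ℚ.*-identityˡ q)
  lemma : ∀ I J u v {p q} → I ⊨ p → p ≡ length u → J ⊨ q → q ≡ length v →
    pairing (ribProd I J) (u ++ v) ≡ ind (match I u) * ind (match J v)
  lemma .[] J [] v nil e cJ f = trans (unit (ind (match J v))) (sym (ℚ.*-identityˡ (ind (match J v))))
  lemma .[] J (x ∷ u) v nil () cJ f
  lemma _ J [] v (cons i c) () cJ f
  lemma _ .[] (x ∷ u) [] (cons i {I} c) e nil f rewrite ++-identityʳ u =
    trans (unit (ind (match (suc i ∷ I) (x ∷ u)))) (sym (ℚ.*-identityʳ (ind (match (suc i ∷ I) (x ∷ u)))))
  lemma _ .[] (x ∷ u) (y ∷ v) (cons i c) e nil ()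
  lemma _ _ (x ∷ u) [] (cons i c) e (cons j d) ()
  lemma _ _ (x ∷ u) (y ∷ v) (cons i {I} c) e (cons j {J} d) f =
    trans (cong₂ _+_ (ℚ.*-identityˡ (ind (match ((suc i ∷ I) ++ (suc j ∷ J)) (x ∷ u ++ y ∷ v))))
                     (unit (ind (match (glue (suc i ∷ I) (suc j ∷ J)) (x ∷ u ++ y ∷ v)))))
      (match-product i I j J u v x y c e d f)

Graded : ℕ → FS → Set
Graded p = All (λ t → proj₂ t ⊨ p)

fsProd-pairing : ∀ f g u v → Graded (length u) f → Graded (length v) g →
  pairing (fsProd f g) (u ++ v) ≡ pairing f u * pairing g v
fsProd-pairing f g u v cf cg = begin
  pairing (fsProd f g) (u ++ v)
    ≡⟨ ∑-concatMap f _ φ ⟩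
  _ ≡⟨ ∑-cong f (λ { (c , I) i → trans (∑-concatMap g _ φ) (∑-cong g (λ { (d , J) j →
         trans (∑-map (ribProd I J) _ φ)
         (trans (∑-cong (ribProd I J) (λ { (e , K) _ → ℚ.*-assoc (c * d) e (ind (match K (u ++ v))) }))
         (trans (∑-*ˡ (ribProd I J) (c * d) φ)
         (trans (cong (c * d *_) (ribProd-pairing I J u v (All.lookup cf i) (All.lookup cg j)))
           (solve 4 (λ c d a b → c :* d :* (a :* b) := (c :* a) :* (d :* b)) refl c d (ind (match I u)) (ind (match J v)))))) })) }) ⟩
  ∑ f (λ s → ∑ g (λ t → (proj₁ s * ind (match (proj₂ s) u)) * (proj₁ t * ind (match (proj₂ t) v))))
    ≡⟨ ∑*∑ f g _ _ ⟨
  pairing f u * pairing g v ∎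
  where φ : ℚ × List ℕ → ℚ
        φ t = proj₁ t * ind (match (proj₂ t) (u ++ v))

fsProd-Graded : ∀ {p q} f g → Graded p f → Graded q g → Graded (p ℕ.+ q) (fsProd f g)
fsProd-Graded f g cf cg = All.concat⁺ (All.map⁺ (All.map (λ {(c , I)} cI →
  All.concat⁺ (All.map⁺ (All.map (λ {(d , J)} cJ → All.map⁺ (All.map (λ {(e , K)} cK → cK) (rib cI cJ))) cg))) cf))
  where
  rib : ∀ {I J p q} → I ⊨ p → J ⊨ q → Graded (p ℕ.+ q) (ribProd I J)
  rib nil           cJ            = cJ ∷ []
  rib (cons i c)    nil           = ⊨-cast (ℕ.+-identityʳ _) (cons i c) ∷ []
  rib c@(cons _ _)  d@(cons _ _)  = ++-⊨ c d ∷ glue-⊨ c d ∷ []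

Homogeneous : Series → Set
Homogeneous F = ∀ p → Graded p (F p)

⋆-Homogeneous : ∀ {F G} → Homogeneous F → Homogeneous G → Homogeneous (F ⋆ G)
⋆-Homogeneous {F} {G} hF hG m = All.concat⁺ (All.map⁺ (All.tabulate (λ {p} i →
  subst (λ z → Graded z (fsProd (F p) (G (m ∸ p)))) (ℕ.m+[n∸m]≡n (ℕ.≤-pred (∈-upTo⁻ i)))
    (fsProd-Graded (F p) (G (m ∸ p)) (hF p) (hG (m ∸ p))))))

eval : Series → List ℕ → ℚ
eval F w = pairing (F (length w)) w

-- The sum of φ u * ψ v over all cuts w = uv. The letters already passed are absorbed into `φ`, so
-- that the recursion is on the word alone.
conv : (List ℕ → ℚ) → (List ℕ → ℚ) → List ℕ → ℚ
conv φ ψ []      = φ [] * ψ []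
conv φ ψ (x ∷ w) = φ [] * ψ (x ∷ w) + conv (λ u → φ (x ∷ u)) ψ w

conv-∑ : ∀ φ ψ w → ∑ (upTo (suc (length w))) (λ p → φ (take p w) * ψ (drop p w)) ≡ conv φ ψ w
conv-∑ φ ψ []      = ℚ.+-identityʳ _
conv-∑ φ ψ (x ∷ w) = cong (φ [] * ψ (x ∷ w) +_) (begin
  ∑ (applyUpTo suc (suc (length w))) h              ≡⟨ cong (λ l → ∑ l h) (sym (map-applyUpTo (λ z → z) suc (suc (length w)))) ⟩
  ∑ (List.map suc (upTo (suc (length w)))) h        ≡⟨ ∑-map (upTo (suc (length w))) suc h ⟩
  ∑ (upTo (suc (length w))) (h ∘ suc)               ≡⟨ conv-∑ (λ u → φ (x ∷ u)) ψ w ⟩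
  conv (λ u → φ (x ∷ u)) ψ w                        ∎)
  where h : ℕ → ℚ
        h p = φ (take p (x ∷ w)) * ψ (drop p (x ∷ w))

conv-cong : ∀ {φ φ' ψ ψ'} → (∀ w → φ w ≡ φ' w) → (∀ w → ψ w ≡ ψ' w) → ∀ w → conv φ ψ w ≡ conv φ' ψ' w
conv-cong e f []      = cong₂ _*_ (e []) (f [])
conv-cong e f (x ∷ w) = cong₂ _+_ (cong₂ _*_ (e []) (f (x ∷ w))) (conv-cong (λ u → e (x ∷ u)) f w)

conv-linear : ∀ c φ φ' ψ w → conv (λ u → c * φ u + φ' u) ψ w ≡ c * conv φ ψ w + conv φ' ψ w
conv-linear c φ φ' ψ [] =
  solve 4 (λ c a b d → (c :* a :+ b) :* d := c :* (a :* d) :+ b :* d) refl c (φ []) (φ' []) (ψ [])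
conv-linear c φ φ' ψ (x ∷ w) = trans
  (cong ((c * φ [] + φ' []) * ψ (x ∷ w) +_) (conv-linear c (λ u → φ (x ∷ u)) (λ u → φ' (x ∷ u)) ψ w))
  (solve 6 (λ c a b d e f → (c :* a :+ b) :* d :+ (c :* e :+ f) := c :* (a :* d :+ e) :+ (b :* d :+ f)) refl
    c (φ []) (φ' []) (ψ (x ∷ w)) (conv (λ u → φ (x ∷ u)) ψ w) (conv (λ u → φ' (x ∷ u)) ψ w))

-- Needed because the V's are powers of a product of two factors, while `conv-Φ` peels off a single
-- factor. `conv-linear` enters since shifting `conv φ ψ` past a letter yields two terms.
conv-assoc : ∀ φ ψ χ w → conv (conv φ ψ) χ w ≡ conv φ (conv ψ χ) w
conv-assoc φ ψ χ []      = ℚ.*-assoc (φ []) (ψ []) (χ [])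
conv-assoc φ ψ χ (x ∷ w) = begin
  φ [] * ψ [] * χ (x ∷ w) + conv (λ u → φ [] * ψ (x ∷ u) + conv φ' ψ u) χ w
    ≡⟨ cong (φ [] * ψ [] * χ (x ∷ w) +_) (conv-linear (φ []) (λ u → ψ (x ∷ u)) (conv φ' ψ) χ w) ⟩
  φ [] * ψ [] * χ (x ∷ w) + (φ [] * conv ψ' χ w + conv (conv φ' ψ) χ w)
    ≡⟨ cong (λ z → φ [] * ψ [] * χ (x ∷ w) + (φ [] * conv ψ' χ w + z)) (conv-assoc φ' ψ χ w) ⟩
  φ [] * ψ [] * χ (x ∷ w) + (φ [] * conv ψ' χ w + conv φ' (conv ψ χ) w)
    ≡⟨ solve 5 (λ a b c d e → a :* b :* c :+ (a :* d :+ e) := a :* (b :* c :+ d) :+ e) refl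
         (φ []) (ψ []) (χ (x ∷ w)) (conv ψ' χ w) (conv φ' (conv ψ χ) w) ⟩
  φ [] * (ψ [] * χ (x ∷ w) + conv ψ' χ w) + conv φ' (conv ψ χ) w ∎
  where φ' = λ u → φ (x ∷ u)
        ψ' = λ u → ψ (x ∷ u)

eval-⋆ : ∀ {F G} → Homogeneous F → Homogeneous G → ∀ w → eval (F ⋆ G) w ≡ conv (eval F) (eval G) w
eval-⋆ {F} {G} hF hG w = begin
  pairing ((F ⋆ G) m) w
    ≡⟨ ∑-concatMap (upTo (suc m)) (λ p → fsProd (F p) (G (m ∸ p))) (λ t → proj₁ t * ind (match (proj₂ t) w)) ⟩
  ∑ (upTo (suc m)) (λ p → pairing (fsProd (F p) (G (m ∸ p))) w)
    ≡⟨ ∑-cong (upTo (suc m)) (λ p i → step p (ℕ.≤-pred (∈-upTo⁻ i))) ⟩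
  ∑ (upTo (suc m)) (λ p → eval F (take p w) * eval G (drop p w))
    ≡⟨ conv-∑ (eval F) (eval G) w ⟩
  conv (eval F) (eval G) w ∎
  where
  m = length w
  step : ∀ p → p ℕ.≤ m → pairing (fsProd (F p) (G (m ∸ p))) w ≡ eval F (take p w) * eval G (drop p w)
  step p p≤m = begin
    pairing (fsProd (F p) (G (m ∸ p))) w
      ≡⟨ cong₂ (λ a b → pairing (fsProd (F a) (G b)) w) (sym ta) (sym (length-drop p w)) ⟩
    pairing (fsProd (F (length u)) (G (length v))) w
      ≡⟨ cong (pairing (fsProd (F (length u)) (G (length v)))) (sym (take++drop≡id p w)) ⟩
    pairing (fsProd (F (length u)) (G (length v))) (u ++ v)
      ≡⟨ fsProd-pairing _ _ u v (hF (length u)) (hG (length v)) ⟩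
    eval F u * eval G v ∎
    where
    u = take p w
    v = drop p w
    ta : length u ≡ p
    ta = trans (length-take p w) (ℕ.m≤n⇒m⊓n≡m p≤m)

V₁ : Bool → Series
V₁ true  = V₁⁺
V₁ false = V₁⁻

V₁-Homogeneous : ∀ δ → Homogeneous (V₁ δ)
V₁-Homogeneous true  zero    = nil ∷ []
V₁-Homogeneous true  (suc p) = subst ((suc p ∷ []) ⊨_) (ℕ.+-identityʳ (suc p)) (cons p nil) ∷ []
V₁-Homogeneous false p       = ones p ∷ []
  where ones : ∀ p → replicate p 1 ⊨ p
        ones zero    = nil
        ones (suc p) = cons 0 (ones p)

oneS-Homogeneous : Homogeneous oneS
oneS-Homogeneous zero    = nil ∷ []
oneS-Homogeneous (suc p) = []

^⋆-Homogeneous : ∀ {F} → Homogeneous F → ∀ k → Homogeneous (F ^⋆ k)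
^⋆-Homogeneous h zero    = oneS-Homogeneous
^⋆-Homogeneous h (suc k) = ⋆-Homogeneous h (^⋆-Homogeneous h k)

bits : List ℕ → List Bool
bits (x ∷ y ∷ r) = not (y <ᵇ x) ∷ bits (y ∷ r)
bits _           = []

monotone : Bool → List ℕ → Bool
monotone δ (x ∷ y ∷ r) = agree δ (not (y <ᵇ x)) ∧ monotone δ (y ∷ r)
monotone δ _           = true

eval-V₁ : ∀ δ w → eval (V₁ δ) w ≡ ind (monotone δ w)
eval-V₁ true [] = refl
eval-V₁ true (x ∷ w) = trans (ℚ.+-identityʳ _) (trans (ℚ.*-identityˡ _) (cong ind (lemma x w)))
  where
  lemma : ∀ x w → match (suc (length w) ∷ []) (x ∷ w) ≡ monotone true (x ∷ w)
  lemma x []      = refl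
  lemma x (y ∷ w) = cong (not (y <ᵇ x) ∧_) (lemma y w)
eval-V₁ false [] = refl
eval-V₁ false (x ∷ w) = trans (ℚ.+-identityʳ _) (trans (ℚ.*-identityˡ _) (cong ind (lemma x w)))
  where
  lemma : ∀ x w → match (replicate (suc (length w)) 1) (x ∷ w) ≡ monotone false (x ∷ w)
  lemma x []      = refl
  lemma x (y ∷ w) with y <ᵇ x
  ... | true  = lemma y w
  ... | false = refl

-- The empty word has a clause of its own because `bits` does not distinguish it from a one-letter
-- word, and every V has constant term 1.
Φ : Bool → ℕ → List ℕ → ℚ
Φ δ k []      = 1ℚ
Φ δ k (x ∷ w) = nat (H δ k (bits (x ∷ w)))

-- The cuts reproduce the recursion of `H`. An empty first piece gives `H (not δ) k`. Otherwise the
-- first piece contains `x`: if the step from `x` to `y` agrees with `δ`, deleting `x` leaves a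
-- first piece of the same kind, possibly empty; if it disagrees, the piece is `x` alone.
conv-Φ : ∀ δ k w → conv (ind ∘ monotone δ) (Φ (not δ) k) w ≡ Φ δ (suc k) w
conv-Φ δ k []       = refl
conv-Φ δ k (x ∷ []) = trans (cong (_+ 1ℚ * 1ℚ) (ℚ.*-identityˡ (nat (H (not δ) k [])))) (last k)
  where last : ∀ k → nat (H (not δ) k []) + 1ℚ * 1ℚ ≡ nat (suc k)
        last zero    = refl
        last (suc k) = trans (ℚ.+-comm (nat (suc k)) 1ℚ) refl
conv-Φ δ k (x ∷ y ∷ w) with conv-Φ δ k (y ∷ w) | agree δ (not (y <ᵇ x))
... | ih | true = begin
  1ℚ * nat h + conv (ind ∘ monotone δ) (Φ (not δ) k) (y ∷ w)
    ≡⟨ cong₂ _+_ (ℚ.*-identityˡ (nat h)) ih ⟩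
  nat h + nat (H δ (suc k) (bits (y ∷ w)))
    ≡⟨ nat-+ h _ ⟨
  nat (h ℕ.+ H δ (suc k) (bits (y ∷ w))) ∎
  where h = H (not δ) k (bits (x ∷ y ∷ w))
... | ih | false = begin
  1ℚ * nat h + (1ℚ * Φ (not δ) k (y ∷ w) + conv (λ _ → 0ℚ) (Φ (not δ) k) w)
    ≡⟨ cong₂ _+_ (ℚ.*-identityˡ (nat h)) (cong₂ _+_ (ℚ.*-identityˡ (Φ (not δ) k (y ∷ w))) (conv-0 w)) ⟩
  nat h + (nat (H (not δ) k (bits (y ∷ w))) + 0ℚ)
    ≡⟨ cong (nat h +_) (ℚ.+-identityʳ _) ⟩
  nat h + nat (H (not δ) k (bits (y ∷ w)))
    ≡⟨ nat-+ h _ ⟨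
  nat (h ℕ.+ H (not δ) k (bits (y ∷ w))) ∎
  where
  h = H (not δ) k (bits (x ∷ y ∷ w))
  conv-0 : ∀ {ψ} w → conv (λ _ → 0ℚ) ψ w ≡ 0ℚ
  conv-0 {ψ} []      = ℚ.*-zeroˡ (ψ [])
  conv-0 {ψ} (z ∷ w) = cong₂ _+_ (ℚ.*-zeroˡ (ψ (z ∷ w))) (conv-0 w)

eval-V₁⋆ : ∀ δ k {F} → Homogeneous F → (∀ w → eval F w ≡ Φ (not δ) k w) → ∀ w → eval (V₁ δ ⋆ F) w ≡ Φ δ (suc k) w
eval-V₁⋆ δ k hF e w = trans (eval-⋆ (V₁-Homogeneous δ) hF w) (trans (conv-cong (eval-V₁ δ) e w) (conv-Φ δ k w))

eval-power : ∀ δ j w → eval ((V₁ δ ⋆ V₁ (not δ)) ^⋆ j) w ≡ Φ δ (j ℕ.* 2) w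
eval-power δ zero []      = refl
eval-power δ zero (x ∷ w) = refl
eval-power δ (suc j) w = begin
  eval ((V₁ δ ⋆ V₁ (not δ)) ⋆ Q) w
    ≡⟨ eval-⋆ hP hQ w ⟩
  conv (eval (V₁ δ ⋆ V₁ (not δ))) (eval Q) w
    ≡⟨ conv-cong (eval-⋆ (V₁-Homogeneous δ) (V₁-Homogeneous (not δ))) (eval-power δ j) w ⟩
  conv (conv (eval (V₁ δ)) (eval (V₁ (not δ)))) (Φ δ (j ℕ.* 2)) w
    ≡⟨ conv-assoc (eval (V₁ δ)) (eval (V₁ (not δ))) (Φ δ (j ℕ.* 2)) w ⟩
  conv (eval (V₁ δ)) (conv (eval (V₁ (not δ))) (Φ δ (j ℕ.* 2))) w
    ≡⟨ conv-cong (eval-V₁ δ) (λ u → trans (conv-cong (eval-V₁ (not δ)) (λ v → cong (λ d → Φ d (j ℕ.* 2) v) (sym (nn δ))) u)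
         (conv-Φ (not δ) (j ℕ.* 2) u)) w ⟩
  conv (ind ∘ monotone δ) (Φ (not δ) (suc (j ℕ.* 2))) w
    ≡⟨ conv-Φ δ (suc (j ℕ.* 2)) w ⟩
  Φ δ (suc j ℕ.* 2) w ∎
  where
  Q = (V₁ δ ⋆ V₁ (not δ)) ^⋆ j
  hP = ⋆-Homogeneous (V₁-Homogeneous δ) (V₁-Homogeneous (not δ))
  hQ = ^⋆-Homogeneous hP j
  nn : ∀ b → not (not b) ≡ b
  nn true  = refl
  nn false = refl

private
  power-Homogeneous : ∀ δ j → Homogeneous ((V₁ δ ⋆ V₁ (not δ)) ^⋆ j)
  power-Homogeneous δ = ^⋆-Homogeneous (⋆-Homogeneous (V₁-Homogeneous δ) (V₁-Homogeneous (not δ)))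

VS : Bool → ℕ → Series
VS true  = V⁺S
VS false = V⁻S

VS-correct : ∀ δ k → Homogeneous (VS δ k) × (∀ w → eval (VS δ k) w ≡ Φ δ k w)
VS-correct true k with k % 2 | m≡m%n+[m/n]*n k 2 | m%n<n k 2
... | 0 | e | _ = power-Homogeneous true (k / 2) ,
      λ w → trans (eval-power true (k / 2) w) (cong (λ z → Φ true z w) (sym e))
... | 1 | e | _ = ⋆-Homogeneous (V₁-Homogeneous true) (power-Homogeneous false (k / 2)) ,
      λ w → trans (eval-V₁⋆ true ((k / 2) ℕ.* 2) (power-Homogeneous false (k / 2)) (eval-power false (k / 2)) w) (cong (λ z → Φ true z w) (sym e))
... | suc (suc _) | _ | s≤s (s≤s ())
VS-correct false k with k % 2 | m≡m%n+[m/n]*n k 2 | m%n<n k 2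
... | 0 | e | _ = power-Homogeneous false (k / 2) ,
      λ w → trans (eval-power false (k / 2) w) (cong (λ z → Φ false z w) (sym e))
... | 1 | e | _ = ⋆-Homogeneous (V₁-Homogeneous false) (power-Homogeneous true (k / 2)) ,
      λ w → trans (eval-V₁⋆ false ((k / 2) ℕ.* 2) (power-Homogeneous true (k / 2)) (eval-power true (k / 2)) w) (cong (λ z → Φ false z w) (sym e))
... | suc (suc _) | _ | s≤s (s≤s ())

toAlg-pairing : ∀ {n} f (σ : Word n) → Graded (length (seqOf σ)) f → toAlg n f σ ≡ pairing f (seqOf σ)
toAlg-pairing [] σ [] = refl
toAlg-pairing ((c , I) ∷ f) σ (g ∷ gs) =
  cong₂ _+_ (cong (λ b → c * ind b) (match-Des I (seqOf σ) g)) (toAlg-pairing f σ gs)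

length-seqOf : ∀ {n} (σ : Word n) → length (seqOf σ) ≡ n
length-seqOf σ = Vec.length-toList (Vec.map _ σ)

Vδ : Bool → (n k : ℕ) → A n
Vδ true  = V⁺
Vδ false = V⁻

Vδ-Φ : ∀ δ n k (σ : Word n) → Vδ δ n k σ ≡ Φ δ k (seqOf σ)
Vδ-Φ δ n k σ = trans (lemma δ) (trans
  (toAlg-pairing (VS δ k n) σ (subst (λ m → Graded m (VS δ k n)) (sym l) (proj₁ (VS-correct δ k) n)))
  (trans (cong (λ m → pairing (VS δ k m) (seqOf σ)) (sym l)) (proj₂ (VS-correct δ k) (seqOf σ))))
  where
  l = length-seqOf σ
  lemma : ∀ δ → Vδ δ n k σ ≡ toAlg n (VS δ k n) σ
  lemma true  = refl
  lemma false = refl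

-- Permutations as injective words, bijections and rankings

Inj : ∀ {m n} → (Fin m → Fin n) → Set
Inj f = ∀ {i j} → f i ≡ f j → i ≡ j

words-suc : ∀ k n → words k (suc n) ≡ cartesianProductWith _∷_ (allFin k) (words k n)
words-suc k n = lemma (allFin k)
  where
  lemma : ∀ is → concatMap (λ i → List.map (i ∷_) (words k n)) is ≡ cartesianProductWith _∷_ is (words k n)
  lemma []       = refl
  lemma (i ∷ is) = cong (List.map (i ∷_) (words k n) ++_) (lemma is)

words-unique : ∀ k n → Unique (words k n)
words-unique k zero    = [] ∷ []
words-unique k (suc n) = subst Unique (sym (words-suc k n))
  (Unique.cartesianProductWith⁺ _∷_ Vec.∷-injective (Unique.allFin⁺ k) (words-unique k n))

∈-words : ∀ {k n} (v : Vec (Fin k) n) → v ∈ words k n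
∈-words []              = here refl
∈-words {k} {suc n} (i ∷ v) = subst ((i ∷ v) ∈_) (sym (words-suc k n))
  (∈-cartesianProductWith⁺ _∷_ (∈-allFin i) (∈-words v))

perms-unique : ∀ n → Unique (perms n)
perms-unique n = Unique.filter⁺ _ (words-unique n n)

Unique⇒Inj : ∀ {k n} (v : Vec (Fin k) n) → Unique (toList v) → Inj (lookup v)
Unique⇒Inj (x ∷ v) (p ∷ u) {zero}  {zero}  e = refl
Unique⇒Inj (x ∷ v) (p ∷ u) {zero}  {suc j} e =
  contradiction e (All.lookup p (VecMem.∈-toList⁺ (VecMem.∈-lookup j v)))
Unique⇒Inj (x ∷ v) (p ∷ u) {suc i} {zero}  e =
  contradiction (sym e) (All.lookup p (VecMem.∈-toList⁺ (VecMem.∈-lookup i v)))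
Unique⇒Inj (x ∷ v) (p ∷ u) {suc i} {suc j} e = cong suc (Unique⇒Inj v u e)

Inj⇒Unique : ∀ {k n} (v : Vec (Fin k) n) → Inj (lookup v) → Unique (toList v)
Inj⇒Unique []      inj = []
Inj⇒Unique (x ∷ v) inj = All.tabulate fresh ∷ Inj⇒Unique v (λ e → Fin.suc-injective (inj e))
  where
  fresh : ∀ {y} → y ∈ toList v → x ≢ y
  fresh y∈ e = contradiction (inj {zero} {suc (VecAny.index m)} (trans e (VecAny.lookup-index m))) λ ()
    where m = VecMem.∈-toList⁻ y∈

perms⇒Inj : ∀ {n} {σ : Word n} → σ ∈ perms n → Inj (lookup σ)
perms⇒Inj {n} {σ} m = Unique⇒Inj σ (toWitness {a? = DecUnique.unique? Fin._≟_ (toList σ)} (proj₂ (∈-filter⁻ _ {xs = words n n} m)))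

Inj⇒perms : ∀ {n} (σ : Word n) → Inj (lookup σ) → σ ∈ perms n
Inj⇒perms σ inj = ∈-filter⁺ _ (∈-words σ) (fromWitness {a? = DecUnique.unique? Fin._≟_ (toList σ)} (Inj⇒Unique σ inj))

unique-map : {X Y : Set} (e : X → Y) (xs : List X) → (∀ {x y} → x ∈ xs → y ∈ xs → e x ≡ e y → x ≡ y) →
             Unique xs → Unique (List.map e xs)
unique-map e []       inj []      = []
unique-map e (x ∷ xs) inj (p ∷ u) =
  All.map⁺ (All.tabulate (λ y∈ q → All.lookup p y∈ (inj (here refl) (there y∈) q))) ∷
  unique-map e xs (λ i j → inj (there i) (there j)) u

bijection-length : {X Y : Set} (e : X → Y) (xs : List X) (ys : List Y) → Unique xs → Unique ys →
  (∀ {x} → x ∈ xs → e x ∈ ys) → (∀ {x y} → x ∈ xs → y ∈ xs → e x ≡ e y → x ≡ y) →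
  (∀ {y} → y ∈ ys → ∃ λ x → x ∈ xs × e x ≡ y) → length xs ≡ length ys
bijection-length e xs ys ux uy into inj onto = trans (sym (length-map e xs))
  (↭-length (∼bag⇒↭ (unique∧set⇒bag (unique-map e xs inj ux) uy (mk⇔ to from))))
  where
  to : ∀ {y} → y ∈ List.map e xs → y ∈ ys
  to m with x , x∈ , refl ← ∈-map⁻ e m = into x∈
  from : ∀ {y} → y ∈ ys → y ∈ List.map e xs
  from m with x , x∈ , refl ← onto m = ∈-map⁺ e x∈

-- Pigeonhole: a missed value would give an injection of `Fin (suc n)` into `Fin n`.
surjective : ∀ {n} {β : Fin n → Fin n} → Inj β → ∀ y → ∃ λ x → β x ≡ y
surjective {suc n} {β} inj y with Fin.any? (λ x → β x Fin.≟ y)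
... | yes p = p
... | no ¬p = contradiction (Fin.injective⇒≤ {f = λ x → punchOut (y≢ x)} (λ e → inj (Fin.punchOut-injective (y≢ _) (y≢ _) e))) (ℕ.<-irrefl refl)
  where y≢ : ∀ x → y ≢ β x
        y≢ x e = ¬p (x , sym e)

-- A permutation is determined by the order it induces on positions. For the bound `β i ≤ β' i`,
-- induct on the value of `β i`: the position whose value is one less precedes `i` for `β'` too, and
-- the induction hypothesis bounds its image.
order-determines : ∀ {n} (β β' : Fin n → Fin n) → Inj β → Inj β' →
  (∀ i j → β i Fin.< β j → β' i Fin.< β' j) → (∀ i j → β' i Fin.< β' j → β i Fin.< β j) → ∀ i → β i ≡ β' i
order-determines β β' inj inj' h h' i =
  Fin.toℕ-injective (ℕ.≤-antisym (le β β' inj h _ i refl) (le β' β inj' h' _ i refl))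
  where
  le : ∀ {n} (β β' : Fin n → Fin n) → Inj β → (∀ i j → β i Fin.< β j → β' i Fin.< β' j) →
       ∀ m i → toℕ (β i) ≡ m → m ℕ.≤ toℕ (β' i)
  le β β' inj h zero    i e = z≤n
  le {n} β β' inj h (suc m) i e with j , q ← surjective inj (fromℕ< {m} {n} (ℕ.<-trans (ℕ.n<1+n m) (subst (ℕ._< n) e (Fin.toℕ<n (β i))))) =
    ℕ.≤-<-trans (le β β' inj h m j βj) (h j i (subst₂ ℕ._<_ (sym βj) (sym e) (ℕ.n<1+n m)))
    where βj : toℕ (β j) ≡ m
          βj = trans (cong toℕ q) (Fin.toℕ-fromℕ< _)

filter-< : {X : Set} {P Q : X → Set} (P? : ∀ x → Dec (P x)) (Q? : ∀ x → Dec (Q x)) →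
  (∀ x → P x → Q x) → ∀ xs {y} → y ∈ xs → Q y → ¬ P y → length (filter P? xs) ℕ.< length (filter Q? xs)
filter-< {P = P} {Q} P? Q? sub (x ∷ xs) (here refl) q ¬p with P? x | Q? x
... | yes p | _     = contradiction p ¬p
... | no _  | no ¬q = contradiction q ¬q
... | no _  | yes _ = s≤s (le xs)
  where
  le : ∀ xs → length (filter P? xs) ℕ.≤ length (filter Q? xs)
  le [] = z≤n
  le (x ∷ xs) with P? x | Q? x
  ... | yes p | yes _ = s≤s (le xs)
  ... | yes p | no ¬q = contradiction (sub x p) ¬q
  ... | no _  | yes _ = ℕ.m≤n⇒m≤1+n (le xs)
  ... | no _  | no _  = le xs
filter-< P? Q? sub (x ∷ xs) (there m) q ¬p with P? x | Q? x | filter-< P? Q? sub xs m q ¬p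
... | yes p | yes _ | ih = s≤s ih
... | yes p | no ¬q | ih = contradiction (sub x p) ¬q
... | no _  | yes _ | ih = ℕ.m≤n⇒m≤1+n ih
... | no _  | no _  | ih = ih

-- The rank of `i` is the number of elements below `i`. It is less than `n` since `i` is not below
-- itself. For `i ≺ j`, everything below `i` is below `j`, and `i` itself makes the count strictly
-- larger.
ranking : ∀ {n} (_≺_ : Fin n → Fin n → Set) → (∀ i j → Dec (i ≺ j)) → (∀ i → ¬ (i ≺ i)) →
  (∀ {i j k} → i ≺ j → j ≺ k → i ≺ k) → ∃ λ (β : Fin n → Fin n) → ∀ i j → i ≺ j → β i Fin.< β j
ranking {n} _≺_ dec irr tr = (λ i → fromℕ< (lt i)) , λ i j p →
  subst₂ ℕ._<_ (sym (Fin.toℕ-fromℕ< (lt i))) (sym (Fin.toℕ-fromℕ< (lt j)))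
    (filter-< (λ k → dec k i) (λ k → dec k j) (λ k q → tr q p) (allFin n) (∈-allFin i) p (irr i))
  where
  lt : ∀ i → length (filter (λ j → dec j i) (allFin n)) ℕ.< n
  lt i = subst (length (filter (λ j → dec j i) (allFin n)) ℕ.<_) (length-tabulate {n = n} (λ z → z))
    (filter-notAll (λ j → dec j i) (allFin n) (lose (∈-allFin i) (irr i)))

-- Signed lexicographic orders

-- Ties between letters are broken by `R`, reversed on negative letters. `R` is a parameter because
-- the product alphabet needs the nested order `Lex ε (Lex δ _<_)`. Equality of letters is stored as
-- an equation since the letters arise as `toℕ` of finite indices, on which matching on a shared
-- index would get stuck.
data Lex {Z : Set} (δ : Bool) (R : Z → Z → Set) : ℕ × Z → ℕ × Z → Set where
  less : ∀ {c d a b} → c ℕ.< d → Lex δ R (c , a) (d , b)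
  up   : ∀ {c d a b} → c ≡ d → sg δ c ≡ true  → R a b → Lex δ R (c , a) (d , b)
  down : ∀ {c d a b} → c ≡ d → sg δ c ≡ false → R b a → Lex δ R (c , a) (d , b)

module _ {Z : Set} {R : Z → Z → Set} (δ : Bool) where

  Lex-trans : (∀ {a b c} → R a b → R b c → R a c) → ∀ {x y z} → Lex δ R x y → Lex δ R y z → Lex δ R x z
  Lex-trans t (less p)      (less q)      = less (ℕ.<-trans p q)
  Lex-trans t (less p)      (up refl _ _)    = less p
  Lex-trans t (less p)      (down refl _ _)  = less p
  Lex-trans t (up refl _ _)    (less q)      = less q
  Lex-trans t (down refl _ _)  (less q)      = less q
  Lex-trans t (up refl s r)    (up refl _ r')   = up refl s (t r r')
  Lex-trans t (down refl s r)  (down refl _ r') = down refl s (t r' r)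
  Lex-trans t (up refl s r)    (down refl s' r') = contradiction (trans (sym s) s') λ ()
  Lex-trans t (down refl s r)  (up refl s' r')   = contradiction (trans (sym s) s') λ ()

  Lex-asym : (∀ {a b} → R a b → ¬ R b a) → ∀ {x y} → Lex δ R x y → ¬ Lex δ R y x
  Lex-asym as (less p)        (less q)         = ℕ.<-asym p q
  Lex-asym as (less p)        (up refl _ _)    = ℕ.<-irrefl refl p
  Lex-asym as (less p)        (down refl _ _)  = ℕ.<-irrefl refl p
  Lex-asym as (up refl _ _)   (less q)         = ℕ.<-irrefl refl q
  Lex-asym as (down refl _ _) (less q)         = ℕ.<-irrefl refl q
  Lex-asym as (up refl s r)   (up refl _ r')   = as r r'
  Lex-asym as (down refl s r) (down refl _ r') = as r r'
  Lex-asym as (up refl s r)   (down refl s' r') = contradiction (trans (sym s) s') λ ()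
  Lex-asym as (down refl s r) (up refl s' r')   = contradiction (trans (sym s) s') λ ()

  Lex-total : ∀ c d {a b} → R a b ⊎ R b a → Lex δ R (c , a) (d , b) ⊎ Lex δ R (d , b) (c , a)
  Lex-total c d r with ℕ.<-cmp c d
  ... | tri< p _ _ = inj₁ (less p)
  ... | tri> _ _ p = inj₂ (less p)
  ... | tri≈ _ refl _ with sg δ c in s | r
  ... | true  | inj₁ q = inj₁ (up refl s q)
  ... | true  | inj₂ q = inj₂ (up refl s q)
  ... | false | inj₁ q = inj₂ (down refl s q)
  ... | false | inj₂ q = inj₁ (down refl s q)

  -- Two maps are taken because a negative letter compares the second coordinates in the opposite
  -- order.
  Lex-map : ∀ {Z' : Set} {R' : Z' → Z' → Set} {c d a b a' b'} → (R a b → R' a' b') → (R b a → R' b' a') →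
            Lex δ R (c , a) (d , b) → Lex δ R' (c , a') (d , b')
  Lex-map f g (less p)     = less p
  Lex-map f g (up e s r)   = up e s (f r)
  Lex-map f g (down e s r) = down e s (g r)

  Lex-dec : (∀ a b → Dec (R a b)) → ∀ x y → Dec (Lex δ R x y)
  Lex-dec dec (c , a) (d , b) with ℕ.<-cmp c d
  ... | tri< p _ _ = yes (less p)
  ... | tri> ¬p ¬q _ = no λ { (less p) → ¬p p ; (up e _ _) → ¬q e ; (down e _ _) → ¬q e }
  ... | tri≈ ¬p e _ with sg δ c in s
  ...   | true with dec a b
  ...     | yes r = yes (up e s r)
  ...     | no ¬r = no λ { (less p) → ¬p p ; (up _ _ r) → ¬r r ; (down _ s' _) → contradiction (trans (sym s) s') λ () }
  Lex-dec dec (c , a) (d , b) | tri≈ ¬p e _ | false with dec b a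
  ...     | yes r = yes (down e s r)
  ...     | no ¬r = no λ { (less p) → ¬p p ; (down _ _ r) → ¬r r ; (up _ s' _) → contradiction (trans (sym s) s') λ () }

-- Words compatible with a sequence

-- The least letter that may follow letter `d` at entry `x`.
next : Bool → ℕ → ℕ → ∀ {m} → Vec ℕ m → ℕ
next δ d x []      = d
next δ d x (y ∷ _) = if agree (sg δ d) (not (y <ᵇ x)) then d else suc d

-- A condition on neighbours, with the lower bound `lb` as state: the form in which words can be
-- counted recursively. `Compat` is the same condition on all pairs of positions, the form that
-- survives a rearrangement of positions.
valid : ∀ {k m} → Bool → ℕ → Vec (Fin k) m → Vec ℕ m → Bool
valid δ lb []      []      = true
valid δ lb (d ∷ h) (x ∷ w) = not (toℕ d <ᵇ lb) ∧ valid δ (next δ (toℕ d) x w) h w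

Compat : ∀ {k m} → Bool → Vec (Fin k) m → Vec ℕ m → Set
Compat δ h w = ∀ i j → i Fin.< j → Lex δ ℕ._<_ (toℕ (lookup h i) , lookup w i) (toℕ (lookup h j) , lookup w j)

Distinct : ∀ {m} → Vec ℕ m → Set
Distinct w = ∀ {i j} → lookup w i ≡ lookup w j → i ≡ j

private
  not<ᵇ⇒≤ : ∀ a b → T (not (a <ᵇ b)) → b ℕ.≤ a
  not<ᵇ⇒≤ a b t with a <ᵇ b in e
  ... | false = ℕ.≮⇒≥ (λ p → subst T e (ℕ.<⇒<ᵇ p))

  ≤⇒not<ᵇ : ∀ a b → b ℕ.≤ a → T (not (a <ᵇ b))
  ≤⇒not<ᵇ a b p with a <ᵇ b in e
  ... | false = _
  ... | true  = contradiction (ℕ.<ᵇ⇒< a b (subst T (sym e) _)) (ℕ.≤⇒≯ p)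

  next-Lex : ∀ δ d e x y {m} (w : Vec ℕ m) → x ≢ y → next δ d x (y ∷ w) ℕ.≤ e → Lex δ ℕ._<_ (d , x) (e , y)
  next-Lex δ d e x y w x≢y p with sg δ d in s | y <ᵇ x in lt
  ... | true  | true  = less p
  ... | false | false = less p
  ... | true  | false with ℕ.m≤n⇒m<n∨m≡n p
  ...   | inj₁ q = less q
  ...   | inj₂ q = up q s (ℕ.≤∧≢⇒< (not<ᵇ⇒≤ y x (subst (T ∘ not) (sym lt) _)) x≢y)
  next-Lex δ d e x y w x≢y p | false | true with ℕ.m≤n⇒m<n∨m≡n p
  ...   | inj₁ q = less q
  ...   | inj₂ q = down q s (ℕ.<ᵇ⇒< y x (subst T (sym lt) _))

  Lex-next : ∀ δ d e x y {m} (w : Vec ℕ m) → Lex δ ℕ._<_ (d , x) (e , y) → next δ d x (y ∷ w) ℕ.≤ e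
  Lex-next δ d e x y w (less p) with agree (sg δ d) (not (y <ᵇ x))
  ... | true  = ℕ.<⇒≤ p
  ... | false = p
  Lex-next δ d e x y w (up refl s r) rewrite s with y <ᵇ x in lt
  ... | false = ℕ.≤-refl
  ... | true  = contradiction (ℕ.<ᵇ⇒< y x (subst T (sym lt) _)) (ℕ.<-asym r)
  Lex-next δ d e x y w (down refl s r) rewrite s with y <ᵇ x in lt
  ... | true  = ℕ.≤-refl
  ... | false = contradiction (subst T lt (ℕ.<⇒<ᵇ r)) λ ()

-- Neighbouring comparisons extend to all pairs by transitivity of `Lex`. Distinctness turns a
-- non-descent of `w` into a strict ascent.
valid⇒Compat : ∀ {k m} δ lb (h : Vec (Fin k) m) w → Distinct w → T (valid δ lb h w) → Compat δ h w
valid⇒Compat δ lb (d ∷ h) (x ∷ w) dist t zero (suc j) _ = first h w dist (proj₂ (Equivalence.to T-∧ t)) j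
  where
  first : ∀ {m} (h : Vec (Fin _) m) w → Distinct (x ∷ w) → T (valid δ (next δ (toℕ d) x w) h w) →
          ∀ j → Lex δ ℕ._<_ (toℕ d , x) (toℕ (lookup h j) , lookup w j)
  first (e ∷ h) (y ∷ w) dist t j with p , q ← Equivalence.to (T-∧ {not (toℕ e <ᵇ next δ (toℕ d) x (y ∷ w))}) t = go j
    where
    adj : Lex δ ℕ._<_ (toℕ d , x) (toℕ e , y)
    adj = next-Lex δ (toℕ d) (toℕ e) x y w (λ eq → contradiction (dist {zero} {suc zero} eq) λ ()) (not<ᵇ⇒≤ _ _ p)
    go : ∀ j → Lex δ ℕ._<_ (toℕ d , x) (toℕ (lookup (e ∷ h) j) , lookup (y ∷ w) j)
    go zero    = adj
    go (suc j) = Lex-trans δ ℕ.<-trans adj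
      (valid⇒Compat δ (next δ (toℕ d) x (y ∷ w)) (e ∷ h) (y ∷ w) (λ eq → Fin.suc-injective (dist eq)) t zero (suc j) (s≤s z≤n))
valid⇒Compat δ lb (d ∷ h) (x ∷ w) dist t (suc i) (suc j) (s≤s p) =
  valid⇒Compat δ _ h w (λ eq → Fin.suc-injective (dist eq)) (proj₂ (Equivalence.to (T-∧ {not (toℕ d <ᵇ lb)}) t)) i j p

Compat⇒valid : ∀ {k m} δ (h : Vec (Fin k) m) w → Compat δ h w → T (valid δ 0 h w)
Compat⇒valid δ h w c = go 0 h w (λ _ → z≤n) c
  where
  go : ∀ {k m} lb (h : Vec (Fin k) m) w → (∀ i → lb ℕ.≤ toℕ (lookup h i)) → Compat δ h w → T (valid δ lb h w)
  go lb []      []      b c = _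
  go lb (d ∷ h) (x ∷ w) b c = Equivalence.from T-∧
    (≤⇒not<ᵇ (toℕ d) lb (b zero) , go _ h w (bound h w c) (λ i j p → c (suc i) (suc j) (s≤s p)))
    where
    bound : ∀ {m} (h : Vec (Fin _) m) w → Compat δ (d ∷ h) (x ∷ w) → ∀ i → next δ (toℕ d) x w ℕ.≤ toℕ (lookup h i)
    bound (e ∷ h) (y ∷ w) c zero    = Lex-next δ (toℕ d) (toℕ e) x y w (c zero (suc zero) (s≤s z≤n))
    bound (e ∷ h) (y ∷ w) c (suc i) = ℕ.≤-trans (bound (e ∷ h) (y ∷ w) c zero) (le (c (suc zero) (suc (suc i)) (s≤s (s≤s z≤n))))
      where
      le : ∀ {c d a b} → Lex δ ℕ._<_ (c , a) (d , b) → c ℕ.≤ d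
      le (less p)        = ℕ.<⇒≤ p
      le (up refl _ _)   = ℕ.≤-refl
      le (down refl _ _) = ℕ.≤-refl

∑-allFin-suc : ∀ k (f : Fin (suc k) → ℚ) → ∑ (allFin (suc k)) f ≡ f zero + ∑ (allFin k) (f ∘ suc)
∑-allFin-suc k f = cong (f zero +_)
  (trans (cong (λ l → ∑ l f) (sym (map-tabulate (λ z → z) Fin.suc))) (∑-map (allFin k) Fin.suc f))

tailSum : ℕ → ℕ → (ℕ → ℚ) → ℚ
tailSum k lb F = ∑ (allFin k) (λ d → ind (not (toℕ d <ᵇ lb)) * F (toℕ d))

tailSum-end : ∀ k F → tailSum k k F ≡ 0ℚ
tailSum-end zero    F = refl
tailSum-end (suc k) F = trans (∑-allFin-suc k (λ d → ind (not (toℕ d <ᵇ suc k)) * F (toℕ d)))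
  (cong₂ _+_ (ℚ.*-zeroˡ (F 0)) (tailSum-end k (F ∘ suc)))

tailSum-step : ∀ k lb F → lb ℕ.< k → tailSum k lb F ≡ tailSum k (suc lb) F + F lb
tailSum-step (suc k) zero F p = begin
  tailSum (suc k) 0 F                      ≡⟨ ∑-allFin-suc k (λ d → ind (not (toℕ d <ᵇ 0)) * F (toℕ d)) ⟩
  1ℚ * F 0 + tailSum k 0 (F ∘ suc)         ≡⟨ cong (_+ tailSum k 0 (F ∘ suc)) (ℚ.*-identityˡ (F 0)) ⟩
  F 0 + tailSum k 0 (F ∘ suc)              ≡⟨ ℚ.+-comm (F 0) _ ⟩
  tailSum k 0 (F ∘ suc) + F 0              ≡⟨ cong (_+ F 0) (sym (trans (∑-allFin-suc k (λ d → ind (not (toℕ d <ᵇ 1)) * F (toℕ d)))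
                                               (trans (cong (_+ tailSum k 0 (F ∘ suc)) (ℚ.*-zeroˡ (F 0))) (ℚ.+-identityˡ (tailSum k 0 (F ∘ suc)))))) ⟩
  tailSum (suc k) 1 F + F 0                ∎
tailSum-step (suc k) (suc lb) F (s≤s p) = begin
  tailSum (suc k) (suc lb) F                               ≡⟨ shift lb ⟩
  tailSum k lb (F ∘ suc)                                   ≡⟨ tailSum-step k lb (F ∘ suc) p ⟩
  tailSum k (suc lb) (F ∘ suc) + F (suc lb)                ≡⟨ cong (_+ F (suc lb)) (sym (shift (suc lb))) ⟩
  tailSum (suc k) (suc (suc lb)) F + F (suc lb)            ∎
  where
  shift : ∀ lb → tailSum (suc k) (suc lb) F ≡ tailSum k lb (F ∘ suc)
  shift lb = trans (∑-allFin-suc k (λ d → ind (not (toℕ d <ᵇ suc lb)) * F (toℕ d)))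
    (trans (cong (_+ tailSum k lb (F ∘ suc)) (ℚ.*-zeroˡ (F 0))) (ℚ.+-identityˡ _))

ind-∧ : ∀ a b → ind (a ∧ b) ≡ ind a * ind b
ind-∧ true  b = sym (ℚ.*-identityˡ (ind b))
ind-∧ false b = sym (ℚ.*-zeroˡ (ind b))

count : ∀ {m} → Bool → ℕ → ℕ → Vec ℕ m → ℚ
count {m} δ k lb w = ∑ (words k m) (λ h → ind (valid δ lb h w))

count-∷ : ∀ {m} δ k lb x (w : Vec ℕ m) → count δ k lb (x ∷ w) ≡ tailSum k lb (λ d → count δ k (next δ d x w) w)
count-∷ {m} δ k lb x w = trans (∑-concatMap (allFin k) (λ i → List.map (i ∷_) (words k m)) _)
  (∑-cong (allFin k) (λ d _ → trans (∑-map (words k m) (d ∷_) _)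
    (trans (∑-cong (words k m) (λ h _ → ind-∧ (not (toℕ d <ᵇ lb)) (valid δ (next δ (toℕ d) x w) h w)))
      (∑-*ˡ (words k m) (ind (not (toℕ d <ᵇ lb))) (λ h → ind (valid δ (next δ (toℕ d) x w) h w))))))

-- The letters from `lb` on form an alternating alphabet of size `j` with first sign `sg δ lb`.
-- Splitting off the words that use its first letter, `lb`, is the case split of `H`.
count-H : ∀ {m} δ k lb j x (w : Vec ℕ m) → lb ℕ.+ j ≡ k → count δ k lb (x ∷ w) ≡ nat (H (sg δ lb) j (bits (toList (x ∷ w))))
count-H δ k lb zero x w e = trans (count-∷ δ k lb x w)
  (trans (cong (λ z → tailSum k z (λ d → count δ k (next δ d x w) w)) (trans (sym (ℕ.+-identityʳ lb)) e)) (tailSum-end k (λ d → count δ k (next δ d x w) w)))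
count-H δ k lb (suc j) x w e = begin
  count δ k lb (x ∷ w)
    ≡⟨ count-∷ δ k lb x w ⟩
  tailSum k lb F
    ≡⟨ tailSum-step k lb F (subst (lb ℕ.<_) e (ℕ.m<m+n lb (s≤s z≤n))) ⟩
  tailSum k (suc lb) F + F lb
    ≡⟨ cong₂ _+_ (trans (sym (count-∷ δ k (suc lb) x w)) (count-H δ k (suc lb) j x w e')) refl ⟩
  nat (H (not (sg δ lb)) j (bits (toList (x ∷ w)))) + F lb
    ≡⟨ last w ⟩
  nat (H (sg δ lb) (suc j) (bits (toList (x ∷ w)))) ∎
  where
  F = λ d → count δ k (next δ d x w) w
  e' : suc lb ℕ.+ j ≡ k
  e' = trans (sym (ℕ.+-suc lb j)) e
  H-[] : ∀ δ j → H δ j [] ≡ j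
  H-[] δ zero    = refl
  H-[] δ (suc j) = refl
  last : ∀ {m} (w : Vec ℕ m) → nat (H (not (sg δ lb)) j (bits (toList (x ∷ w)))) + count δ k (next δ lb x w) w
                ≡ nat (H (sg δ lb) (suc j) (bits (toList (x ∷ w))))
  last []      = trans (cong (λ z → nat z + 1ℚ) (H-[] (not (sg δ lb)) j)) (ℚ.+-comm (nat j) 1ℚ)
  last (y ∷ w) with agree (sg δ lb) (not (y <ᵇ x))
  ... | true  = trans (cong (nat h +_) (count-H δ k lb (suc j) y w e)) (sym (nat-+ h _))
    where h = H (not (sg δ lb)) j (bits (toList (x ∷ y ∷ w)))
  ... | false = trans (cong (nat h +_) (count-H δ k (suc lb) j y w e')) (sym (nat-+ h _))
    where h = H (not (sg δ lb)) j (bits (toList (x ∷ y ∷ w)))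

vals : ∀ {n} → Word n → Vec ℕ n
vals σ = Vec.map (λ x → suc (toℕ x)) σ

-- Both sides are values of `H`: the ribbon side by `conv-Φ`, the count of words by `count-H`.
Vδ-count : ∀ δ n k (σ : Word n) → Vδ δ n k σ ≡ count δ k 0 (vals σ)
Vδ-count δ n k σ = trans (Vδ-Φ δ n k σ) (lemma (vals σ))
  where
  lemma : ∀ {m} (w : Vec ℕ m) → Φ δ k (toList w) ≡ count δ k 0 w
  lemma []      = refl
  lemma (x ∷ w) = sym (count-H δ k 0 k x w refl)

≢⇒<⊎> : ∀ {t t'} → t ≢ t' → t ℕ.< t' ⊎ t' ℕ.< t
≢⇒<⊎> {t} {t'} n with ℕ.<-cmp t t'
... | tri< p _ _ = inj₁ p
... | tri≈ _ p _ = contradiction p n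
... | tri> _ _ p = inj₂ p

-- The alphabet of the product

module _ (ε δ : Bool) (k : ℕ) where

  -- The sign with which the block of a letter of sign `ε'` begins. A negative block is the alphabet
  -- reversed with flipped signs, so it begins with the flipped sign of letter k - 1, that is
  -- `sg δ k`.
  productSign : Bool → Bool
  productSign ε' = if ε' then δ else sg δ k

  private
    productSign-not : ∀ ε' → sg (productSign ε') k ≡ productSign (not ε')
    productSign-not true  = refl
    productSign-not false = sg-double δ k

    -- The product alphabet alternates: a block of size `k` ends so that the alternation continues
    -- with the first sign of the following block, by `productSign-not`.
    sg-block : ∀ ε' c b → sg (productSign ε') (c ℕ.* k ℕ.+ b) ≡ sg (productSign (sg ε' c)) b
    sg-block ε' zero    b = refl
    sg-block ε' (suc c) b = begin
      sg (productSign ε') (k ℕ.+ c ℕ.* k ℕ.+ b)        ≡⟨ cong (sg (productSign ε')) (ℕ.+-assoc k (c ℕ.* k) b) ⟩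
      sg (productSign ε') (k ℕ.+ (c ℕ.* k ℕ.+ b))      ≡⟨ sg-+ (productSign ε') k _ ⟩
      sg (sg (productSign ε') k) (c ℕ.* k ℕ.+ b)       ≡⟨ cong (λ z → sg z (c ℕ.* k ℕ.+ b)) (productSign-not ε') ⟩
      sg (productSign (not ε')) (c ℕ.* k ℕ.+ b)        ≡⟨ sg-block (not ε') c b ⟩
      sg (productSign (sg (not ε') c)) b               ≡⟨ cong (λ z → sg (productSign z) b) (sg-not ε' c) ⟩
      sg (productSign (not (sg ε' c))) b               ∎

  twist : ∀ {l} → Fin l → Fin k → Fin (l ℕ.* k)
  twist c a = combine c (if sg ε (toℕ c) then a else opposite a)

  private
    η : Bool
    η = productSign ε

    sg-combine : ∀ {l} (c : Fin l) (b : Fin k) → sg η (toℕ (combine c b)) ≡ sg (productSign (sg ε (toℕ c))) (toℕ b)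
    sg-combine c b = trans (cong (sg η) (trans (Fin.toℕ-combine c b) (cong (ℕ._+ toℕ b) (ℕ.*-comm k (toℕ c)))))
      (sg-block ε (toℕ c) (toℕ b))

    opposite-sum : ∀ (a : Fin k) → suc (toℕ a) ℕ.+ toℕ (opposite a) ≡ k
    opposite-sum a = trans (cong (suc (toℕ a) ℕ.+_) (Fin.opposite-prop a)) (ℕ.m+[n∸m]≡n (Fin.toℕ<n a))

    -- Since 1 + a + opposite a = k, the sign of the reversed letter differs from `sg δ (suc a)` by
    -- two equal numbers of flips, which cancel.
    sg-opposite : ∀ (a : Fin k) → sg (sg δ k) (toℕ (opposite a)) ≡ not (sg δ (toℕ a))
    sg-opposite a = begin
      sg (sg δ k) b                           ≡⟨ cong (λ z → sg (sg δ z) b) (opposite-sum a) ⟨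
      sg (sg δ (suc (toℕ a) ℕ.+ b)) b         ≡⟨ cong (λ z → sg z b) (sg-+ δ (suc (toℕ a)) b) ⟩
      sg (sg (sg δ (suc (toℕ a))) b) b        ≡⟨ sg-double (sg δ (suc (toℕ a))) b ⟩
      sg δ (suc (toℕ a))                      ∎
      where b = toℕ (opposite a)

    opposite-< : ∀ {a a' : Fin k} → toℕ a' ℕ.< toℕ a → toℕ (opposite a) ℕ.< toℕ (opposite a')
    opposite-< {a} {a'} p = ℕ.+-cancelˡ-< (suc (toℕ a')) _ _ (subst (suc (toℕ a') ℕ.+ toℕ (opposite a) ℕ.<_)
      (trans (opposite-sum a) (sym (opposite-sum a')))
      (ℕ.+-monoˡ-< (toℕ (opposite a)) (s≤s p)))

    combine-monoʳ-< : ∀ {l} (c : Fin l) {b b' : Fin k} → toℕ b ℕ.< toℕ b' → toℕ (combine c b) ℕ.< toℕ (combine c b')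
    combine-monoʳ-< c {b} {b'} p = subst₂ ℕ._<_ (sym (Fin.toℕ-combine c b)) (sym (Fin.toℕ-combine c b'))
      (ℕ.+-monoʳ-< (k ℕ.* toℕ c) p)

  -- In a negative block the outer order reverses the comparison of the inner letters and that of
  -- the final entries. `opposite` makes up for the first reversal and the flipped sign for the
  -- second.
  twist-Lex : ∀ {l} (c c' : Fin l) (a a' : Fin k) {t t'} →
    Lex ε (Lex δ ℕ._<_) (toℕ c , (toℕ a , t)) (toℕ c' , (toℕ a' , t')) →
    Lex η ℕ._<_ (toℕ (twist c a) , t) (toℕ (twist c' a') , t')
  twist-Lex c c' a a' (less p) = less (Fin.combine-monoˡ-< _ _ p)
  twist-Lex c c' a a' (up e s r) with Fin.toℕ-injective e
  ... | refl rewrite s with r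
  ...   | less p = less (combine-monoʳ-< c p)
  ...   | up e' s' q with refl ← Fin.toℕ-injective e' =
          up refl (trans (sg-combine c a) (trans (cong (λ z → sg (productSign z) (toℕ a)) s) s')) q
  ...   | down e' s' q with refl ← Fin.toℕ-injective e' =
          down refl (trans (sg-combine c a) (trans (cong (λ z → sg (productSign z) (toℕ a)) s) s')) q
  twist-Lex c c' a a' (down e s r) with Fin.toℕ-injective e
  ... | refl rewrite s with r
  ...   | less p = less (combine-monoʳ-< c (opposite-< p))
  ...   | up e' s' q with refl ← Fin.toℕ-injective e' =
          down refl (trans (sg-combine c (opposite a)) (trans (cong (λ z → sg (productSign z) (toℕ (opposite a))) s)
            (trans (sg-opposite a) (cong not s')))) q
  ...   | down e' s' q with refl ← Fin.toℕ-injective e' =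
          up refl (trans (sg-combine c (opposite a)) (trans (cong (λ z → sg (productSign z) (toℕ (opposite a))) s)
            (trans (sg-opposite a) (cong not s')))) q

  -- A monotone map out of a total order into an asymmetric one reflects the order; `t ≢ t'`
  -- supplies totality.
  Lex-twist : ∀ {l} (c c' : Fin l) (a a' : Fin k) {t t'} → t ≢ t' →
    Lex η ℕ._<_ (toℕ (twist c a) , t) (toℕ (twist c' a') , t') →
    Lex ε (Lex δ ℕ._<_) (toℕ c , (toℕ a , t)) (toℕ c' , (toℕ a' , t'))
  Lex-twist c c' a a' {t} {t'} t≢t' p
    with Lex-total ε (toℕ c) (toℕ c') (Lex-total δ (toℕ a) (toℕ a') (≢⇒<⊎> t≢t'))
  ... | inj₁ q = q
  ... | inj₂ q = contradiction (twist-Lex c' c a' a q) (Lex-asym η ℕ.<-asym p)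

  twist-injective : ∀ {l} (c c' : Fin l) a a' → twist c a ≡ twist c' a' → c ≡ c' × a ≡ a'
  twist-injective c c' a a' e with refl ← Fin.combine-injectiveˡ c _ c' _ e
    with q ← Fin.combine-injectiveʳ c _ c _ e with sg ε (toℕ c)
  ... | true  = refl , q
  ... | false = refl , trans (sym (Fin.opposite-involutive a)) (trans (cong opposite q) (Fin.opposite-involutive a'))

  twist-surjective : ∀ {l} (h : Fin (l ℕ.* k)) → ∃ λ c → ∃ λ a → twist {l} c a ≡ h
  twist-surjective {l} h with c , b , refl ← Fin.combine-surjective {l} {k} h with sg ε (toℕ c) in s
  ... | true  = c , b , cong (λ z → combine c (if z then b else opposite b)) s
  ... | false = c , opposite b , trans (cong (λ z → combine c (if z then opposite b else opposite (opposite b))) s)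
                  (cong (combine c) (Fin.opposite-involutive b))

-- Factorisations of a permutation and words over the product alphabet

val : ∀ {n} → Word n → Fin n → ℕ
val σ i = suc (toℕ (lookup σ i))

lookup-vals : ∀ {n} (σ : Word n) i → lookup (vals σ) i ≡ val σ i
lookup-vals σ i = Vec.lookup-map i _ σ

vals-Distinct : ∀ {n} {σ : Word n} → σ ∈ perms n → Distinct (vals σ)
vals-Distinct {σ = σ} m {i} {j} e = perms⇒Inj m (Fin.toℕ-injective (ℕ.suc-injective
  (trans (sym (lookup-vals σ i)) (trans e (lookup-vals σ j)))))

-- `Compat` without the shift of the values by one, and for functions instead of vectors, so that
-- composites and rankings can be inserted directly.
CompatF : ∀ {k n} → Bool → (Fin n → Fin k) → (Fin n → Fin n) → Set
CompatF δ f α = ∀ i j → i Fin.< j → Lex δ ℕ._<_ (toℕ (f i) , toℕ (α i)) (toℕ (f j) , toℕ (α j))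

valid⇒CompatF : ∀ {k n} δ (h : Vec (Fin k) n) {σ} → σ ∈ perms n → T (valid δ 0 h (vals σ)) → CompatF δ (lookup h) (lookup σ)
valid⇒CompatF δ h {σ} m t i j p = Lex-map δ {a = lookup (vals σ) i} {b = lookup (vals σ) j} (low i j) (low j i)
  (valid⇒Compat δ 0 h (vals σ) (vals-Distinct m) t i j p)
  where
  low : ∀ i j → lookup (vals σ) i ℕ.< lookup (vals σ) j → toℕ (lookup σ i) ℕ.< toℕ (lookup σ j)
  low i j q = ℕ.≤-pred (subst₂ ℕ._<_ (lookup-vals σ i) (lookup-vals σ j) q)

CompatF⇒valid : ∀ {k n} δ (h : Vec (Fin k) n) σ → CompatF δ (lookup h) (lookup σ) → T (valid δ 0 h (vals σ))
CompatF⇒valid δ h σ c = Compat⇒valid δ h (vals σ) (λ i j p →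
  Lex-map δ {b' = lookup (vals σ) j} (raise i j) (raise j i) (c i j p))
  where
  raise : ∀ i j → toℕ (lookup σ i) ℕ.< toℕ (lookup σ j) → lookup (vals σ) i ℕ.< lookup (vals σ) j
  raise i j q = subst₂ ℕ._<_ (sym (lookup-vals σ i)) (sym (lookup-vals σ j)) (s≤s q)

vec-ext : ∀ {X : Set} {n} (u v : Vec X n) → (∀ i → lookup u i ≡ lookup v i) → u ≡ v
vec-ext u v e = trans (sym (Vec.tabulate∘lookup u)) (trans (Vec.tabulate-cong e) (Vec.tabulate∘lookup v))

CompatF-cong : ∀ {k n} δ {f f' : Fin n → Fin k} {α α' : Fin n → Fin n} → (∀ i → f i ≡ f' i) → (∀ i → α i ≡ α' i) →
               CompatF δ f α → CompatF δ f' α'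
CompatF-cong δ e e' c i j p = subst₂ (Lex δ ℕ._<_)
  (cong₂ (λ a b → toℕ a , toℕ b) (e i) (e' i)) (cong₂ (λ a b → toℕ a , toℕ b) (e j) (e' j)) (c i j p)

record Sorting {n : ℕ} (_≺_ : Fin n → Fin n → Set) : Set where
  field
    rank unrank  : Fin n → Fin n
    rank-unrank  : ∀ j → rank (unrank j) ≡ j
    unrank-rank  : ∀ i → unrank (rank i) ≡ i
    rank-mono    : ∀ i j → i ≺ j → rank i Fin.< rank j
    unrank-mono  : ∀ i j → i Fin.< j → unrank i ≺ unrank j

sorting : ∀ {n} (_≺_ : Fin n → Fin n → Set) → (∀ i j → Dec (i ≺ j)) → (∀ i → ¬ (i ≺ i)) →
  (∀ {i j k} → i ≺ j → j ≺ k → i ≺ k) → (∀ i j → i ≢ j → i ≺ j ⊎ j ≺ i) → Sorting _≺_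
sorting {n} _≺_ dec irr tr tot with b , b-mono ← ranking _≺_ dec irr tr = record
  { rank = b ; unrank = b⁻¹ ; rank-unrank = bb⁻¹ ; unrank-rank = λ i → b-inj (bb⁻¹ (b i))
  ; rank-mono = b-mono ; unrank-mono = b⁻¹-mono }
  where
  b-inj : Inj b
  b-inj {i} {j} e with i Fin.≟ j
  ... | yes p = p
  ... | no ¬p with tot i j ¬p
  ...   | inj₁ q = contradiction (b-mono i j q) (ℕ.<-irrefl (cong toℕ e))
  ...   | inj₂ q = contradiction (b-mono j i q) (ℕ.<-irrefl (cong toℕ (sym e)))
  b⁻¹ : Fin n → Fin n
  b⁻¹ j = proj₁ (surjective b-inj j)
  bb⁻¹ : ∀ j → b (b⁻¹ j) ≡ j
  bb⁻¹ j = proj₂ (surjective b-inj j)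
  b⁻¹-mono : ∀ i j → i Fin.< j → b⁻¹ i ≺ b⁻¹ j
  b⁻¹-mono i j p with tot (b⁻¹ i) (b⁻¹ j) (λ e → ℕ.<-irrefl (cong toℕ (trans (sym (bb⁻¹ i)) (trans (cong b e) (bb⁻¹ j)))) p)
  ... | inj₁ q = q
  ... | inj₂ q = contradiction (subst₂ Fin._<_ (bb⁻¹ j) (bb⁻¹ i) (b-mono _ _ q)) (ℕ.<-asym p)

module Product {n : ℕ} (δ ε : Bool) (k l : ℕ) (τ : Word n) (τ∈ : τ ∈ perms n) where

  η : Bool
  η = productSign ε δ k ε

  Quad : Set
  Quad = (Word n × Word n) × (Vec (Fin k) n × Vec (Fin l) n)

  quads : List Quad
  quads = cartesianProduct (cartesianProduct (perms n) (perms n)) (cartesianProduct (words k n) (words l n))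

  factors : Quad → Bool
  factors ((α , β) , (f , g)) = (compose α β ==W τ) ∧ (valid δ 0 f (vals α) ∧ valid ε 0 g (vals β))

  merge : Quad → Vec (Fin (l ℕ.* k)) n
  merge ((α , β) , (f , g)) = tabulate (λ i → twist ε δ k (lookup g i) (lookup f (lookup β i)))

  record Factorisation (q : Quad) : Set where
    constructor fact
    α = proj₁ (proj₁ q)
    β = proj₂ (proj₁ q)
    f = proj₁ (proj₂ q)
    g = proj₂ (proj₂ q)
    field
      α∈  : α ∈ perms n
      β∈  : β ∈ perms n
      αβ  : ∀ i → lookup α (lookup β i) ≡ lookup τ i
      f~α : CompatF δ (lookup f) (lookup α)
      g~β : CompatF ε (lookup g) (lookup β)

    -- Hence β is the ranking of the positions by (f ∘ β , τ), which is what makes merge injective.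
    β-reflects : ∀ i j → lookup β i Fin.< lookup β j →
      Lex δ ℕ._<_ (toℕ (lookup f (lookup β i)) , toℕ (lookup τ i)) (toℕ (lookup f (lookup β j)) , toℕ (lookup τ j))
    β-reflects i j p = subst₂ (λ x y → Lex δ ℕ._<_ (toℕ (lookup f (lookup β i)) , toℕ x) (toℕ (lookup f (lookup β j)) , toℕ y))
      (αβ i) (αβ j) (f~α (lookup β i) (lookup β j) p)

  factorisation : ∀ {q} → q ∈ filterᵇ factors quads → Factorisation q
  factorisation {q@((α , β) , (f , g))} m
    with q∈ , t ← ∈-filter⁻ (T? ∘ factors) {xs = quads} m
    with αβ∈ , _ ← ∈-cartesianProduct⁻ (cartesianProduct (perms n) (perms n)) _ q∈
    with α∈ , β∈ ← ∈-cartesianProduct⁻ (perms n) (perms n) αβ∈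
    with t₁ , t₂₃ ← Equivalence.to (T-∧ {compose α β ==W τ}) t
    with t₂ , t₃ ← Equivalence.to (T-∧ {valid δ 0 f (vals α)}) t₂₃ = fact α∈ β∈
      (λ i → trans (sym (Vec.lookup∘tabulate _ i)) (cong (λ v → lookup v i) (toWitness {a? = Vec.≡-dec Fin._≟_ (compose α β) τ} t₁)))
      (valid⇒CompatF δ f α∈ t₂) (valid⇒CompatF ε g β∈ t₃)

  ∈-factors : ∀ {q} → Factorisation q → q ∈ filterᵇ factors quads
  ∈-factors {q@((α , β) , (f , g))} F = ∈-filter⁺ (T? ∘ factors)
    (∈-cartesianProduct⁺ (∈-cartesianProduct⁺ α∈ β∈) (∈-cartesianProduct⁺ (∈-words f) (∈-words g)))
    (Equivalence.from T-∧ (fromWitness {a? = Vec.≡-dec Fin._≟_ (compose α β) τ}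
        (vec-ext _ _ (λ i → trans (Vec.lookup∘tabulate _ i) (αβ i)))
      , Equivalence.from T-∧ (CompatF⇒valid δ f α f~α , CompatF⇒valid ε g β g~β)))
    where open Factorisation F using (α∈; β∈; αβ; f~α; g~β)

  validη : Vec (Fin (l ℕ.* k)) n → Bool
  validη h = valid η 0 h (vals τ)

  merge-valid : ∀ {q} → Factorisation q → T (validη (merge q))
  merge-valid {q} F = CompatF⇒valid η (merge q) τ (CompatF-cong η (λ i → sym (Vec.lookup∘tabulate _ i)) (λ _ → refl)
    (λ i j p → twist-Lex ε δ k (lookup g i) (lookup g j) (lookup f (lookup β i)) (lookup f (lookup β j))
      (Lex-map ε {a = toℕ (lookup β i)} {b = toℕ (lookup β j)} (β-reflects i j) (β-reflects j i) (g~β i j p))))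
    where open Factorisation F

  -- The merged letters give back `g` and f ∘ β. Both β and β' then order the positions by the same
  -- keys, so they agree by `order-determines`, and surjectivity of β recovers `f` and `α`.
  merge-injective : ∀ {q q'} → Factorisation q → Factorisation q' → merge q ≡ merge q' → q ≡ q'
  merge-injective {q@((α , β) , (f , g))} {q'@((α' , β') , (f' , g'))} F F' e =
    cong₂ _,_ (cong₂ _,_ (vec-ext α α' α≡) (vec-ext β β' β≡)) (cong₂ _,_ (vec-ext f f' f≡) (vec-ext g g' (proj₁ ∘ letters)))
    where
    module F  = Factorisation F
    module F' = Factorisation F'
    letters : ∀ i → lookup g i ≡ lookup g' i × lookup f (lookup β i) ≡ lookup f' (lookup β' i)
    letters i = twist-injective ε δ k _ _ _ _
      (trans (sym (Vec.lookup∘tabulate _ i)) (trans (cong (λ v → lookup v i) e) (Vec.lookup∘tabulate _ i)))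
    β-inj = perms⇒Inj F.β∈
    β'-inj = perms⇒Inj F'.β∈
    transfer : ∀ {γ γ' : Fin n → Fin n} {u u' : Fin n → Fin k} → Inj γ → Inj γ' → (∀ i → u i ≡ u' i) →
      (∀ i j → γ i Fin.< γ j → Lex δ ℕ._<_ (toℕ (u i) , toℕ (lookup τ i)) (toℕ (u j) , toℕ (lookup τ j))) →
      (∀ i j → γ' i Fin.< γ' j → Lex δ ℕ._<_ (toℕ (u' i) , toℕ (lookup τ i)) (toℕ (u' j) , toℕ (lookup τ j))) →
      ∀ i j → γ i Fin.< γ j → γ' i Fin.< γ' j
    transfer {γ} {γ'} inj inj' u≡ r r' i j p with Fin.<-cmp (γ' i) (γ' j)
    ... | tri< q _ _ = q
    ... | tri≈ _ q _ with refl ← inj' q = contradiction p (ℕ.<-irrefl refl)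
    ... | tri> _ _ q = contradiction (r' j i q) (Lex-asym δ ℕ.<-asym
          (subst₂ (λ x y → Lex δ ℕ._<_ (toℕ x , toℕ (lookup τ i)) (toℕ y , toℕ (lookup τ j))) (u≡ i) (u≡ j) (r i j p)))
    β≡ : ∀ i → lookup β i ≡ lookup β' i
    β≡ = order-determines (lookup β) (lookup β') β-inj β'-inj
      (transfer β-inj β'-inj (proj₂ ∘ letters) F.β-reflects F'.β-reflects)
      (transfer β'-inj β-inj (sym ∘ proj₂ ∘ letters) F'.β-reflects F.β-reflects)
    f≡ : ∀ j → lookup f j ≡ lookup f' j
    f≡ j with i , refl ← surjective β-inj j = trans (proj₂ (letters i)) (cong (lookup f') (sym (β≡ i)))
    α≡ : ∀ j → lookup α j ≡ lookup α' j
    α≡ j with i , refl ← surjective β-inj j = trans (F.αβ i) (trans (sym (F'.αβ i)) (cong (lookup α') (sym (β≡ i))))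

  private
    key : (Fin n → Fin k) → Fin n → ℕ × ℕ
    key u i = toℕ (u i) , toℕ (lookup τ i)

    τ-inj : Inj (lookup τ)
    τ-inj = perms⇒Inj τ∈

  sort-positions : ∀ u → Sorting (λ i j → Lex δ ℕ._<_ (key u i) (key u j))
  sort-positions u = sorting _ (λ i j → Lex-dec δ ℕ._<?_ (key u i) (key u j)) (λ i p → Lex-asym δ ℕ.<-asym p p)
    (Lex-trans δ ℕ.<-trans)
    (λ i j i≢j → Lex-total δ (toℕ (u i)) (toℕ (u j)) (≢⇒<⊎> (λ e → i≢j (τ-inj (Fin.toℕ-injective e)))))

  -- With β the ranking by (u, τ), the choices α = τβ⁻¹ and f = uβ⁻¹ are forced. Compatibility of
  -- `f` with α is monotonicity of `unrank`. For `g` and β, the twist is undone and the inner keys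
  -- are replaced by their ranks, which compare in the same way.
  unmerge : ∀ (c : Fin n → Fin l) (u : Fin n → Fin k) → Sorting (λ i j → Lex δ ℕ._<_ (key u i) (key u j)) →
    CompatF η (λ i → twist ε δ k (c i) (u i)) (lookup τ) →
    ∃ λ q → Factorisation q × (∀ i → lookup (merge q) i ≡ twist ε δ k (c i) (u i))
  unmerge c u S h~τ = ((α , β) , (f , g)) , fact (Inj⇒perms α α-inj) (Inj⇒perms β β-inj) αβ f~α g~β ,
    λ i → trans (Vec.lookup∘tabulate _ i) (cong₂ (twist ε δ k) (Vec.lookup∘tabulate c i) (fβ i))
    where
    open Sorting S
    α β : Word n
    α = tabulate (λ j → lookup τ (unrank j))
    β = tabulate rank
    f = tabulate (λ j → u (unrank j))
    g = tabulate c
    β-inj : Inj (lookup β)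
    β-inj {i} {j} e = trans (sym (unrank-rank i)) (trans (cong unrank
      (trans (sym (Vec.lookup∘tabulate rank i)) (trans e (Vec.lookup∘tabulate rank j)))) (unrank-rank j))
    α-inj : Inj (lookup α)
    α-inj {i} {j} e = trans (sym (rank-unrank i)) (trans (cong rank (τ-inj
      (trans (sym (Vec.lookup∘tabulate _ i)) (trans e (Vec.lookup∘tabulate _ j))))) (rank-unrank j))
    αβ : ∀ i → lookup α (lookup β i) ≡ lookup τ i
    αβ i = trans (Vec.lookup∘tabulate _ (lookup β i)) (cong (lookup τ) (trans (cong unrank (Vec.lookup∘tabulate rank i)) (unrank-rank i)))
    fβ : ∀ i → lookup f (lookup β i) ≡ u i
    fβ i = trans (Vec.lookup∘tabulate _ (lookup β i)) (cong u (trans (cong unrank (Vec.lookup∘tabulate rank i)) (unrank-rank i)))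
    f~α : CompatF δ (lookup f) (lookup α)
    f~α = CompatF-cong δ {f = λ j → u (unrank j)} {α = λ j → lookup τ (unrank j)}
      (λ i → sym (Vec.lookup∘tabulate _ i)) (λ i → sym (Vec.lookup∘tabulate _ i)) unrank-mono
    g~β : CompatF ε (lookup g) (lookup β)
    g~β = CompatF-cong ε {f = c} {α = rank} (λ i → sym (Vec.lookup∘tabulate _ i)) (λ i → sym (Vec.lookup∘tabulate _ i))
      (λ i j p → Lex-map ε {a = key u i} {b = key u j} (rank-mono i j) (rank-mono j i)
        (Lex-twist ε δ k (c i) (c j) (u i) (u j)
          (λ e → ℕ.<-irrefl (cong toℕ (τ-inj (Fin.toℕ-injective e))) p) (h~τ i j p)))

  merge-surjective : ∀ {h} → T (validη h) → ∃ λ q → Factorisation q × merge q ≡ h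
  merge-surjective {h} t =
    let q , F , e = unmerge c u (sort-positions u)
                      (CompatF-cong η (λ i → sym (ca i)) (λ _ → refl) (valid⇒CompatF η h τ∈ t))
    in q , F , vec-ext (merge q) h (λ i → trans (e i) (ca i))
    where
    c = λ i → proj₁ (twist-surjective ε δ k {l} (lookup h i))
    u = λ i → proj₁ (proj₂ (twist-surjective ε δ k {l} (lookup h i)))
    ca : ∀ i → twist ε δ k (c i) (u i) ≡ lookup h i
    ca i = proj₂ (proj₂ (twist-surjective ε δ k {l} (lookup h i)))

  factors-count : length (filterᵇ factors quads) ≡ length (filterᵇ validη (words (l ℕ.* k) n))
  factors-count = bijection-length merge _ _
    (Unique.filter⁺ (T? ∘ factors) (Unique.cartesianProduct⁺
      (Unique.cartesianProduct⁺ (perms-unique n) (perms-unique n))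
      (Unique.cartesianProduct⁺ (words-unique k n) (words-unique l n))))
    (Unique.filter⁺ (T? ∘ validη) (words-unique (l ℕ.* k) n))
    (λ m → ∈-filter⁺ (T? ∘ validη) (∈-words _) (merge-valid (factorisation m)))
    (λ m m' → merge-injective (factorisation m) (factorisation m'))
    (λ m → let q , F , e = merge-surjective (proj₂ (∈-filter⁻ (T? ∘ validη) {xs = words (l ℕ.* k) n} m))
           in q , ∈-factors F , e)

⊛-V : ∀ {n} δ ε k l → (Vδ δ n k ⊛ Vδ ε n l) ≈ Vδ (productSign ε δ k ε) n (l ℕ.* k)
⊛-V {n} δ ε k l τ τ∈ = begin
  (Vδ δ n k ⊛ Vδ ε n l) τ
    ≡⟨ ⊛-∑ (Vδ δ n k) (Vδ ε n l) τ ⟩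
  ∑ (perms n) (λ α → ∑ (perms n) (λ β → ind (compose α β ==W τ) * (Vδ δ n k α * Vδ ε n l β)))
    ≡⟨ ∑-cong (perms n) (λ α _ → ∑-cong (perms n) (λ β _ → expand α β)) ⟩
  ∑ (perms n) (λ α → ∑ (perms n) (λ β → ∑ (cartesianProduct (words k n) (words l n)) (λ fg → ind (factors ((α , β) , fg)))))
    ≡⟨ ∑-× (perms n) (perms n) _ ⟨
  ∑ (cartesianProduct (perms n) (perms n)) (λ αβ → ∑ (cartesianProduct (words k n) (words l n)) (λ fg → ind (factors (αβ , fg))))
    ≡⟨ ∑-× (cartesianProduct (perms n) (perms n)) _ (ind ∘ factors) ⟨
  ∑ quads (ind ∘ factors)
    ≡⟨ nat-length-filterᵇ factors quads ⟨
  nat (length (filterᵇ factors quads))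
    ≡⟨ cong nat factors-count ⟩
  nat (length (filterᵇ validη (words (l ℕ.* k) n)))
    ≡⟨ nat-length-filterᵇ validη (words (l ℕ.* k) n) ⟩
  count η (l ℕ.* k) 0 (vals τ)
    ≡⟨ Vδ-count η n (l ℕ.* k) τ ⟨
  Vδ η n (l ℕ.* k) τ ∎
  where
  open Product δ ε k l τ τ∈
  expand : ∀ α β → ind (compose α β ==W τ) * (Vδ δ n k α * Vδ ε n l β)
    ≡ ∑ (cartesianProduct (words k n) (words l n)) (λ fg → ind (factors ((α , β) , fg)))
  expand α β = begin
    i * (Vδ δ n k α * Vδ ε n l β)
      ≡⟨ cong₂ (λ x y → i * (x * y)) (Vδ-count δ n k α) (Vδ-count ε n l β) ⟩
    i * (∑ (words k n) φα * ∑ (words l n) φβ)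
      ≡⟨ cong (i *_) (∑*∑ (words k n) (words l n) φα φβ) ⟩
    i * ∑ (words k n) (λ f → ∑ (words l n) (λ g → φα f * φβ g))
      ≡⟨ cong (i *_) (∑-× (words k n) (words l n) (λ fg → φα (proj₁ fg) * φβ (proj₂ fg))) ⟨
    i * ∑ (cartesianProduct (words k n) (words l n)) (λ fg → φα (proj₁ fg) * φβ (proj₂ fg))
      ≡⟨ ∑-*ˡ (cartesianProduct (words k n) (words l n)) i _ ⟨
    ∑ (cartesianProduct (words k n) (words l n)) (λ fg → i * (φα (proj₁ fg) * φβ (proj₂ fg)))
      ≡⟨ ∑-cong (cartesianProduct (words k n) (words l n)) (λ { (f , g) _ →
           trans (cong (i *_) (sym (ind-∧ (valid δ 0 f (vals α)) (valid ε 0 g (vals β)))))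
             (sym (ind-∧ (compose α β ==W τ) _)) }) ⟩
    ∑ (cartesianProduct (words k n) (words l n)) (λ fg → ind (factors ((α , β) , fg))) ∎
    where
    i = ind (compose α β ==W τ)
    φα = λ f → ind (valid δ 0 f (vals α))
    φβ = λ g → ind (valid ε 0 g (vals β))

-- Statistics in terms of the ascent pattern

private
  not<ᵇ : ∀ {x y} → x ≢ y → (x <ᵇ y) ≡ not (y <ᵇ x)
  not<ᵇ {x} {y} x≢y with x <ᵇ y in e | y <ᵇ x in f
  ... | true  | false = refl
  ... | false | true  = refl
  ... | true  | true  = contradiction (ℕ.<ᵇ⇒< y x (subst T (sym f) _)) (ℕ.<-asym (ℕ.<ᵇ⇒< x y (subst T (sym e) _)))
  ... | false | false = contradiction
    (ℕ.≤-antisym (ℕ.≮⇒≥ (λ p → subst T f (ℕ.<⇒<ᵇ p))) (ℕ.≮⇒≥ (λ p → subst T e (ℕ.<⇒<ᵇ p)))) x≢y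

turns-changes : ∀ {m} x y (r : Vec ℕ m) → Distinct (x ∷ y ∷ r) →
  turns (x ∷ y ∷ toList r) ≡ changes (not (y <ᵇ x)) (bits (y ∷ toList r))
turns-changes x y [] d = refl
turns-changes x y (z ∷ r) d = cong₂ ℕ._+_ here-turn (turns-changes y z r (λ e → Fin.suc-injective (d e)))
  where
  x≢y : x ≢ y
  x≢y e = contradiction (d {zero} {suc zero} e) λ ()
  y≢z : y ≢ z
  y≢z e = contradiction (d {suc zero} {suc (suc zero)} e) λ ()
  here-turn : (if ((x <ᵇ y) ∧ (z <ᵇ y)) ∨ ((y <ᵇ x) ∧ (y <ᵇ z)) then 1 else 0)
            ≡ (if agree (not (y <ᵇ x)) (not (z <ᵇ y)) then 0 else 1)
  here-turn rewrite not<ᵇ x≢y | not<ᵇ y≢z with y <ᵇ x | z <ᵇ y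
  ... | true  | true  = refl
  ... | true  | false = refl
  ... | false | true  = refl
  ... | false | false = refl

peaks-peaksᵇ : ∀ {m} x y (r : Vec ℕ m) → Distinct (x ∷ y ∷ r) →
  peaks (x ∷ y ∷ toList r) ≡ peaksᵇ (not (y <ᵇ x)) (bits (y ∷ toList r))
peaks-peaksᵇ x y [] d = refl
peaks-peaksᵇ x y (z ∷ r) d = cong₂ ℕ._+_ here-peak (peaks-peaksᵇ y z r (λ e → Fin.suc-injective (d e)))
  where
  x≢y : x ≢ y
  x≢y e = contradiction (d {zero} {suc zero} e) λ ()
  here-peak : (if (x <ᵇ y) ∧ (z <ᵇ y) then 1 else 0) ≡ (if not (y <ᵇ x) ∧ not (not (z <ᵇ y)) then 1 else 0)
  here-peak rewrite not<ᵇ x≢y with y <ᵇ x | z <ᵇ y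
  ... | true  | true  = refl
  ... | true  | false = refl
  ... | false | true  = refl
  ... | false | false = refl

-- `b` is the first step and `bs` the later ones. The value σ(0) = 0 acts as a preceding ascent,
-- hence `true` in `run°≡` and `pk°≡`. A preceding descent creates no peak, so `false` can be put in
-- front for `pk≡`.
record Shape {n : ℕ} (σ : Word n) : Set where
  field
    b        : Bool
    bs       : List Bool
    length≡  : suc (length (b ∷ bs)) ≡ n
    run≡     : run σ ≡ suc (changes b bs)
    first≡   : firstAsc (seqOf σ) ≡ b
    run°≡    : run° σ ≡ suc (changes true (b ∷ bs))
    pk≡      : pk σ ≡ ⌊ changes false (b ∷ bs) /2⌋
    pk°≡     : pk° σ ≡ ⌈ changes true (b ∷ bs) /2⌉
    V≡       : ∀ δ k → Vδ δ n k σ ≡ nat (H δ k (b ∷ bs))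

  t : ℕ
  t = changes b bs

  -- The statistic T that governs V^δ at σ: equal to `t` if the first step has direction `δ`, and to
  -- t + 1 otherwise.
  ch : Bool → ℕ
  ch δ = changes δ (b ∷ bs)

bits-length : ∀ x w → length (bits (x ∷ w)) ≡ length w
bits-length x []      = refl
bits-length x (y ∷ w) = cong suc (bits-length y w)

shape : ∀ {n} → 2 ℕ.≤ n → (σ : Word n) → σ ∈ perms n → Shape σ
shape (s≤s ()) (_ ∷ []) _
shape {suc (suc m)} _ σ@(c ∷ d ∷ r) σ∈ = record
  { b = not (y <ᵇ x) ; bs = bits (y ∷ toList w)
  ; length≡ = cong (λ z → suc (suc z)) (trans (bits-length y (toList w)) (Vec.length-toList w))
  ; run≡ = cong suc (turns-changes x y w dist)
  ; first≡ = not<ᵇ x≢y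
  ; run°≡ = cong suc (turns-changes 0 x (y ∷ w) dist0)
  ; pk≡ = trans (peaks-peaksᵇ x y w dist) (peaks-false (not (y <ᵇ x) ∷ bits (y ∷ toList w)))
  ; pk°≡ = trans (peaks-peaksᵇ 0 x (y ∷ w) dist0) (peaks-true (not (y <ᵇ x) ∷ bits (y ∷ toList w)))
  ; V≡ = λ δ k → Vδ-Φ δ (suc (suc m)) k σ }
  where
  x = suc (toℕ c)
  y = suc (toℕ d)
  w = Vec.map (λ z → suc (toℕ z)) r
  dist : Distinct (x ∷ y ∷ w)
  dist = vals-Distinct σ∈
  x≢y : x ≢ y
  x≢y e = contradiction (dist {zero} {suc zero} e) λ ()
  pos : ∀ i → lookup (x ∷ y ∷ w) i ≢ 0
  pos i e = contradiction (trans (sym (lookup-vals σ i)) e) λ ()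
  dist0 : Distinct (0 ∷ x ∷ y ∷ w)
  dist0 {zero}  {zero}  e = refl
  dist0 {zero}  {suc j} e = contradiction (sym e) (pos j)
  dist0 {suc i} {zero}  e = contradiction e (pos i)
  dist0 {suc i} {suc j} e = cong suc (dist e)

-- Lexicographic, with true before false: V^±_k is triangular for this order on (run , asc).
code : ℕ → Bool → ℕ
code zero    true  = 0
code zero    false = 1
code (suc r) x     = suc (suc (code r x))

code-injective : ∀ r r' x x' → code r x ≡ code r' x' → r ≡ r' × x ≡ x'
code-injective zero zero true  true  e = refl , refl
code-injective zero zero false false e = refl , refl
code-injective zero (suc r') true  x' ()
code-injective zero (suc r') false x' ()
code-injective (suc r) zero x true  ()
code-injective (suc r) zero x false ()
code-injective (suc r) (suc r') x x' e with p , q ← code-injective r r' x x' (ℕ.suc-injective (ℕ.suc-injective e)) = cong suc p , q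

code-< : ∀ r r' x x' → code r x ℕ.< code r' x' → r ℕ.< r' ⊎ (r ≡ r' × x ≡ true × x' ≡ false)
code-< zero zero true  false p = inj₂ (refl , refl , refl)
code-< zero zero false true  ()
code-< zero zero true  true  ()
code-< zero zero false false (s≤s ())
code-< zero (suc r') x x' p = inj₁ (s≤s z≤n)
code-< (suc r) zero x true  ()
code-< (suc r) zero x false (s≤s ())
code-< (suc r) (suc r') x x' (s≤s (s≤s p)) with code-< r r' x x' p
... | inj₁ q = inj₁ (s≤s q)
... | inj₂ (q , s) = inj₂ (cong suc q , s)

even : ℕ → Bool
even r = r % 2 ≡ᵇ 0

private
  ⌊k*2/2⌋ : ∀ j → ⌊ j ℕ.* 2 /2⌋ ≡ j
  ⌊k*2/2⌋ zero    = refl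
  ⌊k*2/2⌋ (suc j) = cong suc (⌊k*2/2⌋ j)

  ⌊1+k*2/2⌋ : ∀ j → ⌊ suc (j ℕ.* 2) /2⌋ ≡ j
  ⌊1+k*2/2⌋ zero    = refl
  ⌊1+k*2/2⌋ (suc j) = cong suc (⌊1+k*2/2⌋ j)

  2⌊/2⌋≤ : ∀ c → 2 ℕ.* ⌊ c /2⌋ ℕ.≤ c
  2⌊/2⌋≤ zero          = z≤n
  2⌊/2⌋≤ (suc zero)    = z≤n
  2⌊/2⌋≤ (suc (suc c)) rewrite ℕ.+-suc ⌊ c /2⌋ (⌊ c /2⌋ ℕ.+ 0) = s≤s (s≤s (2⌊/2⌋≤ c))

  <2⌊/2⌋+2 : ∀ c → c ℕ.< 2 ℕ.* suc ⌊ c /2⌋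
  <2⌊/2⌋+2 zero          = s≤s z≤n
  <2⌊/2⌋+2 (suc zero)    = s≤s (s≤s z≤n)
  <2⌊/2⌋+2 (suc (suc c)) rewrite ℕ.+-suc (suc ⌊ c /2⌋) (suc (⌊ c /2⌋ ℕ.+ 0)) = s≤s (s≤s (<2⌊/2⌋+2 c))

  ≤2⌈/2⌉ : ∀ c → c ℕ.≤ 2 ℕ.* ⌈ c /2⌉
  ≤2⌈/2⌉ zero    = z≤n
  ≤2⌈/2⌉ (suc zero) = s≤s z≤n
  ≤2⌈/2⌉ (suc (suc c)) rewrite ℕ.+-suc ⌈ c /2⌉ (⌈ c /2⌉ ℕ.+ 0) = s≤s (s≤s (≤2⌈/2⌉ c))

parity : ∀ r → (even r ≡ true × ∃ λ j → r ≡ 2 ℕ.* j) ⊎ (even r ≡ false × (r % 2 ≡ᵇ 1) ≡ true × ∃ λ j → r ≡ 2 ℕ.* j ℕ.+ 1)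
parity r with r % 2 | m≡m%n+[m/n]*n r 2 | m%n<n r 2
... | 0           | e | _ = inj₁ (refl , r / 2 , trans e (ℕ.*-comm (r / 2) 2))
... | 1           | e | _ = inj₂ (refl , refl , r / 2 , trans e (trans (ℕ.+-comm 1 _) (cong (ℕ._+ 1) (ℕ.*-comm (r / 2) 2))))
... | suc (suc _) | _ | s≤s (s≤s ())

-- The six spans

gens-map : ∀ {n} {P : A n → Set} (f : ℕ → A n) ks → (∀ k → k ∈ ks → P (f k)) → ∀ g → g ∈ List.map f ks → P g
gens-map f ks h g m with k , k∈ , refl ← ∈-map⁻ f m = h k k∈

gens-concatMap : ∀ {n} {P : A n → Set} (f : ℕ → List (A n)) ks → (∀ k → k ∈ ks → ∀ g → g ∈ f k → P g) →
  ∀ g → g ∈ concatMap f ks → P g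
gens-concatMap f (k ∷ ks) h g m with ∈-++⁻ (f k) m
... | inj₁ i = h k (here refl) g i
... | inj₂ i = gens-concatMap f ks (λ k j → h k (there j)) g i

∈-concatMap : ∀ {n} (f : ℕ → List (A n)) {ks k g} → k ∈ ks → g ∈ f k → g ∈ concatMap f ks
∈-concatMap f (here refl) i = ∈-++⁺ˡ i
∈-concatMap f {k ∷ ks} (there m) i = ∈-++⁺ʳ (f k) (∈-concatMap f m i)

∈-fromTo⁺ : ∀ {t b} → t ℕ.< b → suc t ∈ fromTo 1 b
∈-fromTo⁺ p = ∈-map⁺ suc (∈-upTo⁺ p)

∈-fromTo⁻ : ∀ {k b} → k ∈ fromTo 1 b → ∃ λ t → k ≡ suc t × t ℕ.< b
∈-fromTo⁻ m with t , t∈ , e ← ∈-map⁻ suc m = t , e , ∈-upTo⁻ t∈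

-- One description per space: `S` is its statistic, `G` the infinite family, `vs` the finite list of
-- V's and `ws` the spanning list that defines the space. `Gen` gives the form of the generators
-- with unrestricted index, so that products can be computed regardless of the finite range.
record Described {n : ℕ} (S : Word n → ℕ) (Gen : A n → Set) (G : ℕ → List (A n)) (vs ws : List (A n)) : Set where
  field
    bound   : ℕ
    gen     : ∀ g → Gen g → Inv S g
    all-gen : ∀ k g → g ∈ G k → Gen g
    fin-gen : ∀ g → g ∈ vs → Gen g
    fin-all : ∀ g → g ∈ vs → g ∈ concatMap G (upTo bound)
    fin-tri : Triangular S vs
    w-inv   : ∀ g → g ∈ ws → Inv S g
    w-tri   : Triangular S ws

  fin≐Inv : span vs ≐ Inv S
  fin≐Inv = span≐Inv S vs (λ g m → gen g (fin-gen g m)) fin-tri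

  w≐Inv : span ws ≐ Inv S
  w≐Inv = span≐Inv S ws w-inv w-tri

  all≐fin : spanFam G ≐ span vs
  all≐fin = spanFam≐span S G vs (λ k g m → gen g (all-gen k g m)) fin≐Inv bound fin-all

  fin≐w : span vs ≐ span ws
  fin≐w = ≐-trans fin≐Inv (≐-sym w≐Inv)

  closed : (∀ g h → Gen g → Gen h → Inv S (g ⊛ h)) → ClosedUnder⊛ (span ws)
  closed p x y sx sy = proj₂ w≐Inv _ (span-closed vs (Inv-isSubspace S)
    (λ g h i j → p g h (fin-gen g i) (fin-gen h j)) x y (proj₂ fin≐w x sx) (proj₂ fin≐w y sy))

-- Two descriptions are taken so that commutativity and centrality are both instances.
commute : ∀ {n} {S S' : Word n → ℕ} {Gen Gen' G G' vs vs' ws ws'} → Described S Gen G vs ws → Described S' Gen' G' vs' ws' →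
  (∀ g h → Gen g → Gen' h → (g ⊛ h) ≈ (h ⊛ g)) → ∀ x y → span ws x → span ws' y → (x ⊛ y) ≈ (y ⊛ x)
commute {vs = vs} {vs'} D D' p x y sx sy = span-commute vs vs'
  (λ g h i j → p g h (Described.fin-gen D g i) (Described.fin-gen D' h j)) x y
  (proj₂ (Described.fin≐w D) x sx) (proj₂ (Described.fin≐w D') y sy)

module _ {n : ℕ} (2≤n : 2 ℕ.≤ n) where

  private
    shapeOf : ∀ {σ : Word n} → σ ∈ perms n → Shape σ
    shapeOf {σ} m = shape 2≤n σ m

  V-zero : ∀ δ k {σ} (m : σ ∈ perms n) → k ℕ.≤ Shape.ch (shapeOf m) δ → Vδ δ n k σ ≡ 0ℚ
  V-zero δ k m p = trans (Shape.V≡ (shapeOf m) δ k) (cong nat (H-zero δ k _ p))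

  V-nonzero : ∀ δ k {σ} (m : σ ∈ perms n) → Shape.ch (shapeOf m) δ ℕ.< k → Vδ δ n k σ ≢ 0ℚ
  V-nonzero δ k m p e = nat≢0 (H-pos δ k _ p) (trans (sym (Shape.V≡ (shapeOf m) δ k)) e)

  private
    lengths : ∀ {σ σ'} (m : σ ∈ perms n) (m' : σ' ∈ perms n) →
      length (Shape.b (shapeOf m) ∷ Shape.bs (shapeOf m)) ≡ length (Shape.b (shapeOf m') ∷ Shape.bs (shapeOf m'))
    lengths m m' = ℕ.suc-injective (trans (Shape.length≡ (shapeOf m)) (sym (Shape.length≡ (shapeOf m'))))

  V-changes : ∀ δ δ' k {σ σ'} (m : σ ∈ perms n) (m' : σ' ∈ perms n) → Shape.ch (shapeOf m) δ ≡ Shape.ch (shapeOf m') δ' →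
    Vδ δ n k σ ≡ Vδ δ' n k σ'
  V-changes δ δ' k m m' e = trans (Shape.V≡ (shapeOf m) δ k)
    (trans (cong nat (H-changes δ δ' k _ _ (lengths m m') e)) (sym (Shape.V≡ (shapeOf m') δ' k)))

  V-even : ∀ δ δ' j {σ σ'} (m : σ ∈ perms n) (m' : σ' ∈ perms n) → ⌊ Shape.ch (shapeOf m) δ /2⌋ ≡ ⌊ Shape.ch (shapeOf m') δ' /2⌋ →
    Vδ δ n (2 ℕ.* j) σ ≡ Vδ δ' n (2 ℕ.* j) σ'
  V-even δ δ' j m m' e = trans (Shape.V≡ (shapeOf m) δ (2 ℕ.* j))
    (trans (cong nat (H-even δ δ' j _ _ (lengths m m') e)) (sym (Shape.V≡ (shapeOf m') δ' (2 ℕ.* j))))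

  V-odd : ∀ δ δ' j {σ σ'} (m : σ ∈ perms n) (m' : σ' ∈ perms n) → ⌈ Shape.ch (shapeOf m) δ /2⌉ ≡ ⌈ Shape.ch (shapeOf m') δ' /2⌉ →
    Vδ δ n (2 ℕ.* j ℕ.+ 1) σ ≡ Vδ δ' n (2 ℕ.* j ℕ.+ 1) σ'
  V-odd δ δ' j m m' e = trans (Shape.V≡ (shapeOf m) δ (2 ℕ.* j ℕ.+ 1))
    (trans (cong nat (H-odd δ δ' j _ _ (lengths m m') e)) (sym (Shape.V≡ (shapeOf m') δ' (2 ℕ.* j ℕ.+ 1))))

  ch<n : ∀ δ {σ} (m : σ ∈ perms n) → Shape.ch (shapeOf m) δ ℕ.< n
  ch<n δ m = subst (Shape.ch (shapeOf m) δ ℕ.<_) (Shape.length≡ (shapeOf m)) (s≤s (changes≤length δ (Shape.b (shapeOf m) ∷ Shape.bs (shapeOf m))))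

  t<n∸1 : ∀ {σ} (m : σ ∈ perms n) → Shape.t (shapeOf m) ℕ.< n ∸ 1
  t<n∸1 m = subst (Shape.t (shapeOf m) ℕ.<_) (cong ℕ.pred (Shape.length≡ (shapeOf m))) (s≤s (changes≤length (Shape.b (shapeOf m)) (Shape.bs (shapeOf m))))

  run-t : ∀ {σ σ'} (m : σ ∈ perms n) (m' : σ' ∈ perms n) → run σ ≡ run σ' → Shape.t (shapeOf m) ≡ Shape.t (shapeOf m')
  run-t m m' e = ℕ.suc-injective (trans (sym (Shape.run≡ (shapeOf m))) (trans e (Shape.run≡ (shapeOf m'))))

  run-t< : ∀ {σ σ'} (m : σ ∈ perms n) (m' : σ' ∈ perms n) → run σ ℕ.< run σ' → Shape.t (shapeOf m) ℕ.< Shape.t (shapeOf m')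
  run-t< m m' p = ℕ.≤-pred (subst₂ ℕ._<_ (Shape.run≡ (shapeOf m)) (Shape.run≡ (shapeOf m')) p)

  asc : Word n → Bool
  asc σ = firstAsc (seqOf σ)

  private
    asc-b : ∀ {σ σ'} (m : σ ∈ perms n) (m' : σ' ∈ perms n) → asc σ ≡ asc σ' → Shape.b (shapeOf m) ≡ Shape.b (shapeOf m')
    asc-b m m' e = trans (sym (Shape.first≡ (shapeOf m))) (trans e (Shape.first≡ (shapeOf m')))

    t≤ch : ∀ δ {σ} (m : σ ∈ perms n) → Shape.t (shapeOf m) ℕ.≤ Shape.ch (shapeOf m) δ
    t≤ch δ m = ℕ.m≤n+m _ _

    agree-refl : ∀ b → agree b b ≡ true
    agree-refl true  = refl
    agree-refl false = refl

    ch-b : ∀ {σ} (m : σ ∈ perms n) → Shape.ch (shapeOf m) (Shape.b (shapeOf m)) ≡ Shape.t (shapeOf m)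
    ch-b m rewrite agree-refl (Shape.b (shapeOf m)) = refl

    ch-not : ∀ δ {σ} (m : σ ∈ perms n) → Shape.b (shapeOf m) ≡ not δ → Shape.ch (shapeOf m) δ ≡ suc (Shape.t (shapeOf m))
    ch-not true  m e rewrite e = refl
    ch-not false m e rewrite e = refl

  -- An indicator that holds at `σ₀` and only within its class is a pivot there: it is 1 at `σ₀` and
  -- 0 wherever `S` takes another value.
  ind-Triangular : (S : Word n → ℕ) (gs : List (A n)) →
    (∀ σ₀ → σ₀ ∈ perms n → ∃ λ (p : Word n → Bool) → (λ σ → ind (p σ)) ∈ gs × p σ₀ ≡ true ×
      (∀ σ → σ ∈ perms n → p σ ≡ true → S σ ≡ S σ₀)) → Triangular S gs
  ind-Triangular S gs h σ₀ m₀ with p , i , e , q ← h σ₀ m₀ =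
    (λ σ → ind (p σ)) , i , (λ z → contradiction (trans (sym (cong ind e)) z) λ ()) , zero-above
    where
    zero-above : ∀ σ → σ ∈ perms n → S σ₀ ℕ.< S σ → ind (p σ) ≡ 0ℚ
    zero-above σ m lt with p σ in eq
    ... | false = refl
    ... | true  = contradiction lt (ℕ.<-irrefl (sym (q σ m eq)))

  private
    ≡ᵇ-refl : ∀ k → (k ≡ᵇ k) ≡ true
    ≡ᵇ-refl k = Equivalence.to T-≡ (ℕ.≡⇒≡ᵇ k k refl)

    ≡ᵇ-sound : ∀ a b → (a ≡ᵇ b) ≡ true → a ≡ b
    ≡ᵇ-sound a b e = ℕ.≡ᵇ⇒≡ a b (subst T (sym e) _)

    ∧-true : ∀ a b → a ∧ b ≡ true → a ≡ true × b ≡ true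
    ∧-true true true _ = refl , refl

    not-true : ∀ a → not a ≡ true → a ≡ false
    not-true false _ = refl

  Wδ : Bool → ℕ → A n
  Wδ true  = W⁺ n
  Wδ false = W⁻ n

  isW : Bool → ℕ → Word n → Bool
  isW true  k σ = (run σ ≡ᵇ k) ∧ asc σ
  isW false k σ = (run σ ≡ᵇ k) ∧ not (asc σ)

  isW-sound : ∀ δ k σ → isW δ k σ ≡ true → run σ ≡ k × asc σ ≡ δ
  isW-sound true  k σ e with p , q ← ∧-true (run σ ≡ᵇ k) _ e = ≡ᵇ-sound (run σ) k p , q
  isW-sound false k σ e with p , q ← ∧-true (run σ ≡ᵇ k) _ e = ≡ᵇ-sound (run σ) k p , not-true (asc σ) q

  isW-complete : ∀ σ → isW (asc σ) (run σ) σ ≡ true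
  isW-complete σ with asc σ in e
  ... | true  rewrite e | ≡ᵇ-refl (run σ) = refl
  ... | false rewrite e | ≡ᵇ-refl (run σ) = refl

  isW-cong : ∀ δ k σ σ' → run σ ≡ run σ' → asc σ ≡ asc σ' → isW δ k σ ≡ isW δ k σ'
  isW-cong true  k σ σ' e f = cong₂ (λ r a → (r ≡ᵇ k) ∧ a) e f
  isW-cong false k σ σ' e f = cong₂ (λ r a → (r ≡ᵇ k) ∧ not a) e f

  Wδ-isW : ∀ δ k → (λ σ → ind (isW δ k σ)) ≡ Wδ δ k
  Wδ-isW true  k = refl
  Wδ-isW false k = refl

  pair-∈ : {X : Set} (f : Bool → X) (xs : List X) → ∀ δ → f δ ∈ f true ∷ f false ∷ xs
  pair-∈ f xs true  = here refl
  pair-∈ f xs false = there (here refl)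

  S± : Word n → ℕ
  S± σ = code (run σ) (asc σ)

  data Gen± : A n → Set where
    gen : ∀ δ k → Gen± (Vδ δ n k)

  Gen±-Inv : ∀ g → Gen± g → Inv S± g
  Gen±-Inv _ (gen δ k) σ σ' m m' e with p , q ← code-injective (run σ) (run σ') _ _ e =
    V-changes δ δ k m m' (cong₂ (λ b t → (if agree δ b then 0 else 1) ℕ.+ t) (asc-b m m' q) (run-t m m' p))

  -- The pivot takes the direction `b` of the first step, for which `ch b` is `t`, and the least
  -- index t + 1 at which it does not vanish. It vanishes at larger `run`, where every `ch` exceeds
  -- `t`, and at equal `run` with the other first direction, where `ch b` is t + 1.
  V±-tri : Triangular S± (concatMap (λ k → V⁺ n k ∷ V⁻ n k ∷ []) (fromTo 1 (n ∸ 1)))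
  V±-tri σ₀ m₀ = Vδ b n (suc t) , ∈-concatMap _ (∈-fromTo⁺ (t<n∸1 m₀)) (pair-∈ (λ δ → Vδ δ n (suc t)) [] b) ,
    V-nonzero b (suc t) m₀ (ℕ.≤-reflexive (cong suc (ch-b m₀))) , λ σ m lt → V-zero b (suc t) m (above σ m lt)
    where
    open Shape (shapeOf m₀)
    above : ∀ σ (m : σ ∈ perms n) → S± σ₀ ℕ.< S± σ → suc t ℕ.≤ Shape.ch (shapeOf m) b
    above σ m lt with code-< (run σ₀) (run σ) _ _ lt
    ... | inj₁ p = ℕ.≤-trans (run-t< m₀ m p) (t≤ch b m)
    ... | inj₂ (p , q , q') = ℕ.≤-reflexive (sym (trans (ch-not b m
            (trans (sym (Shape.first≡ (shapeOf m))) (trans q' (cong not (sym (trans (sym first≡) q)))))) (cong suc (sym (run-t m₀ m p)))))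

  W±-inv : ∀ δ k → Inv S± (Wδ δ k)
  W±-inv δ k σ σ' m m' e with p , q ← code-injective (run σ) (run σ') _ _ e =
    subst (λ w → w σ ≡ w σ') (Wδ-isW δ k) (cong ind (isW-cong δ k σ σ' p q))

  W±-tri : Triangular S± (concatMap (λ k → W⁺ n k ∷ W⁻ n k ∷ []) (fromTo 1 (n ∸ 1)))
  W±-tri = ind-Triangular S± _ λ σ₀ m₀ → isW (asc σ₀) (run σ₀) ,
    subst (_∈ concatMap (λ k → W⁺ n k ∷ W⁻ n k ∷ []) (fromTo 1 (n ∸ 1))) (sym (Wδ-isW (asc σ₀) (run σ₀)))
      (∈-concatMap _ (subst (_∈ fromTo 1 (n ∸ 1)) (sym (Shape.run≡ (shapeOf m₀))) (∈-fromTo⁺ (t<n∸1 m₀)))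
        (pair-∈ (λ δ → Wδ δ (run σ₀)) [] (asc σ₀))) ,
    isW-complete σ₀ , λ σ m e → let p , q = isW-sound (asc σ₀) (run σ₀) σ e in cong₂ code p q

  private
    V±-gens : ∀ k g → g ∈ (V⁺ n k ∷ V⁻ n k ∷ []) → Gen± g
    V±-gens k g (here refl)         = gen true k
    V±-gens k g (there (here refl)) = gen false k

    W±-gens : ∀ k g → g ∈ (W⁺ n k ∷ W⁻ n k ∷ []) → ∃ λ δ → g ≡ Wδ δ k
    W±-gens k g (here refl)         = true , refl
    W±-gens k g (there (here refl)) = false , refl

  described± : Described S± Gen± (λ k → V⁺ n (suc k) ∷ V⁻ n (suc k) ∷ [])
    (concatMap (λ k → V⁺ n k ∷ V⁻ n k ∷ []) (fromTo 1 (n ∸ 1)))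
    (concatMap (λ k → W⁺ n k ∷ W⁻ n k ∷ []) (fromTo 1 (n ∸ 1)))
  described± = record
    { bound   = n ∸ 1
    ; gen     = Gen±-Inv
    ; all-gen = λ k → V±-gens (suc k)
    ; fin-gen = gens-concatMap _ (fromTo 1 (n ∸ 1)) (λ k _ → V±-gens k)
    ; fin-all = gens-concatMap {P = λ g → g ∈ concatMap _ (upTo (n ∸ 1))} _ (fromTo 1 (n ∸ 1)) in-all
    ; fin-tri = V±-tri
    ; w-inv   = gens-concatMap _ (fromTo 1 (n ∸ 1)) (λ k _ g i → let δ , e = W±-gens k g i in subst (Inv S±) (sym e) (W±-inv δ k))
    ; w-tri   = W±-tri }
    where
    in-all : ∀ k → k ∈ fromTo 1 (n ∸ 1) → ∀ g → g ∈ (V⁺ n k ∷ V⁻ n k ∷ []) →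
      g ∈ concatMap (λ k → V⁺ n (suc k) ∷ V⁻ n (suc k) ∷ []) (upTo (n ∸ 1))
    in-all k k∈ g i with t , refl , t< ← ∈-fromTo⁻ k∈ = ∈-concatMap _ (∈-upTo⁺ t<) i

  -- With equal `run` and equal first directions, V⁺ and V⁻ agree separately. With opposite first
  -- directions, `ch δ` on one side equals `ch (not δ)` on the other, so V⁺ and V⁻ are exchanged and
  -- their sum is unchanged.
  V-run : ∀ k → Inv run (V n k)
  V-run k σ σ' m m' e = lemma (Shape.b (shapeOf m)) (Shape.b (shapeOf m')) refl refl
    where
    te = run-t m m' e
    same : ∀ δ → Shape.b (shapeOf m) ≡ Shape.b (shapeOf m') → Vδ δ n k σ ≡ Vδ δ n k σ'
    same δ p = V-changes δ δ k m m' (cong₂ (λ b t → (if agree δ b then 0 else 1) ℕ.+ t) p te)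
    swap : ∀ δ → Shape.b (shapeOf m) ≡ not (Shape.b (shapeOf m')) → Vδ δ n k σ ≡ Vδ (not δ) n k σ'
    swap δ p = V-changes δ (not δ) k m m' (cong₂ ℕ._+_
      (trans (cong (λ b → if agree δ b then 0 else 1) p) (flip δ (Shape.b (shapeOf m')))) te)
      where
      flip : ∀ δ b → (if agree δ (not b) then 0 else 1) ≡ (if agree (not δ) b then 0 else 1)
      flip true  b     = refl
      flip false true  = refl
      flip false false = refl
    lemma : ∀ b b' → Shape.b (shapeOf m) ≡ b → Shape.b (shapeOf m') ≡ b' → V n k σ ≡ V n k σ'
    lemma true  true  p q = cong₂ _+_ (same true (trans p (sym q))) (same false (trans p (sym q)))
    lemma false false p q = cong₂ _+_ (same true (trans p (sym q))) (same false (trans p (sym q)))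
    lemma true  false p q = trans (cong₂ _+_ (swap true (trans p (cong not (sym q)))) (swap false (trans p (cong not (sym q)))))
                              (ℚ.+-comm (V⁻ n k σ') (V⁺ n k σ'))
    lemma false true  p q = trans (cong₂ _+_ (swap true (trans p (cong not (sym q)))) (swap false (trans p (cong not (sym q)))))
                              (ℚ.+-comm (V⁻ n k σ') (V⁺ n k σ'))

  -- The summand with δ = b is positive, and the other is a count too, so they cannot cancel.
  V-nonzero-run : ∀ {σ} (m : σ ∈ perms n) → V n (suc (Shape.t (shapeOf m))) σ ≢ 0ℚ
  V-nonzero-run {σ} m e = nat≢0 {h true ℕ.+ h false} (positive b refl)
    (trans (nat-+ (h true) (h false)) (trans (sym (cong₂ _+_ (V≡ true (suc t)) (V≡ false (suc t)))) e))
    where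
    open Shape (shapeOf m)
    h = λ δ → H δ (suc t) (b ∷ bs)
    positive-b : ∀ δ → b ≡ δ → 0 ℕ.< h δ
    positive-b δ refl = H-pos b (suc t) (b ∷ bs) (ℕ.≤-reflexive (cong suc (ch-b m)))
    positive : ∀ δ → b ≡ δ → 0 ℕ.< h true ℕ.+ h false
    positive true  p = ℕ.≤-trans (positive-b true p) (ℕ.m≤m+n (h true) (h false))
    positive false p = ℕ.≤-trans (positive-b false p) (ℕ.m≤n+m (h false) (h true))

  V-zero-run : ∀ k {σ} (m : σ ∈ perms n) → k ℕ.≤ Shape.t (shapeOf m) → V n k σ ≡ 0ℚ
  V-zero-run k m p = cong₂ _+_ (V-zero true k m (ℕ.≤-trans p (t≤ch true m))) (V-zero false k m (ℕ.≤-trans p (t≤ch false m)))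

  data Gen⁰ : A n → Set where
    gen : ∀ k → Gen⁰ (V n k)

  described⁰ : Described run Gen⁰ (λ k → V n (suc k) ∷ []) (List.map (V n) (fromTo 1 (n ∸ 1))) (List.map (W n) (fromTo 1 (n ∸ 1)))
  described⁰ = record
    { bound   = n ∸ 1
    ; gen     = λ { _ (gen k) → V-run k }
    ; all-gen = λ { k _ (here refl) → gen (suc k) }
    ; fin-gen = gens-map (V n) (fromTo 1 (n ∸ 1)) (λ k _ → gen k)
    ; fin-all = gens-map (V n) (fromTo 1 (n ∸ 1)) in-all
    ; fin-tri = λ σ₀ m₀ → V n (suc (Shape.t (shapeOf m₀))) , ∈-map⁺ (V n) (∈-fromTo⁺ (t<n∸1 m₀)) , V-nonzero-run m₀ ,
        λ σ m lt → V-zero-run _ m (run-t< m₀ m lt)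
    ; w-inv   = gens-map (W n) (fromTo 1 (n ∸ 1)) (λ k _ σ σ' m m' e → cong (λ r → ind (r ≡ᵇ k)) e)
    ; w-tri   = ind-Triangular run _ λ σ₀ m₀ → (λ σ → run σ ≡ᵇ run σ₀) ,
        ∈-map⁺ (W n) (subst (_∈ fromTo 1 (n ∸ 1)) (sym (Shape.run≡ (shapeOf m₀))) (∈-fromTo⁺ (t<n∸1 m₀))) ,
        ≡ᵇ-refl (run σ₀) , λ σ m e → ≡ᵇ-sound (run σ) (run σ₀) e }
    where
    in-all : ∀ k → k ∈ fromTo 1 (n ∸ 1) → V n k ∈ concatMap (λ k → V n (suc k) ∷ []) (upTo (n ∸ 1))
    in-all k k∈ with t , refl , t< ← ∈-fromTo⁻ k∈ = ∈-concatMap _ (∈-upTo⁺ t<) (here refl)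

  data Gen⁺ : A n → Set where
    gen : ∀ k → Gen⁺ (V⁺ n k)

  private
    run°-ch : ∀ {σ σ'} (m : σ ∈ perms n) (m' : σ' ∈ perms n) → run° σ ≡ run° σ' → Shape.ch (shapeOf m) true ≡ Shape.ch (shapeOf m') true
    run°-ch m m' e = ℕ.suc-injective (trans (sym (Shape.run°≡ (shapeOf m))) (trans e (Shape.run°≡ (shapeOf m'))))

  -- Here `run°` is 1 + `ch true`, which is bounded by `n` and not by n - 1; hence the longer lists.
  described⁺ : Described run° Gen⁺ (λ k → V⁺ n (suc k) ∷ []) (List.map (V⁺ n) (fromTo 1 n)) (List.map (W° n) (fromTo 1 n))
  described⁺ = record
    { bound   = n
    ; gen     = λ { _ (gen k) σ σ' m m' e → V-changes true true k m m' (run°-ch m m' e) }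
    ; all-gen = λ { k _ (here refl) → gen (suc k) }
    ; fin-gen = gens-map (V⁺ n) (fromTo 1 n) (λ k _ → gen k)
    ; fin-all = gens-map (V⁺ n) (fromTo 1 n) in-all
    ; fin-tri = λ σ₀ m₀ → V⁺ n (suc (Shape.ch (shapeOf m₀) true)) , ∈-map⁺ (V⁺ n) (∈-fromTo⁺ (ch<n true m₀)) ,
        V-nonzero true _ m₀ ℕ.≤-refl ,
        λ σ m lt → V-zero true _ m (ℕ.≤-pred (subst₂ ℕ._<_ (Shape.run°≡ (shapeOf m₀)) (Shape.run°≡ (shapeOf m)) lt))
    ; w-inv   = gens-map (W° n) (fromTo 1 n) (λ k _ σ σ' m m' e → cong (λ r → ind (r ≡ᵇ k)) e)
    ; w-tri   = ind-Triangular run° _ λ σ₀ m₀ → (λ σ → run° σ ≡ᵇ run° σ₀) ,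
        ∈-map⁺ (W° n) (subst (_∈ fromTo 1 n) (sym (Shape.run°≡ (shapeOf m₀))) (∈-fromTo⁺ (ch<n true m₀))) ,
        ≡ᵇ-refl (run° σ₀) , λ σ m e → ≡ᵇ-sound (run° σ) (run° σ₀) e }
    where
    in-all : ∀ k → k ∈ fromTo 1 n → V⁺ n k ∈ concatMap (λ k → V⁺ n (suc k) ∷ []) (upTo n)
    in-all k k∈ with t , refl , t< ← ∈-fromTo⁻ k∈ = ∈-concatMap _ (∈-upTo⁺ t<) (here refl)

  private
    ∈-range : ∀ {p : ℕ → Bool} {k b} → k ℕ.< b → T (p k) → k ∈ filterᵇ p (upTo b)
    ∈-range {p} lt t = ∈-filter⁺ (T? ∘ p) (∈-upTo⁺ lt) t

    range-∈ : ∀ {p : ℕ → Bool} {k} b → k ∈ filterᵇ p (upTo b) → k ℕ.< b × T (p k)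
    range-∈ {p} b m with i , t ← ∈-filter⁻ (T? ∘ p) {xs = upTo b} m = ∈-upTo⁻ i , t

  data GenP : A n → Set where
    gen : ∀ k → GenP (V⁻ n (2 ℕ.* k))

  evens : List ℕ
  evens = filterᵇ (λ k → (1 ≤ᵇ 2 ℕ.* k) ∧ (2 ℕ.* k ≤ᵇ n ℕ.+ 1)) (upTo (n ℕ.+ 2))

  private
    -- Places the pivot index in the finite list: c < n gives 2⌊c/2⌋ + 2 ≤ n + 1.
    pk≤ : ∀ {σ} (m : σ ∈ perms n) → 2 ℕ.* suc (pk σ) ℕ.≤ n ℕ.+ 1
    pk≤ {σ} m rewrite Shape.pk≡ (shapeOf m) = ℕ.≤-trans (ℕ.≤-reflexive (ℕ.*-suc 2 ⌊ c /2⌋))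
      (ℕ.≤-trans (ℕ.+-monoʳ-≤ 2 (2⌊/2⌋≤ c)) (ℕ.≤-trans (s≤s (ch<n false m)) (ℕ.≤-reflexive (ℕ.+-comm 1 n))))
      where c = Shape.ch (shapeOf m) false

    pk<n+1 : ∀ {σ} (m : σ ∈ perms n) → suc (pk σ) ℕ.< n ℕ.+ 2
    pk<n+1 {σ} m = ℕ.≤-trans (s≤s (ℕ.≤-trans (ℕ.m≤m+n (suc (pk σ)) _) (pk≤ m))) (ℕ.≤-reflexive (sym (ℕ.+-suc n 1)))

    pk°≤ : ∀ {σ} (m : σ ∈ perms n) → 2 ℕ.* pk° σ ℕ.≤ n
    pk°≤ {σ} m rewrite Shape.pk°≡ (shapeOf m) = ℕ.≤-trans (2⌊/2⌋≤ (suc (Shape.ch (shapeOf m) true))) (ch<n true m)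

  -- At p peaks `ch false` is 2p or 2p + 1, and with more peaks it is at least 2p + 2. So 2p + 2 is
  -- the even index that separates them.
  V⁻ev-tri : Triangular pk (List.map (λ k → V⁻ n (2 ℕ.* k)) evens)
  V⁻ev-tri σ₀ m₀ = V⁻ n (2 ℕ.* suc (pk σ₀)) ,
    ∈-map⁺ (λ k → V⁻ n (2 ℕ.* k)) (∈-range (pk<n+1 m₀) (Equivalence.from T-∧ (_ , ℕ.≤⇒≤ᵇ (pk≤ m₀)))) ,
    V-nonzero false _ m₀ (subst (λ p → Shape.ch (shapeOf m₀) false ℕ.< 2 ℕ.* suc p) (sym (Shape.pk≡ (shapeOf m₀))) (<2⌊/2⌋+2 _)) ,
    λ σ m lt → V-zero false _ m (ℕ.≤-trans (ℕ.*-monoʳ-≤ 2 (subst (pk σ₀ ℕ.<_) (Shape.pk≡ (shapeOf m)) lt)) (2⌊/2⌋≤ _))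

  describedP : Described pk GenP (λ k → V⁻ n (2 ℕ.* suc k) ∷ []) (List.map (λ k → V⁻ n (2 ℕ.* k)) evens)
    (List.map (Pk n) (upTo (suc n)))
  describedP = record
    { bound   = n ℕ.+ 2
    ; gen     = λ { _ (gen k) σ σ' m m' e → V-even false false k m m' (trans (sym (Shape.pk≡ (shapeOf m))) (trans e (Shape.pk≡ (shapeOf m')))) }
    ; all-gen = λ { k _ (here refl) → gen (suc k) }
    ; fin-gen = gens-map _ evens (λ k _ → gen k)
    ; fin-all = gens-map (λ k → V⁻ n (2 ℕ.* k)) evens in-all
    ; fin-tri = V⁻ev-tri
    ; w-inv   = gens-map (Pk n) (upTo (suc n)) (λ k _ σ σ' m m' e → cong (λ r → ind (r ≡ᵇ k)) e)
    ; w-tri   = ind-Triangular pk _ λ σ₀ m₀ → (λ σ → pk σ ≡ᵇ pk σ₀) ,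
        ∈-map⁺ (Pk n) (∈-upTo⁺ (ℕ.≤-trans (s≤s (ℕ.≤-trans (ℕ.≤-reflexive (Shape.pk≡ (shapeOf m₀)))
          (ℕ.≤-trans (ℕ.⌊n/2⌋≤n _) (ℕ.<⇒≤ (ch<n false m₀))))) ℕ.≤-refl)) ,
        ≡ᵇ-refl (pk σ₀) , λ σ m e → ≡ᵇ-sound (pk σ) (pk σ₀) e }
    where
    in-all : ∀ k → k ∈ evens → V⁻ n (2 ℕ.* k) ∈ concatMap (λ k → V⁻ n (2 ℕ.* suc k) ∷ []) (upTo (n ℕ.+ 2))
    in-all k k∈ with range-∈ (n ℕ.+ 2) k∈
    -- The filter condition 1 ≤ 2k leaves only successors, which matches the shifted index of the
    -- family.
    in-all (suc k) _ | lt , _ = ∈-concatMap _ (∈-upTo⁺ (ℕ.<-trans (ℕ.n<1+n k) lt)) (here refl)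

  data GenP° : A n → Set where
    gen : ∀ k → GenP° (V⁺ n (2 ℕ.* k ℕ.+ 1))

  odds : List ℕ
  odds = filterᵇ (λ k → (1 ≤ᵇ 2 ℕ.* k ℕ.+ 1) ∧ (2 ℕ.* k ℕ.+ 1 ≤ᵇ n ℕ.+ 1)) (upTo (n ℕ.+ 2))

  private
    1≤2k+1 : ∀ k → T (1 ≤ᵇ 2 ℕ.* k ℕ.+ 1)
    1≤2k+1 k = ℕ.≤⇒≤ᵇ (ℕ.m≤n+m 1 (2 ℕ.* k))

    k≤2*k : ∀ k → k ℕ.≤ 2 ℕ.* k
    k≤2*k k = ℕ.m≤m+n k _

  -- At p left peaks `ch true` is at most 2p, and with more left peaks it is at least 2p + 1. So 2p
  -- + 1 is the separating odd index.
  V⁺od-tri : Triangular pk° (List.map (λ k → V⁺ n (2 ℕ.* k ℕ.+ 1)) odds)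
  V⁺od-tri σ₀ m₀ = V⁺ n (2 ℕ.* pk° σ₀ ℕ.+ 1) ,
    ∈-map⁺ (λ k → V⁺ n (2 ℕ.* k ℕ.+ 1)) (∈-range
      (ℕ.≤-trans (s≤s (ℕ.≤-trans (k≤2*k (pk° σ₀)) (pk°≤ m₀))) (ℕ.≤-trans (ℕ.n≤1+n _) (ℕ.≤-reflexive (ℕ.+-comm 2 n))))
      (Equivalence.from T-∧ (1≤2k+1 (pk° σ₀) , ℕ.≤⇒≤ᵇ (ℕ.+-monoˡ-≤ 1 (pk°≤ m₀))))) ,
    V-nonzero true _ m₀ (ℕ.≤-trans (s≤s (subst (λ q → Shape.ch (shapeOf m₀) true ℕ.≤ 2 ℕ.* q) (sym (Shape.pk°≡ (shapeOf m₀))) (≤2⌈/2⌉ _)))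
      (ℕ.≤-reflexive (ℕ.+-comm 1 (2 ℕ.* pk° σ₀)))) ,
    λ σ m lt → V-zero true _ m (ℕ.≤-pred (ℕ.≤-trans (ℕ.≤-reflexive (eq (pk° σ₀)))
      (ℕ.≤-trans (ℕ.*-monoʳ-≤ 2 (subst (pk° σ₀ ℕ.<_) (Shape.pk°≡ (shapeOf m)) lt)) (2⌊/2⌋≤ (suc (Shape.ch (shapeOf m) true))))))
    where eq : ∀ q → suc (2 ℕ.* q ℕ.+ 1) ≡ 2 ℕ.* suc q
          eq = solve-∀

  describedP° : Described pk° GenP° (λ k → V⁺ n (2 ℕ.* k ℕ.+ 1) ∷ []) (List.map (λ k → V⁺ n (2 ℕ.* k ℕ.+ 1)) odds)
    (List.map (Pk° n) (upTo (suc n)))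
  describedP° = record
    { bound   = n ℕ.+ 2
    ; gen     = λ { _ (gen k) σ σ' m m' e → V-odd true true k m m' (trans (sym (Shape.pk°≡ (shapeOf m))) (trans e (Shape.pk°≡ (shapeOf m')))) }
    ; all-gen = λ { k _ (here refl) → gen k }
    ; fin-gen = gens-map _ odds (λ k _ → gen k)
    ; fin-all = gens-map (λ k → V⁺ n (2 ℕ.* k ℕ.+ 1)) odds
        (λ k k∈ → ∈-concatMap _ (∈-upTo⁺ (proj₁ (range-∈ (n ℕ.+ 2) k∈))) (here refl))
    ; fin-tri = V⁺od-tri
    ; w-inv   = gens-map (Pk° n) (upTo (suc n)) (λ k _ σ σ' m m' e → cong (λ r → ind (r ≡ᵇ k)) e)
    ; w-tri   = ind-Triangular pk° _ λ σ₀ m₀ → (λ σ → pk° σ ≡ᵇ pk° σ₀) ,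
        ∈-map⁺ (Pk° n) (∈-upTo⁺ (s≤s (ℕ.≤-trans (k≤2*k (pk° σ₀)) (pk°≤ m₀)))) ,
        ≡ᵇ-refl (pk° σ₀) , λ σ m e → ≡ᵇ-sound (pk° σ) (pk° σ₀) e }

  -- The first direction is forgotten exactly when the number of runs is even, where 𝒞 contains only
  -- the sum of W⁺ and W⁻.
  SC : Word n → ℕ
  SC σ = code (run σ) (even (run σ) ∨ asc σ)

  data GenC : A n → Set where
    odd-gen  : ∀ δ k → GenC (Vδ δ n (2 ℕ.* k ℕ.+ 1))
    even-gen : ∀ k → GenC (V n (2 ℕ.* k))

  private
    refines-SC : Inv run ⊆S Inv SC
    refines-SC = Inv-mono run SC (λ σ σ' m m' e → proj₁ (code-injective (run σ) (run σ') _ _ e))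

    SC-cases : ∀ σ σ' → SC σ ≡ SC σ' → run σ ≡ run σ' × ((∃ λ j → run σ ≡ 2 ℕ.* j) ⊎ asc σ ≡ asc σ')
    SC-cases σ σ' e with p , q ← code-injective (run σ) (run σ') _ _ e with parity (run σ)
    ... | inj₁ (_ , j) = p , inj₁ j
    ... | inj₂ (o , _) = p , inj₂ (trans (sym (cong (_∨ asc σ) o))
            (trans q (cong (_∨ asc σ') (trans (cong even (sym p)) o))))

    -- With 2j runs, t = 2j - 1, so `ch δ` is 2j - 1 or 2j, and both halves round up to j. Hence the
    -- V's of odd index cannot see the first direction of such a permutation.
    ⌈ch/2⌉ : ∀ δ {σ} (m : σ ∈ perms n) j → run σ ≡ 2 ℕ.* j → ⌈ Shape.ch (shapeOf m) δ /2⌉ ≡ j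
    ⌈ch/2⌉ δ m j e with agree δ (Shape.b (shapeOf m))
    ... | true  = trans (cong ⌊_/2⌋ t≡) (⌊k*2/2⌋ j)
      where t≡ = trans (sym (Shape.run≡ (shapeOf m))) (trans e (ℕ.*-comm 2 j))
    ... | false = trans (cong (λ z → ⌊ suc z /2⌋) t≡) (⌊1+k*2/2⌋ j)
      where t≡ = trans (sym (Shape.run≡ (shapeOf m))) (trans e (ℕ.*-comm 2 j))

  GenC-Inv : ∀ g → GenC g → Inv SC g
  GenC-Inv _ (even-gen k) = refines-SC _ (V-run (2 ℕ.* k))
  GenC-Inv _ (odd-gen δ k) σ σ' m m' e with SC-cases σ σ' e
  ... | p , inj₁ (j , r) = V-odd δ δ k m m' (trans (⌈ch/2⌉ δ m j r) (sym (⌈ch/2⌉ δ m' j (trans (sym p) r))))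
  ... | p , inj₂ q       = V-odd δ δ k m m' (cong ⌈_/2⌉
          (cong₂ (λ b t → (if agree δ b then 0 else 1) ℕ.+ t) (asc-b m m' q) (run-t m m' p)))

  oddsC evensC : List ℕ
  oddsC  = filterᵇ (λ k → (1 ≤ᵇ 2 ℕ.* k ℕ.+ 1) ∧ (2 ℕ.* k ℕ.+ 1 <ᵇ n)) (upTo n)
  evensC = filterᵇ (λ l → (1 ≤ᵇ 2 ℕ.* l) ∧ (2 ℕ.* l <ᵇ n)) (upTo n)

  oddVs evenVs evenWs oddWs : List (A n)
  oddVs  = concatMap (λ k → V⁺ n (2 ℕ.* k ℕ.+ 1) ∷ V⁻ n (2 ℕ.* k ℕ.+ 1) ∷ []) oddsC
  evenVs = List.map (λ l → V n (2 ℕ.* l)) evensC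
  evenWs = List.map (W n) (filterᵇ (λ k → k % 2 ≡ᵇ 0) (fromTo 1 (n ∸ 1)))
  oddWs  = concatMap (λ k → W⁺ n k ∷ W⁻ n k ∷ []) (filterᵇ (λ k → k % 2 ≡ᵇ 1) (fromTo 1 (n ∸ 1)))

  private
    run<n : ∀ {σ} (m : σ ∈ perms n) → run σ ℕ.< n
    run<n {σ} m rewrite Shape.run≡ (shapeOf m) = subst (suc (suc (Shape.t (shapeOf m))) ℕ.≤_) (Shape.length≡ (shapeOf m))
      (s≤s (s≤s (changes≤length (Shape.b (shapeOf m)) (Shape.bs (shapeOf m)))))

    run∈ : ∀ {σ} (m : σ ∈ perms n) → run σ ∈ fromTo 1 (n ∸ 1)
    run∈ m = subst (_∈ fromTo 1 (n ∸ 1)) (sym (Shape.run≡ (shapeOf m))) (∈-fromTo⁺ (t<n∸1 m))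

  -- The pivot has index `run σ₀`. For an even number of runs it is V, and a larger value of `SC`
  -- means a larger `run`. For an odd number it is V^b, with the argument of `V±-tri`.
  VC-tri : Triangular SC (oddVs ++ evenVs)
  VC-tri σ₀ m₀ with parity (run σ₀)
  ... | inj₁ (ev , j , e) = V n (2 ℕ.* j) , ∈-++⁺ʳ oddVs (∈-map⁺ (λ l → V n (2 ℕ.* l))
        (∈-range (ℕ.≤-<-trans (k≤2*k j) 2j<n) (Equivalence.from T-∧ (ℕ.≤⇒≤ᵇ (subst (1 ℕ.≤_) e (s≤s z≤n)) , ℕ.<⇒<ᵇ 2j<n)))) ,
        subst (λ k → V n k σ₀ ≢ 0ℚ) (trans (sym run≡) e) (V-nonzero-run m₀) ,
        λ σ m lt → V-zero-run (2 ℕ.* j) m (subst (ℕ._≤ Shape.t (shapeOf m)) (trans (sym run≡) e) (run-t< m₀ m (above σ lt)))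
    where
    open Shape (shapeOf m₀)
    2j<n : 2 ℕ.* j ℕ.< n
    2j<n = subst (ℕ._< n) e (run<n m₀)
    above : ∀ σ → SC σ₀ ℕ.< SC σ → run σ₀ ℕ.< run σ
    above σ lt with code-< (run σ₀) (run σ) _ _ lt
    ... | inj₁ p = p
    ... | inj₂ (p , _ , q) = contradiction (trans (sym (cong (_∨ asc σ) (trans (cong even (sym p)) ev))) q) λ ()
  ... | inj₂ (od , _ , j , e) = Vδ b n (2 ℕ.* j ℕ.+ 1) , ∈-++⁺ˡ (∈-concatMap _
        (∈-range (ℕ.≤-<-trans (ℕ.≤-trans (k≤2*k j) (ℕ.m≤m+n _ 1)) r<n) (Equivalence.from T-∧ (1≤2k+1 j , ℕ.<⇒<ᵇ r<n)))
        (pair-∈ (λ δ → Vδ δ n (2 ℕ.* j ℕ.+ 1)) [] b)) ,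
        subst (λ k → Vδ b n k σ₀ ≢ 0ℚ) k≡ (V-nonzero b (suc t) m₀ (ℕ.≤-reflexive (cong suc (ch-b m₀)))) ,
        λ σ m lt → subst (λ k → Vδ b n k σ ≡ 0ℚ) k≡ (V-zero b (suc t) m (above σ m lt))
    where
    open Shape (shapeOf m₀)
    k≡ : suc t ≡ 2 ℕ.* j ℕ.+ 1
    k≡ = trans (sym run≡) e
    r<n : 2 ℕ.* j ℕ.+ 1 ℕ.< n
    r<n = subst (ℕ._< n) e (run<n m₀)
    above : ∀ σ (m : σ ∈ perms n) → SC σ₀ ℕ.< SC σ → suc t ℕ.≤ Shape.ch (shapeOf m) b
    above σ m lt with code-< (run σ₀) (run σ) _ _ lt
    ... | inj₁ p = ℕ.≤-trans (run-t< m₀ m p) (t≤ch b m)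
    ... | inj₂ (p , q , q') = ℕ.≤-reflexive (sym (trans (ch-not b m opp) (cong suc (sym (run-t m₀ m p)))))
      where
      asc₀ : asc σ₀ ≡ true
      asc₀ = trans (sym (cong (_∨ asc σ₀) od)) q
      asc₁ : asc σ ≡ false
      asc₁ = trans (sym (cong (_∨ asc σ) (trans (cong even (sym p)) od))) q'
      opp : Shape.b (shapeOf m) ≡ not b
      opp = trans (sym (Shape.first≡ (shapeOf m))) (trans asc₁ (cong not (sym (trans (sym first≡) asc₀))))

  WC-inv : ∀ δ k → (k % 2 ≡ᵇ 1) ≡ true → Inv SC (Wδ δ k)
  WC-inv δ k od σ σ' m m' e with SC-cases σ σ' e
  ... | p , inj₂ q = subst (λ w → w σ ≡ w σ') (Wδ-isW δ k) (cong ind (isW-cong δ k σ σ' p q))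
  ... | p , inj₁ (j , r) = subst (λ w → w σ ≡ w σ') (Wδ-isW δ k) (cong ind (trans (off σ r) (sym (off σ' (trans (sym p) r)))))
    where
    off : ∀ σ → run σ ≡ 2 ℕ.* j → isW δ k σ ≡ false
    off σ r with isW δ k σ in eq
    ... | false = refl
    ... | true  = contradiction (trans (sym od) (cong (_≡ᵇ 1) (trans (cong (_% 2)
            (trans (sym (proj₁ (isW-sound δ k σ eq))) (trans r (ℕ.*-comm 2 j)))) (m*n%n≡0 j 2)))) λ ()

  WC-tri : Triangular SC (evenWs ++ oddWs)
  WC-tri = ind-Triangular SC _ go
    where
    go : ∀ σ₀ → σ₀ ∈ perms n → ∃ λ (p : Word n → Bool) → (λ σ → ind (p σ)) ∈ (evenWs ++ oddWs) × p σ₀ ≡ true ×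
      (∀ σ → σ ∈ perms n → p σ ≡ true → SC σ ≡ SC σ₀)
    go σ₀ m₀ with parity (run σ₀)
    ... | inj₁ (ev , _) = (λ σ → run σ ≡ᵇ run σ₀) ,
          ∈-++⁺ˡ (∈-map⁺ (W n) (∈-filter⁺ (T? ∘ λ k → k % 2 ≡ᵇ 0) (run∈ m₀) (Equivalence.from T-≡ ev))) ,
          ≡ᵇ-refl (run σ₀) ,
          λ σ m e → let p = ≡ᵇ-sound (run σ) (run σ₀) e in
            cong₂ code p (trans (cong (_∨ asc σ) (trans (cong even p) ev)) (sym (cong (_∨ asc σ₀) ev)))
    ... | inj₂ (_ , od , _) = isW (asc σ₀) (run σ₀) ,
          subst (_∈ evenWs ++ oddWs) (sym (Wδ-isW (asc σ₀) (run σ₀)))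
            (∈-++⁺ʳ evenWs (∈-concatMap _ (∈-filter⁺ (T? ∘ λ k → k % 2 ≡ᵇ 1) (run∈ m₀) (Equivalence.from T-≡ od))
              (pair-∈ (λ δ → Wδ δ (run σ₀)) [] (asc σ₀)))) ,
          isW-complete σ₀ ,
          λ σ m e → let p , q = isW-sound (asc σ₀) (run σ₀) σ e in cong₂ (λ r a → code r (even r ∨ a)) p q

  private
    gens-++ : ∀ {P : A n → Set} xs {ys} → (∀ g → g ∈ xs → P g) → (∀ g → g ∈ ys → P g) → ∀ g → g ∈ xs ++ ys → P g
    gens-++ xs h h' g m with ∈-++⁻ xs m
    ... | inj₁ i = h g i
    ... | inj₂ i = h' g i

  familyC : ℕ → List (A n)
  familyC k = V⁺ n (2 ℕ.* k ℕ.+ 1) ∷ V⁻ n (2 ℕ.* k ℕ.+ 1) ∷ V n (2 ℕ.* k) ∷ []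

  describedC : Described SC GenC familyC (oddVs ++ evenVs) (evenWs ++ oddWs)
  describedC = record
    { bound   = n
    ; gen     = GenC-Inv
    ; all-gen = λ { k _ (here refl) → odd-gen true k ; k _ (there (here refl)) → odd-gen false k
                  ; k _ (there (there (here refl))) → even-gen k }
    ; fin-gen = gens-++ oddVs
        (gens-concatMap _ oddsC (λ { k _ _ (here refl) → odd-gen true k ; k _ _ (there (here refl)) → odd-gen false k }))
        (gens-map _ evensC (λ k _ → even-gen k))
    ; fin-all = gens-++ oddVs
        (gens-concatMap {P = λ g → g ∈ concatMap familyC (upTo n)} _ oddsC (λ
          { k k∈ _ (here refl)         → ∈-concatMap familyC (∈-upTo⁺ (proj₁ (range-∈ n k∈))) (here refl)
          ; k k∈ _ (there (here refl)) → ∈-concatMap familyC (∈-upTo⁺ (proj₁ (range-∈ n k∈))) (there (here refl)) }))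
        (gens-map (λ l → V n (2 ℕ.* l)) evensC
          (λ k k∈ → ∈-concatMap familyC (∈-upTo⁺ (proj₁ (range-∈ n k∈))) (there (there (here refl)))))
    ; fin-tri = VC-tri
    ; w-inv   = gens-++ evenWs
        (gens-map (W n) _ (λ k _ → refines-SC _ (λ σ σ' m m' e → cong (λ r → ind (r ≡ᵇ k)) e)))
        (gens-concatMap _ _ (λ k k∈ g i → let δ , e = W±-gens k g i in
          subst (Inv SC) (sym e) (WC-inv δ k (Equivalence.to T-≡ (proj₂ (∈-filter⁻ (T? ∘ λ k → k % 2 ≡ᵇ 1) {xs = fromTo 1 (n ∸ 1)} k∈))))))
    ; w-tri   = WC-tri }

  -- Products of the generators

  ≈-trans : {x y z : A n} → x ≈ y → y ≈ z → x ≈ z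
  ≈-trans p q σ m = trans (p σ m) (q σ m)

  ≈-sym : {x y : A n} → x ≈ y → y ≈ x
  ≈-sym p σ m = sym (p σ m)

  ≈-reflexive : {x y : A n} → x ≡ y → x ≈ y
  ≈-reflexive refl σ m = refl

  -- For negative ε the signs of both summands are flipped k times, which at most exchanges the
  -- summands.
  ⊛-Vˡ : ∀ k ε l → (V n k ⊛ Vδ ε n l) ≈ V n (l ℕ.* k)
  ⊛-Vˡ k ε l σ m = trans (⊛-distribʳ (V⁺ n k) (V⁻ n k) (Vδ ε n l) σ m)
    (trans (cong₂ _+_ (⊛-V true ε k l σ m) (⊛-V false ε k l σ m)) (lemma ε (sg true k) (sg-not true k)))
    where
    lemma : ∀ ε s → sg false k ≡ not s →
      Vδ (if ε then true else s) n (l ℕ.* k) σ + Vδ (if ε then false else sg false k) n (l ℕ.* k) σ ≡ V n (l ℕ.* k) σ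
    lemma true  s     e = refl
    lemma false true  e rewrite e = refl
    lemma false false e rewrite e = ℚ.+-comm (V⁻ n (l ℕ.* k) σ) (V⁺ n (l ℕ.* k) σ)

  ⊛-VV : ∀ k l → (V n k ⊛ V n l) ≈ (V n (l ℕ.* k) ⊕ V n (l ℕ.* k))
  ⊛-VV k l σ m = trans (⊛-distribˡ (V n k) (V⁺ n l) (V⁻ n l) σ m)
    (cong₂ _+_ (⊛-Vˡ k true l σ m) (⊛-Vˡ k false l σ m))

  -- An odd number of flips is one flip, so the sign of the result is the product of the signs δ and
  -- ε, a rule symmetric in the two factors.
  ⊛-V-odd : ∀ δ j ε l → (Vδ δ n (2 ℕ.* j ℕ.+ 1) ⊛ Vδ ε n l) ≈ Vδ (if ε then δ else not δ) n (l ℕ.* (2 ℕ.* j ℕ.+ 1))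
  ⊛-V-odd δ j ε l = ≈-trans (⊛-V δ ε (2 ℕ.* j ℕ.+ 1) l)
    (≈-reflexive (cong (λ s → Vδ (if ε then δ else s) n (l ℕ.* (2 ℕ.* j ℕ.+ 1))) (sg-odd δ j)))

  ⊛-odd-V : ∀ δ j l → (Vδ δ n (2 ℕ.* j ℕ.+ 1) ⊛ V n l) ≈ V n (l ℕ.* (2 ℕ.* j ℕ.+ 1))
  ⊛-odd-V δ j l σ m = trans (⊛-distribˡ (Vδ δ n (2 ℕ.* j ℕ.+ 1)) (V⁺ n l) (V⁻ n l) σ m)
    (trans (cong₂ _+_ (⊛-V-odd δ j true l σ m) (⊛-V-odd δ j false l σ m)) (lemma δ))
    where
    lemma : ∀ δ → Vδ δ n (l ℕ.* (2 ℕ.* j ℕ.+ 1)) σ + Vδ (not δ) n (l ℕ.* (2 ℕ.* j ℕ.+ 1)) σ ≡ V n (l ℕ.* (2 ℕ.* j ℕ.+ 1)) σ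
    lemma true  = refl
    lemma false = ℚ.+-comm (V⁻ n (l ℕ.* (2 ℕ.* j ℕ.+ 1)) σ) (V⁺ n (l ℕ.* (2 ℕ.* j ℕ.+ 1)) σ)

  private
    odd*odd : ∀ i j → (2 ℕ.* i ℕ.+ 1) ℕ.* (2 ℕ.* j ℕ.+ 1) ≡ 2 ℕ.* (2 ℕ.* i ℕ.* j ℕ.+ i ℕ.+ j) ℕ.+ 1
    odd*odd = solve-∀

    Inv-resp : ∀ {S : Word n → ℕ} {x y : A n} → x ≈ y → Inv S y → Inv S x
    Inv-resp {S} = respₛ (Inv-isSubspace S)

    comm-V : ∀ δ k l → Vδ δ n (l ℕ.* k) ≈ Vδ δ n (k ℕ.* l)
    comm-V δ k l = ≈-reflexive (cong (Vδ δ n) (ℕ.*-comm l k))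

  closed± : ∀ g h → Gen± g → Gen± h → Inv S± (g ⊛ h)
  closed± _ _ (gen δ k) (gen ε l) = Inv-resp {S±} (⊛-V δ ε k l) (Gen±-Inv _ (gen (productSign ε δ k ε) (l ℕ.* k)))

  closed⁰ : ∀ g h → Gen⁰ g → Gen⁰ h → Inv run (g ⊛ h)
  closed⁰ _ _ (gen k) (gen l) = Inv-resp {run} (⊛-VV k l) (addₛ (Inv-isSubspace run) (V-run (l ℕ.* k)) (V-run (l ℕ.* k)))

  comm⁰ : ∀ g h → Gen⁰ g → Gen⁰ h → (g ⊛ h) ≈ (h ⊛ g)
  comm⁰ _ _ (gen k) (gen l) = ≈-trans (⊛-VV k l) (≈-trans (≈-reflexive (cong (λ z → V n z ⊕ V n z) (ℕ.*-comm l k))) (≈-sym (⊛-VV l k)))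

  closed⁺ : ∀ g h → Gen⁺ g → Gen⁺ h → Inv run° (g ⊛ h)
  closed⁺ _ _ (gen k) (gen l) = Inv-resp {run°} (⊛-V true true k l) (Described.gen described⁺ _ (gen (l ℕ.* k)))

  comm⁺ : ∀ g h → Gen⁺ g → Gen⁺ h → (g ⊛ h) ≈ (h ⊛ g)
  comm⁺ _ _ (gen k) (gen l) = ≈-trans (⊛-V true true k l) (≈-trans (comm-V true k l) (≈-sym (⊛-V true true l k)))

  private
    -- The index 2k of the left factor makes the number of flips even, so the sign stays negative.
    ⊛-VP : ∀ k l → (V⁻ n (2 ℕ.* k) ⊛ V⁻ n (2 ℕ.* l)) ≈ V⁻ n (2 ℕ.* l ℕ.* (2 ℕ.* k))
    ⊛-VP k l = ≈-trans (⊛-V false false (2 ℕ.* k) (2 ℕ.* l))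
      (≈-reflexive (cong (λ s → Vδ s n (2 ℕ.* l ℕ.* (2 ℕ.* k))) (sg-2* false k)))

  closedP : ∀ g h → GenP g → GenP h → Inv pk (g ⊛ h)
  closedP _ _ (gen k) (gen l) = Inv-resp {pk} (⊛-VP k l)
    (subst (λ z → Inv pk (V⁻ n z)) (sym (ℕ.*-assoc 2 l (2 ℕ.* k))) (Described.gen describedP _ (gen (l ℕ.* (2 ℕ.* k)))))

  commP : ∀ g h → GenP g → GenP h → (g ⊛ h) ≈ (h ⊛ g)
  commP _ _ (gen k) (gen l) = ≈-trans (⊛-VP k l) (≈-trans (comm-V false (2 ℕ.* k) (2 ℕ.* l)) (≈-sym (⊛-VP l k)))

  closedP° : ∀ g h → GenP° g → GenP° h → Inv pk° (g ⊛ h)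
  closedP° _ _ (gen k) (gen l) = Inv-resp {pk°} (⊛-V true true (2 ℕ.* k ℕ.+ 1) (2 ℕ.* l ℕ.+ 1))
    (subst (λ z → Inv pk° (V⁺ n z)) (sym (odd*odd l k)) (Described.gen describedP° _ (gen (2 ℕ.* l ℕ.* k ℕ.+ l ℕ.+ k))))

  -- As a left factor, V⁺ of odd index takes on the sign ε of the right factor. As a right factor it
  -- is positive and leaves ε unchanged. Both products are V^ε with the same index.
  centralP° : ∀ g h → GenP° g → Gen± h → (g ⊛ h) ≈ (h ⊛ g)
  centralP° _ _ (gen k) (gen ε l) = ≈-trans (⊛-V-odd true k ε l)
    (≈-trans (≈-reflexive (cong₂ (λ s z → Vδ s n z) (lemma ε) (ℕ.*-comm l (2 ℕ.* k ℕ.+ 1)))) (≈-sym (⊛-V ε true l (2 ℕ.* k ℕ.+ 1))))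
    where
    lemma : ∀ ε → (if ε then true else false) ≡ ε
    lemma true  = refl
    lemma false = refl

  commP° : ∀ g h → GenP° g → GenP° h → (g ⊛ h) ≈ (h ⊛ g)
  commP° g _ p (gen l) = centralP° g _ p (gen true (2 ℕ.* l ℕ.+ 1))

  -- Odd times odd is again an odd generator. A product that involves an even generator is one or
  -- two copies of some V, hence a function of `run` alone.
  closedC : ∀ g h → GenC g → GenC h → Inv SC (g ⊛ h)
  closedC _ _ (odd-gen δ k) (odd-gen ε l) = Inv-resp {SC} (⊛-V-odd δ k ε (2 ℕ.* l ℕ.+ 1))
    (subst (λ z → Inv SC (Vδ (if ε then δ else not δ) n z)) (sym (odd*odd l k)) (GenC-Inv _ (odd-gen (if ε then δ else not δ) (2 ℕ.* l ℕ.* k ℕ.+ l ℕ.+ k))))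
  closedC _ _ (odd-gen δ k) (even-gen l) = Inv-resp {SC} (⊛-odd-V δ k (2 ℕ.* l)) (refines-SC _ (V-run (2 ℕ.* l ℕ.* (2 ℕ.* k ℕ.+ 1))))
  closedC _ _ (even-gen k) (odd-gen ε l) = Inv-resp {SC} (⊛-Vˡ (2 ℕ.* k) ε (2 ℕ.* l ℕ.+ 1)) (refines-SC _ (V-run ((2 ℕ.* l ℕ.+ 1) ℕ.* (2 ℕ.* k))))
  closedC _ _ (even-gen k) (even-gen l) = Inv-resp {SC} (⊛-VV (2 ℕ.* k) (2 ℕ.* l))
    (addₛ (Inv-isSubspace SC) V-SC V-SC)
    where V-SC = refines-SC _ (V-run (2 ℕ.* l ℕ.* (2 ℕ.* k)))

  commC : ∀ g h → GenC g → GenC h → (g ⊛ h) ≈ (h ⊛ g)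
  commC _ _ (odd-gen δ k) (odd-gen ε l) = ≈-trans (⊛-V-odd δ k ε (2 ℕ.* l ℕ.+ 1))
    (≈-trans (≈-reflexive (cong₂ (λ s z → Vδ s n z) (lemma δ ε) (ℕ.*-comm (2 ℕ.* l ℕ.+ 1) (2 ℕ.* k ℕ.+ 1))))
      (≈-sym (⊛-V-odd ε l δ (2 ℕ.* k ℕ.+ 1))))
    where
    lemma : ∀ δ ε → (if ε then δ else not δ) ≡ (if δ then ε else not ε)
    lemma true  true  = refl
    lemma true  false = refl
    lemma false true  = refl
    lemma false false = refl
  commC _ _ (odd-gen δ k) (even-gen l) = ≈-trans (⊛-odd-V δ k (2 ℕ.* l))
    (≈-trans (≈-reflexive (cong (V n) (ℕ.*-comm (2 ℕ.* l) (2 ℕ.* k ℕ.+ 1)))) (≈-sym (⊛-Vˡ (2 ℕ.* l) δ (2 ℕ.* k ℕ.+ 1))))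
  commC _ _ (even-gen k) (odd-gen ε l) = ≈-trans (⊛-Vˡ (2 ℕ.* k) ε (2 ℕ.* l ℕ.+ 1))
    (≈-trans (≈-reflexive (cong (V n) (ℕ.*-comm (2 ℕ.* l ℕ.+ 1) (2 ℕ.* k)))) (≈-sym (⊛-odd-V ε l (2 ℕ.* k))))
  commC _ _ (even-gen k) (even-gen l) = comm⁰ _ _ (gen (2 ℕ.* k)) (gen (2 ℕ.* l))

  -- Inclusions in the algebra of alternating runs

  private
    S±-run : ∀ σ σ' → S± σ ≡ S± σ' → run σ ≡ run σ' × asc σ ≡ asc σ'
    S±-run σ σ' = code-injective (run σ) (run σ') (asc σ) (asc σ')

    S±-ch : ∀ δ σ σ' (m : σ ∈ perms n) (m' : σ' ∈ perms n) → S± σ ≡ S± σ' → Shape.ch (shapeOf m) δ ≡ Shape.ch (shapeOf m') δ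
    S±-ch δ σ σ' m m' e with p , q ← S±-run σ σ' e =
      cong₂ (λ b t → (if agree δ b then 0 else 1) ℕ.+ t) (asc-b m m' q) (run-t m m' p)

  -- A function of `S` is a function of any statistic that determines `S`. The inclusion therefore
  -- reduces to showing that (run, asc) determines `S`.
  sub : ∀ {S Gen G vs ws} → Described S Gen G vs ws →
    (∀ σ σ' → σ ∈ perms n → σ' ∈ perms n → S± σ ≡ S± σ' → S σ ≡ S σ') → span ws ⊆S 𝒲± n
  sub {S} D h x s = proj₂ (Described.w≐Inv described±) x (Inv-mono S S± h x (proj₁ (Described.w≐Inv D) x s))

  sub⁰ : 𝒲 n ⊆S 𝒲± n
  sub⁰ = sub described⁰ (λ σ σ' _ _ e → proj₁ (S±-run σ σ' e))

  sub⁺ : 𝒲° n ⊆S 𝒲± n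
  sub⁺ = sub described⁺ (λ σ σ' m m' e → trans (Shape.run°≡ (shapeOf m)) (trans (cong suc (S±-ch true σ σ' m m' e)) (sym (Shape.run°≡ (shapeOf m')))))

  subP : 𝒫 n ⊆S 𝒲± n
  subP = sub describedP (λ σ σ' m m' e → trans (Shape.pk≡ (shapeOf m)) (trans (cong ⌊_/2⌋ (S±-ch false σ σ' m m' e)) (sym (Shape.pk≡ (shapeOf m')))))

  subP° : 𝒫° n ⊆S 𝒲± n
  subP° = sub describedP° (λ σ σ' m m' e → trans (Shape.pk°≡ (shapeOf m)) (trans (cong ⌈_/2⌉ (S±-ch true σ σ' m m' e)) (sym (Shape.pk°≡ (shapeOf m')))))

  subC : 𝒞 n ⊆S 𝒲± n
  subC = sub describedC (λ σ σ' _ _ e → let p , q = S±-run σ σ' e in cong₂ (λ r a → code r (even r ∨ a)) p q)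

theorem4p4 : (n : ℕ) → 2 ≤ n →
    -- W_n^± = span of the V^± and is an algebra
    ((V±all n ≐ V±fin n) × (V±fin n ≐ 𝒲± n) × ClosedUnder⊛ (𝒲± n))
    -- W_n
    × ((Vall n ≐ Vfin n) × (Vfin n ≐ 𝒲 n) × CommSubalgebraOf (𝒲 n) (𝒲± n))
    -- W°_n
    × ((V⁺all n ≐ V⁺fin n) × (V⁺fin n ≐ 𝒲° n) × CommSubalgebraOf (𝒲° n) (𝒲± n))
    -- P_n
    × ((V⁻evall n ≐ V⁻evfin n) × (V⁻evfin n ≐ 𝒫 n) × CommSubalgebraOf (𝒫 n) (𝒲± n))
    -- P°_n
    × ((V⁺odall n ≐ V⁺odfin n) × (V⁺odfin n ≐ 𝒫° n) × CommSubalgebraOf (𝒫° n) (𝒲± n))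
    -- C_n
    × ((VCall n ≐ VCfin n) × (VCfin n ≐ 𝒞 n) × CommSubalgebraOf (𝒞 n) (𝒲± n))
    -- P°_n is central in W_n^±
    × Central (𝒫° n) (𝒲± n)
theorem4p4 n 2≤n =
    (all≐fin d± , fin≐w d± , closed d± (closed± 2≤n))
  , (all≐fin d⁰ , fin≐w d⁰ , sub⁰ 2≤n , closed d⁰ (closed⁰ 2≤n) , commute d⁰ d⁰ (comm⁰ 2≤n))
  , (all≐fin d⁺ , fin≐w d⁺ , sub⁺ 2≤n , closed d⁺ (closed⁺ 2≤n) , commute d⁺ d⁺ (comm⁺ 2≤n))
  , (all≐fin dP , fin≐w dP , subP 2≤n , closed dP (closedP 2≤n) , commute dP dP (commP 2≤n))
  , (all≐fin dP° , fin≐w dP° , subP° 2≤n , closed dP° (closedP° 2≤n) , commute dP° dP° (commP° 2≤n))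
  , (all≐fin dC , fin≐w dC , subC 2≤n , closed dC (closedC 2≤n) , commute dC dC (commC 2≤n))
  , commute dP° d± (centralP° 2≤n)
  where
  open Described
  d±  = described± 2≤n
  d⁰  = described⁰ 2≤n
  d⁺  = described⁺ 2≤n
  dP  = describedP 2≤n
  dP° = describedP° 2≤n
  dC  = describedC 2≤n
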